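{- Assume $T$ is a $\forall\exists$-axiomatizable theory of C*-algebras and $P$ is a property definable by uniform families of existential formulas such that $T$ has a model satisfying $P$. Let $\mathfrak T_T$ be the space of functionals defined in the context (with $\Sigma$ the set of all quantifier-free $\mathcal L^+$-sentences). (1) There exists a dense $G_\delta$ subset $\mathfrak G$ of $\mathfrak T_T$ such that every $s\in\mathfrak G$ determines a unique model $A_s$ of $T$ and an interpretation $\bar a_s$ of the constants $\bar c$ in $A_s$ such that each sort $S$ in $A_s$ is the closure of $\{a_j^S:j\in\mathbb N\}$ and $s=s_{A_s,\bar a_s}$. (2) The set $\mathfrak G_P:=\{s\in\mathfrak G:A_s\text{ has }P\}$ is a $G_\delta$ subset of $\mathfrak G$. (3) Furthermore, if $T$ is a complete theory then $\mathfrak G_P$ is dense in $\mathfrak G$.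
   Context: Continuous logic for C*-algebras (language $\mathcal L$). A C*-algebra $A$ is viewed as a metric structure whose sorts are the balls $B_n(A)=\{a:\|a\|\le n\}$, $n\in\mathbb N$, with metric $\|x-y\|$, and whose functions are the restrictions to these balls of $+,\cdot,{}^*$, scalar multiplication by each $\lambda\in\mathbb C$, the constant $0$ (and $1$ for unital algebras) and the inclusions $B_m\to B_n$. Terms are *-polynomials, atomic formulas are distances between terms, and formulas are obtained from atomic ones by applying continuous functions $f:\mathbb R^n\to\mathbb R$ and the quantifiers $\sup_x,\inf_x$ over a sort; quantifier-free formulas use no quantifiers; existential formulas are those of the form $\inf_{\bar x}\varphi$ with $\varphi$ quantifier-free and nonnegative; $\varphi^A(\bar a)$ denotes the value. A theory is a set of sentences; $A\models T$ if $\varphi^A=0$ for all $\varphi\in T$; $T$ is complete if any two models assign the same value to each sentence. $T$ is $\forall\exists$-axiomatizable if it has a set of axioms of the form $\sup_{\bar x}\inf_{\bar y}\varphi(\bar x,\bar y)$ with $\varphi$ quantifier-free and nonnegative. Uniform families. A countable set $\mathcal F$ of nonnegative-valued formulas in the same free variables is a uniform family with respect to a theory $T'$ if all its members satisfy $|\varphi(\bar x)-\varphi(\bar y)|\le u(d(\bar x,\bar y))$ in all models of $T'$ for a common uniform continuity modulus $u$. $P$ is definable by uniform families of existential formulas if there are a theory $T'$ and uniform families $\mathcal F_n$ ($n\in\mathbb N$) with respect to $T'$, consisting of existential formulas, such that $A$ has $P$ iff $A\models T'$ and $\inf_{\varphi\in\mathcal F_n}\varphi^A(\bar a)=0$ for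 all $n$ and all $\bar a$ of the appropriate sort. Forcing set-up. $\mathcal L^+$ is obtained from $\mathcal L$ by adding, for each sort $S$, new constant symbols $c_n^S$, $n\in\mathbb N$; its sentences have the form $\varphi(\bar c)$ with $\varphi(\bar x)$ an $\mathcal L$-formula and $\bar c$ a tuple of new constants. Let $\Sigma$ be the set of all quantifier-free $\mathcal L^+$-sentences, a real vector space with seminorm $\|\varphi(\bar c)\|_T=\sup_{A,\bar a}|\varphi(\bar a)^A|$ over models $A$ of $T$ and tuples $\bar a$ of the appropriate sort. Given $A\models T$ and an assignment $\bar a=(a_i^S)$ of elements $a_i^S$ of sort $S$ in $A$ to all constants $c_i^S$, define the functional $s_{A,\bar a}$ on $\Sigma$ by $s_{A,\bar a}(\varphi(\bar c))=\varphi(\bar a)^A$. Let $\mathfrak T_T=\{s_{A,\bar a}:A\models T,\ \bar a\text{ in }A\}$, a weak*-compact subset of the dual of $(\Sigma,\|\cdot\|_T)$, with the relative weak* topology. -}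

module Defs where

open import Level using (Level; 0ℓ; _⊔_) renaming (suc to lsuc)
open import Algebra.Bundles using (AbelianGroup; CommutativeRing)
open import Algebra.Core using (Op₁; Op₂)
open import Algebra.Module.Bundles using (LeftModule)
open import Algebra.Structures using (IsRingWithoutOne)
import Algebra.Construct.DirectProduct as DirectProduct
import Algebra.Construct.NaturalChoice.Max as Max
import Algebra.Definitions.RawMonoid as Multiples
import Algebra.Properties.Ring as RingProperties
import Algebra.Solver.Ring.NaturalCoefficients.Default as SemiringSolver
open import Data.Bool.Base using (Bool; T)
open import Data.Empty using (⊥)
open import Data.Fin.Base using (Fin) renaming (zero to fzero; suc to fsuc)
open import Data.List.Base using (List; []; _∷_; _++_)
open import Data.List.Membership.Propositional using (_∈_)
open import Data.List.Relation.Unary.All using (All; []; _∷_; lookup)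
open import Data.Nat.Base using (ℕ) renaming (_≤_ to _≤ℕ_)
open import Data.Product.Base using (Σ; Σ-syntax; ∃; ∃-syntax; _×_; _,_; proj₁; proj₂)
open import Data.Vec.Functional using (Vector)
open import Function.Base using (flip)
open import Function.Bundles using (_⇔_)
open import Relation.Binary.Bundles using (TotalOrder)
open import Relation.Binary.Core using (Rel)
open import Relation.Binary.PropositionalEquality.Core using (_≡_)
open import Relation.Binary.Structures using (IsTotalOrder)
import Relation.Binary.Construct.NonStrictToStrict as ToStrict
import Relation.Binary.Reasoning.Setoid as SetoidReasoning
open import Relation.Nullary.Negation.Core using (¬_)
open import Relation.Unary using (Pred; _⊆_)

module _ {a ℓ p} {A : Set a} (_≤_ : Rel A ℓ) (S : Pred A p) where

  IsUpperBound : Pred A _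
  IsUpperBound u = ∀ {x} → S x → x ≤ u

  IsSupremum : Pred A _
  IsSupremum m = IsUpperBound m × (∀ {u} → IsUpperBound u → m ≤ u)

-- The real numbers, presented as a Dedekind-complete ordered field (with
-- classical logic this determines them up to unique isomorphism).
record RealNumbers : Set₁ where
  infix 4 _≤_
  field
    commutativeRing : CommutativeRing 0ℓ 0ℓ

  open CommutativeRing commutativeRing public
    renaming (Carrier to ℝ)

  field
    _≤_          : Rel ℝ 0ℓ
    isTotalOrder : IsTotalOrder _≈_ _≤_
    +-monoˡ-≤    : ∀ {x y} z → x ≤ y → x + z ≤ y + z
    *-nonneg     : ∀ {x y} → 0# ≤ x → 0# ≤ y → 0# ≤ x * y
    0≉1          : ¬ 0# ≈ 1#
    inverse      : ∀ x → ¬ x ≈ 0# → ∃[ y ] x * y ≈ 1#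
    complete     : (S : Pred ℝ 0ℓ) → ∃ S → ∃ (IsUpperBound _≤_ S) →
                   ∃ (IsSupremum _≤_ S)

  totalOrder : TotalOrder 0ℓ 0ℓ 0ℓ
  totalOrder = record { isTotalOrder = isTotalOrder }

  open ToStrict _≈_ _≤_ public using (_<_)
  open Max totalOrder public using () renaming (_⊔_ to max)

  ∣_∣ : ℝ → ℝ
  ∣ x ∣ = max x (- x)

  fromℕ : ℕ → ℝ
  fromℕ n = n ×′ 1#
    where open Multiples +-rawMonoid using () renaming (_×_ to _×′_)

  IsInfimum : ∀ {p} → Pred ℝ p → Pred ℝ p
  IsInfimum = IsSupremum (flip _≤_)

module ComplexNumbers (R : RealNumbers) where
  open RealNumbers R
  open RingProperties ring using (-1*x≈-x; -‿distribʳ-*)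
  open SemiringSolver commutativeSemiring using (solve; _:+_; _:*_; _:=_)

  ℂ-group : AbelianGroup 0ℓ 0ℓ
  ℂ-group = DirectProduct.abelianGroup +-abelianGroup +-abelianGroup

  open AbelianGroup ℂ-group using ()
    renaming (Carrier to ℂ; _≈_ to _≈ᶜ_; _∙_ to _+ᶜ_; ε to 0ᶜ; _⁻¹ to -ᶜ_;
              sym to symᶜ; trans to transᶜ)

  infixl 7 _*ᶜ_ _∗_

  _*ᶜ_ : Op₂ ℂ
  (a , b) *ᶜ (c , d) = a * c - b * d , a * d + b * c

  1ᶜ : ℂ
  1ᶜ = 1# , 0#

  conj : Op₁ ℂ
  conj (a , b) = a , - b

  -- r is the modulus of a + bi
  IsModulus : ℂ → Pred ℝ 0ℓ
  IsModulus (a , b) r = 0# ≤ r × r * r ≈ a * a + b * b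

  private
    -- _*ᶜ_ with its minus sign replaced by multiplication with m = -1; in this
    -- form the ring laws are semiring identities in m and the coordinates.
    m : ℝ
    m = - 1#

    _∗_ : Op₂ ℂ
    (a , b) ∗ (c , d) = a * c + m * (b * d) , a * d + b * c

    *≈∗ : ∀ x y → (x *ᶜ y) ≈ᶜ (x ∗ y)
    *≈∗ (a , b) (c , d) = +-congˡ (sym (-1*x≈-x (b * d))) , refl

    ∗-cong : ∀ {x x′ y y′} → x ≈ᶜ x′ → y ≈ᶜ y′ → (x ∗ y) ≈ᶜ (x′ ∗ y′)
    ∗-cong (p , q) (r , s) =
      +-cong (*-cong p r) (*-congˡ (*-cong q s)) ,
      +-cong (*-cong p s) (*-cong q r)

    ∗-assoc : ∀ x y z → ((x ∗ y) ∗ z) ≈ᶜ (x ∗ (y ∗ z))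
    ∗-assoc (a , b) (c , d) (e , f) =
      solve 7 (λ m a b c d e f →
        (a :* c :+ m :* (b :* d)) :* e :+ m :* ((a :* d :+ b :* c) :* f) :=
        a :* (c :* e :+ m :* (d :* f)) :+ m :* (b :* (c :* f :+ d :* e)))
        refl m a b c d e f ,
      solve 7 (λ m a b c d e f →
        (a :* c :+ m :* (b :* d)) :* f :+ (a :* d :+ b :* c) :* e :=
        a :* (c :* f :+ d :* e) :+ b :* (c :* e :+ m :* (d :* f)))
        refl m a b c d e f

    ∗-comm : ∀ x y → (x ∗ y) ≈ᶜ (y ∗ x)
    ∗-comm (a , b) (c , d) =
      +-cong (*-comm a c) (*-congˡ (*-comm b d)) ,
      trans (+-comm (a * d) (b * c)) (+-cong (*-comm b c) (*-comm a d))

    ∗-distribˡ : ∀ x y z → (x ∗ (y +ᶜ z)) ≈ᶜ ((x ∗ y) +ᶜ (x ∗ z))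
    ∗-distribˡ (a , b) (c , d) (e , f) =
      solve 7 (λ m a b c d e f →
        a :* (c :+ e) :+ m :* (b :* (d :+ f)) :=
        (a :* c :+ m :* (b :* d)) :+ (a :* e :+ m :* (b :* f)))
        refl m a b c d e f ,
      solve 6 (λ a b c d e f →
        a :* (d :+ f) :+ b :* (c :+ e) :=
        (a :* d :+ b :* c) :+ (a :* f :+ b :* e))
        refl a b c d e f

    ∗-identityˡ : ∀ x → (1ᶜ ∗ x) ≈ᶜ x
    ∗-identityˡ (a , b) =
      trans (+-cong (*-identityˡ a) (trans (*-congˡ (zeroˡ b)) (zeroʳ m)))
            (+-identityʳ a) ,
      trans (+-cong (*-identityˡ b) (zeroˡ a)) (+-identityʳ b)

    +ᶜ-cong : ∀ {x x′ y y′} → x ≈ᶜ x′ → y ≈ᶜ y′ → (x +ᶜ y) ≈ᶜ (x′ +ᶜ y′)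
    +ᶜ-cong = AbelianGroup.∙-cong ℂ-group

    *ᶜ-cong : ∀ {x x′ y y′} → x ≈ᶜ x′ → y ≈ᶜ y′ → (x *ᶜ y) ≈ᶜ (x′ *ᶜ y′)
    *ᶜ-cong {x} {x′} {y} {y′} p q =
      transᶜ (*≈∗ x y) (transᶜ (∗-cong p q) (symᶜ (*≈∗ x′ y′)))

    reflᶜ : ∀ {x} → x ≈ᶜ x
    reflᶜ = AbelianGroup.refl ℂ-group

    *ᶜ-assoc : ∀ x y z → ((x *ᶜ y) *ᶜ z) ≈ᶜ (x *ᶜ (y *ᶜ z))
    *ᶜ-assoc x y z = begin
      (x *ᶜ y) *ᶜ z  ≈⟨ *≈∗ (x *ᶜ y) z ⟩
      (x *ᶜ y) ∗ z   ≈⟨ ∗-cong (*≈∗ x y) (reflᶜ {z}) ⟩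
      (x ∗ y) ∗ z    ≈⟨ ∗-assoc x y z ⟩
      x ∗ (y ∗ z)    ≈⟨ ∗-cong (reflᶜ {x}) (*≈∗ y z) ⟨
      x ∗ (y *ᶜ z)   ≈⟨ *≈∗ x (y *ᶜ z) ⟨
      x *ᶜ (y *ᶜ z)  ∎
      where open SetoidReasoning (AbelianGroup.setoid ℂ-group)

    *ᶜ-comm : ∀ x y → (x *ᶜ y) ≈ᶜ (y *ᶜ x)
    *ᶜ-comm x y = transᶜ (*≈∗ x y) (transᶜ (∗-comm x y) (symᶜ (*≈∗ y x)))

    *ᶜ-identityˡ : ∀ x → (1ᶜ *ᶜ x) ≈ᶜ x
    *ᶜ-identityˡ x = transᶜ (*≈∗ 1ᶜ x) (∗-identityˡ x)

    *ᶜ-distribˡ : ∀ x y z → (x *ᶜ (y +ᶜ z)) ≈ᶜ ((x *ᶜ y) +ᶜ (x *ᶜ z))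
    *ᶜ-distribˡ x y z =
      transᶜ (*≈∗ x (y +ᶜ z)) (transᶜ (∗-distribˡ x y z)
        (symᶜ (+ᶜ-cong (*≈∗ x y) (*≈∗ x z))))

    *ᶜ-distribʳ : ∀ x y z → ((y +ᶜ z) *ᶜ x) ≈ᶜ ((y *ᶜ x) +ᶜ (z *ᶜ x))
    *ᶜ-distribʳ x y z =
      transᶜ (*ᶜ-comm (y +ᶜ z) x) (transᶜ (*ᶜ-distribˡ x y z)
        (+ᶜ-cong (*ᶜ-comm x y) (*ᶜ-comm x z)))

  complexRing : CommutativeRing 0ℓ 0ℓ
  complexRing = record
    { Carrier = ℂ ; _≈_ = _≈ᶜ_ ; _+_ = _+ᶜ_ ; _*_ = _*ᶜ_
    ; -_ = -ᶜ_ ; 0# = 0ᶜ ; 1# = 1ᶜ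
    ; isCommutativeRing = record
      { isRing = record
        { +-isAbelianGroup = AbelianGroup.isAbelianGroup ℂ-group
        ; *-cong     = λ {x} {x′} {y} {y′} → *ᶜ-cong {x} {x′} {y} {y′}
        ; *-assoc    = *ᶜ-assoc
        ; *-identity = *ᶜ-identityˡ ,
                       λ x → transᶜ (*ᶜ-comm x 1ᶜ) (*ᶜ-identityˡ x)
        ; distrib    = *ᶜ-distribˡ , *ᶜ-distribʳ
        }
      ; *-comm = *ᶜ-comm
      }
    }

-- `unital` selects the language: that of C*-algebras, or that of unital
-- C*-algebras, which has an additional constant for the unit.
module ContinuousLogic (R : RealNumbers) (unital : Bool) where
  open RealNumbers R using
    (ℝ; _≈_; _≤_; _<_; _+_; _*_; _-_; 0#; max; ∣_∣; fromℕ; IsInfimum)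
  open ComplexNumbers R using (complexRing; conj; IsModulus)
  open CommutativeRing complexRing using () renaming (Carrier to ℂ)

  record CStarAlgebra : Set₁ where
    infixl 7 _·_
    infix  9 _⋆
    field
      leftModule : LeftModule (CommutativeRing.ring complexRing) 0ℓ 0ℓ

    open LeftModule leftModule public
      using (_≈ᴹ_; _+ᴹ_; _*ₗ_; 0ᴹ; -ᴹ_)
      renaming (Carrierᴹ to Carrier)

    field
      _·_              : Op₂ Carrier
      isRingWithoutOne : IsRingWithoutOne _≈ᴹ_ _+ᴹ_ _·_ -ᴹ_ 0ᴹ
      *ₗ-·-assocˡ      : ∀ z x y → (z *ₗ x) · y ≈ᴹ z *ₗ (x · y)
      *ₗ-·-assocʳ      : ∀ z x y → x · (z *ₗ y) ≈ᴹ z *ₗ (x · y)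

      one              : T unital → Carrier
      one-identityˡ    : ∀ u x → one u · x ≈ᴹ x
      one-identityʳ    : ∀ u x → x · one u ≈ᴹ x

      _⋆               : Op₁ Carrier
      ⋆-cong           : ∀ {x y} → x ≈ᴹ y → x ⋆ ≈ᴹ y ⋆
      ⋆-involutive     : ∀ x → (x ⋆) ⋆ ≈ᴹ x
      ⋆-homo-+ᴹ        : ∀ x y → (x +ᴹ y) ⋆ ≈ᴹ x ⋆ +ᴹ y ⋆
      ⋆-conjugate      : ∀ z x → (z *ₗ x) ⋆ ≈ᴹ conj z *ₗ x ⋆
      ⋆-antihomo-·     : ∀ x y → (x · y) ⋆ ≈ᴹ y ⋆ · x ⋆

      ‖_‖              : Carrier → ℝ
      ‖‖-cong          : ∀ {x y} → x ≈ᴹ y → ‖ x ‖ ≈ ‖ y ‖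
      ‖‖-nonneg        : ∀ x → 0# ≤ ‖ x ‖
      ‖‖-definite      : ∀ x → ‖ x ‖ ≈ 0# → x ≈ᴹ 0ᴹ
      ‖‖-homogeneous   : ∀ z {r} x → IsModulus z r → ‖ z *ₗ x ‖ ≈ r * ‖ x ‖
      ‖‖-triangle      : ∀ x y → ‖ x +ᴹ y ‖ ≤ ‖ x ‖ + ‖ y ‖
      ‖‖-submult       : ∀ x y → ‖ x · y ‖ ≤ ‖ x ‖ * ‖ y ‖
      C*-identity      : ∀ x → ‖ x ⋆ · x ‖ ≈ ‖ x ‖ * ‖ x ‖

    d : Carrier → Carrier → ℝ
    d x y = ‖ x +ᴹ (-ᴹ y) ‖

    field
      isComplete : (x : ℕ → Carrier) →
        (∀ ε → 0# < ε → ∃[ N ] ∀ {j k} → N ≤ℕ j → N ≤ℕ k → d (x j) (x k) < ε) →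
        ∃[ y ] ∀ ε → 0# < ε → ∃[ N ] ∀ {j} → N ≤ℕ j → d (x j) y < ε

    Ball : ℕ → Set
    Ball n = Σ[ x ∈ Carrier ] ‖ x ‖ ≤ fromℕ n

  open CStarAlgebra using (Carrier; Ball)

  -- A sort is given by the radius n of the corresponding ball.
  Sort : Set
  Sort = ℕ

  -- C is a set of extra constant symbols: empty for the language of
  -- (unital) C*-algebras.  Since the balls are included in one another, terms
  -- carry no sort; only variables and constant symbols do.
  data Term (C : Set) (Γ : List Sort) : Set where
    var   : ∀ {n} → n ∈ Γ → Term C Γ
    con   : C → Term C Γ
    zeroₜ : Term C Γ
    oneₜ  : T unital → Term C Γ
    _+ₜ_  : Term C Γ → Term C Γ → Term C Γ
    _·ₜ_  : Term C Γ → Term C Γ → Term C Γ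
    _⋆ₜ   : Term C Γ → Term C Γ
    _*ₜ_  : ℂ → Term C Γ → Term C Γ

  record Connective (k : ℕ) : Set where
    field
      apply      : Vector ℝ k → ℝ
      continuous : ∀ x ε → 0# < ε → ∃[ δ ] 0# < δ ×
                   (∀ y → (∀ i → ∣ x i - y i ∣ < δ) → ∣ apply x - apply y ∣ < ε)

  open Connective using (apply)

  data Formula (C : Set) (Γ : List Sort) : Set where
    dist : Term C Γ → Term C Γ → Formula C Γ
    conn : ∀ {k} → Connective k → (Fin k → Formula C Γ) → Formula C Γ
    ⨆ ⨅  : (n : Sort) → Formula C (n ∷ Γ) → Formula C Γ

  data QuantifierFree {C Γ} : Formula C Γ → Set where
    dist : ∀ t u → QuantifierFree (dist t u)
    conn : ∀ {k} (f : Connective k) {φs} →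
           (∀ i → QuantifierFree (φs i)) → QuantifierFree (conn f φs)

  LFormula : List Sort → Set
  LFormula = Formula ⊥

  LSentence : Set
  LSentence = LFormula []

  Env : CStarAlgebra → List Sort → Set
  Env A = All (Ball A)

  dᴱ : ∀ A {Γ} → Env A Γ → Env A Γ → ℝ
  dᴱ A []            []            = 0#
  dᴱ A ((x , _) ∷ ρ) ((y , _) ∷ τ) = max (CStarAlgebra.d A x y) (dᴱ A ρ τ)

  module _ {C : Set} (A : CStarAlgebra) (κ : C → Carrier A) where
    open CStarAlgebra A hiding (Carrier; Ball)

    ⟦_⟧ : ∀ {Γ} → Term C Γ → Env A Γ → Carrier A
    ⟦ var i ⟧  ρ = proj₁ (lookup ρ i)
    ⟦ con c ⟧  ρ = κ c
    ⟦ zeroₜ ⟧  ρ = 0ᴹ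
    ⟦ oneₜ u ⟧ ρ = one u
    ⟦ t +ₜ u ⟧ ρ = ⟦ t ⟧ ρ +ᴹ ⟦ u ⟧ ρ
    ⟦ t ·ₜ u ⟧ ρ = ⟦ t ⟧ ρ · ⟦ u ⟧ ρ
    ⟦ t ⋆ₜ ⟧   ρ = ⟦ t ⟧ ρ ⋆
    ⟦ z *ₜ t ⟧ ρ = z *ₗ ⟦ t ⟧ ρ

    -- The graph of the evaluation of formulas: r is the value of φ at ρ.
    -- Suprema and infima of bounded sets of reals exist only as a property,
    -- so the value is given by a relation.
    HasValue : ∀ {Γ} → Formula C Γ → Env A Γ → ℝ → Set
    HasValue (dist t u)  ρ r = r ≈ d (⟦ t ⟧ ρ) (⟦ u ⟧ ρ)
    HasValue (conn f φs) ρ r =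
      ∃[ v ] (∀ i → HasValue (φs i) ρ (v i)) × r ≈ apply f v
    HasValue (⨆ n φ)     ρ r =
      IsSupremum _≤_ (λ v → Σ[ x ∈ Ball A n ] HasValue φ (x ∷ ρ) v) r
    HasValue (⨅ n φ)     ρ r =
      IsInfimum (λ v → Σ[ x ∈ Ball A n ] HasValue φ (x ∷ ρ) v) r

  LValue : ∀ A {Γ} → LFormula Γ → Env A Γ → ℝ → Set
  LValue A = HasValue A λ ()

  Nonnegative : ∀ {Γ} → LFormula Γ → Set₁
  Nonnegative φ = ∀ A ρ r → LValue A φ ρ r → 0# ≤ r

  ⨆-closure : ∀ {C Γ} → Formula C Γ → Formula C []
  ⨆-closure {Γ = []}    φ = φ
  ⨆-closure {Γ = n ∷ _} φ = ⨆-closure (⨆ n φ)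

  ⨅* : ∀ {C Γ} Δ → Formula C (Δ ++ Γ) → Formula C Γ
  ⨅* []      φ = φ
  ⨅* (n ∷ Δ) φ = ⨅* Δ (⨅ n φ)

  Existential : ∀ {Γ} → LFormula Γ → Set₁
  Existential {Γ} φ = Σ[ Δ ∈ List Sort ] Σ[ ψ ∈ LFormula (Δ ++ Γ) ]
    QuantifierFree ψ × Nonnegative ψ × φ ≡ ⨅* Δ ψ

  ForallExists : LSentence → Set₁
  ForallExists φ =
    Σ[ Γ ∈ List Sort ] Σ[ Δ ∈ List Sort ] Σ[ ψ ∈ LFormula (Δ ++ Γ) ]
      QuantifierFree ψ × Nonnegative ψ × φ ≡ ⨆-closure (⨅* {Γ = Γ} Δ ψ)

  Theory : Set₁
  Theory = Pred LSentence 0ℓ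

  infix 4 _⊨_

  _⊨_ : CStarAlgebra → Theory → Set
  A ⊨ 𝒯 = ∀ φ → 𝒯 φ → LValue A φ [] 0#

  Complete : Theory → Set₁
  Complete 𝒯 = ∀ A B → A ⊨ 𝒯 → B ⊨ 𝒯 → ∀ φ r s →
    LValue A φ [] r → LValue B φ [] s → r ≈ s

  ForallExistsAxiomatizable : Theory → Set₁
  ForallExistsAxiomatizable 𝒯 = Σ[ 𝒰 ∈ Theory ]
    (∀ φ → 𝒰 φ → ForallExists φ) × (∀ A → A ⊨ 𝒯 ⇔ A ⊨ 𝒰)

  -- A uniform continuity modulus is only ever evaluated on [0,∞).
  record Modulus : Set where
    field
      modulus : ℝ → ℝ
      cong    : ∀ {s t} → s ≈ t → modulus s ≈ modulus t
      nonneg  : ∀ {t} → 0# ≤ t → 0# ≤ modulus t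
      limit   : ∀ ε → 0# < ε → ∃[ δ ] 0# < δ ×
                (∀ t → 0# ≤ t → t < δ → modulus t < ε)

  open Modulus using (modulus)

  record UniformFamily (𝒯 : Theory) (Γ : List Sort)
                       (F : Pred (LFormula Γ) 0ℓ) : Set₁ where
    field
      countable   : Σ[ e ∈ (ℕ → LFormula Γ) ] ∀ φ → F φ → ∃[ k ] φ ≡ e k
      nonnegative : ∀ φ → F φ → Nonnegative φ
      equicontinuous : Σ[ u ∈ Modulus ] ∀ A → A ⊨ 𝒯 → ∀ φ → F φ →
        ∀ ρ τ r s → LValue A φ ρ r → LValue A φ τ s →
        ∣ r - s ∣ ≤ modulus u (dᴱ A ρ τ)

  record DefinableByUniformFamilies {p} (P : Pred CStarAlgebra p) : Set (lsuc 0ℓ ⊔ p) where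
    field
      theory      : Theory
      context     : ℕ → List Sort
      family      : ∀ n → Pred (LFormula (context n)) 0ℓ
      uniform     : ∀ n → UniformFamily theory (context n) (family n)
      existential : ∀ n φ → family n φ → Existential φ
      defines     : ∀ A → P A ⇔
        (A ⊨ theory × (∀ n ρ →
          IsInfimum (λ v → ∃[ φ ] family n φ × LValue A φ ρ v) 0#))

  -- (n , j) stands for the j-th new constant symbol of sort n.
  NewConstant : Set
  NewConstant = Sort × ℕ

  Interpretation : CStarAlgebra → Set
  Interpretation A = ∀ n → ℕ → Ball A n

  QFSentence⁺ : Set
  QFSentence⁺ = Σ (Formula NewConstant []) QuantifierFree

  Value⁺ : ∀ A → Interpretation A → QFSentence⁺ → ℝ → Set
  Value⁺ A a (φ , _) = HasValue A (λ (n , j) → proj₁ (a n j)) φ []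

  AttainedModulus : Theory → QFSentence⁺ → Pred ℝ (lsuc 0ℓ)
  AttainedModulus 𝒯 σ v =
    Σ[ A ∈ CStarAlgebra ] A ⊨ 𝒯 × Σ[ a ∈ Interpretation A ]
      ∃[ r ] Value⁺ A a σ r × v ≈ ∣ r ∣

  HasSeminorm : Theory → QFSentence⁺ → ℝ → Set₁
  HasSeminorm 𝒯 σ = IsSupremum _≤_ (AttainedModulus 𝒯 σ)

  binary : Connective 2 → QFSentence⁺ → QFSentence⁺ → QFSentence⁺
  binary f (φ , p) (ψ , q) = conn f φs , conn f qfs
    where
    φs : Fin 2 → Formula NewConstant []
    φs fzero        = φ
    φs (fsuc fzero) = ψ
    qfs : ∀ i → QuantifierFree (φs i)
    qfs fzero        = p
    qfs (fsuc fzero) = q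

  -- The linear combination b σ + c τ of sentences is obtained by applying the
  -- connective (x , y) ↦ b x + c y.
  record Dual (𝒯 : Theory) : Set₁ where
    field
      ⟪_⟫     : QFSentence⁺ → ℝ
      linear  : ∀ b c (f : Connective 2) →
                (∀ v → apply f v ≈ b * v fzero + c * v (fsuc fzero)) →
                ∀ σ τ → ⟪ binary f σ τ ⟫ ≈ b * ⟪ σ ⟫ + c * ⟪ τ ⟫
      bounded : ∃[ K ] ∀ σ r → HasSeminorm 𝒯 σ r → ∣ ⟪ σ ⟫ ∣ ≤ K * r

  open Dual using (⟪_⟫)

  module _ {𝒯 : Theory} where

    -- s is the functional determined by A and a
    IsEvaluationAt : ∀ A → Interpretation A → Dual 𝒯 → Set
    IsEvaluationAt A a s = ∀ σ → Value⁺ A a σ (⟪ s ⟫ σ)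

    -- s′ lies in the basic weak* neighbourhood of s given by σs and ε
    Near : List QFSentence⁺ → ℝ → Rel (Dual 𝒯) 0ℓ
    Near σs ε s s′ = All (λ σ → ∣ ⟪ s′ ⟫ σ - ⟪ s ⟫ σ ∣ < ε) σs

    module _ {x} (X : Pred (Dual 𝒯) x) where

      IsOpenIn : ∀ {y} → Pred (Dual 𝒯) y → Set _
      IsOpenIn U = ∀ s → X s → U s →
        ∃[ σs ] ∃[ ε ] 0# < ε × (∀ s′ → X s′ → Near σs ε s s′ → U s′)

      IsDenseIn : ∀ {y} → Pred (Dual 𝒯) y → Set _
      IsDenseIn G = G ⊆ X × (∀ s → X s → ∀ σs ε → 0# < ε →
        ∃[ s′ ] G s′ × Near σs ε s s′)

      IsGδIn : ∀ {y} → Pred (Dual 𝒯) y → Set _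
      IsGδIn G = G ⊆ X × (Σ[ U ∈ (ℕ → Pred (Dual 𝒯) (lsuc 0ℓ)) ]
        (∀ k → IsOpenIn (U k)) × (∀ s → X s → G s ⇔ (∀ k → U k s)))

  𝔗 : ∀ 𝒯 → Pred (Dual 𝒯) (lsuc 0ℓ)
  𝔗 𝒯 s = Σ[ A ∈ CStarAlgebra ] A ⊨ 𝒯 ×
    Σ[ a ∈ Interpretation A ] IsEvaluationAt A a s

  record _≅_ (A B : CStarAlgebra) : Set where
    private
      module A = CStarAlgebra A
      module B = CStarAlgebra B
    field
      to         : A.Carrier → B.Carrier
      from       : B.Carrier → A.Carrier
      to-cong    : ∀ {x y} → x A.≈ᴹ y → to x B.≈ᴹ to y
      from-cong  : ∀ {x y} → x B.≈ᴹ y → from x A.≈ᴹ from y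
      to-from    : ∀ y → to (from y) B.≈ᴹ y
      from-to    : ∀ x → from (to x) A.≈ᴹ x
      +ᴹ-homo    : ∀ x y → to (x A.+ᴹ y) B.≈ᴹ to x B.+ᴹ to y
      ·-homo     : ∀ x y → to (x A.· y) B.≈ᴹ to x B.· to y
      *ₗ-homo    : ∀ z x → to (z A.*ₗ x) B.≈ᴹ z B.*ₗ to x
      ⋆-homo     : ∀ x → to (x A.⋆) B.≈ᴹ to x B.⋆
      one-homo   : ∀ u → to (A.one u) B.≈ᴹ B.one u
      isometric  : ∀ x → B.‖ to x ‖ ≈ A.‖ x ‖

  open _≅_ using (to)

  -- The new constants of each sort are dense in that sort.
  SortwiseDense : ∀ A → Interpretation A → Set
  SortwiseDense A a = ∀ n (x : Ball A n) ε → 0# < ε →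
    ∃[ j ] CStarAlgebra.d A (proj₁ x) (proj₁ (a n j)) < ε

  record Determines {𝒯} (s : Dual 𝒯) (A : CStarAlgebra) (a : Interpretation A) : Set where
    field
      isModel    : A ⊨ 𝒯
      dense      : SortwiseDense A a
      evaluation : IsEvaluationAt A a s

  record UniquelyDetermines {𝒯} (s : Dual 𝒯) : Set₁ where
    field
      algebra        : CStarAlgebra
      interpretation : Interpretation algebra
      determines     : Determines s algebra interpretation
      unique         : ∀ B b → Determines s B b → Σ[ h ∈ algebra ≅ B ]
        ∀ n j → CStarAlgebra._≈ᴹ_ B (to h (proj₁ (interpretation n j)))
                                    (proj₁ (b n j))

  open UniquelyDetermines using (algebra)

  _with-property_ : ∀ {𝒯 p} {G : Pred (Dual 𝒯) (lsuc 0ℓ)} →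
    (∀ s → G s → UniquelyDetermines s) → Pred CStarAlgebra p →
    Pred (Dual 𝒯) (lsuc 0ℓ ⊔ p)
  _with-property_ {G = G} det P s = Σ[ g ∈ G s ] P (algebra (det s g))

module Submission where

-- A point is an algebra A with an interpretation a of the constants.  The theory T'
-- in the definition of P may contain arbitrary sentences, so among the functionals
-- given by points with dense constants those with A ⊨ T' need not form a Gδ.
-- Therefore 𝔊 is cut out by three countable families of dense open conditions: the
-- constants are dense in every ball; the ∀∃-axioms are witnessed by constants; and a
-- family that makes the values of the sentences of T' continuous on 𝔊 (by induction
-- on formulas, since an infimum of continuous functions is semicontinuous, hence
-- continuous on a dense Gδ).  Countably many axioms suffice because formulas are
-- separable for uniform approximation in all structures.
--
-- Conditions are dense because witnesses can be named by constants with fresh indices.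
-- They can be met simultaneously by the Baire category theorem: along a suitable
-- sequence of points the norms of all closed terms converge, and the completion of
-- the closed terms for the limit norm is the required algebra.
--
-- On 𝔊 the models of T' form a closed set, and the existential families contribute
-- countably many open conditions.  If T is complete, all its models satisfy T' and
-- approximately realize the same quantifier-free types, so these open conditions are
-- dense as well.

open import Defs
open import Level using (Level; 0ℓ; _⊔_; Lift; lift; lower) renaming (suc to lsuc)
open import Axiom.ExcludedMiddle using (ExcludedMiddle)
open import Algebra.Bundles using (AbelianGroup; CommutativeRing; RawRing; RingWithoutOne)
open import Algebra.Module.Bundles using (LeftModule)
open import Algebra.Structures using (IsAbelianGroup)
open import Algebra.Solver.Ring.AlmostCommutativeRing using (fromCommutativeRing; _-Raw-AlmostCommutative⟶_)
import Algebra.Construct.NaturalChoice.Max as Max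
import Algebra.Properties.AbelianGroup as AbelianGroupProperties
import Algebra.Properties.CommutativeSemigroup as CommutativeSemigroupProperties
import Algebra.Properties.Ring as RingProperties
import Algebra.Properties.RingWithoutOne as RingWithoutOneProperties
import Algebra.Properties.Semiring.Mult as Mult
import Algebra.Properties.Semiring.Mult.TCOptimised as OptMult
import Algebra.Solver.Ring as RingSolver
import Algebra.Solver.Ring.NaturalCoefficients.Default as SemiringSolver
open import Data.Bool.Base using (Bool)
open import Data.Bool.Properties using (T-irrelevant)
open import Data.Empty using (⊥; ⊥-elim)
open import Data.Fin.Base using (Fin; fromℕ<; toℕ) renaming (zero to fzero; suc to fsuc)
open import Data.Fin.Properties using (toℕ-fromℕ<)
open import Data.List.Base using (List; []; _∷_; _++_; map)
open import Data.List.Membership.Propositional using (_∈_)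
open import Data.List.Relation.Unary.All as All using (All; []; _∷_; lookup)
open import Data.List.Relation.Unary.All.Properties using (++⁺; ++⁻ˡ; ++⁻ʳ)
open import Data.List.Relation.Unary.Any using (here; there)
open import Data.Maybe.Base using (Maybe; just; nothing; maybe′)
import Data.Maybe.Base as Maybe
open import Data.Nat.Base as ℕ using (ℕ; zero; suc) renaming (_≤_ to _≤ℕ_; _<_ to _<ℕ_)
import Data.Nat.Properties as ℕ
open import Data.Product.Base using (Σ; Σ-syntax; ∃; ∃-syntax; _×_; _,_; proj₁; proj₂)
open import Data.Sum.Base using (_⊎_; inj₁; inj₂; [_,_]′)
open import Data.Unit.Base using (⊤; tt)
open import Data.Vec.Functional using (Vector) renaming (_∷_ to _∷ᵛ_; [] to []ᵛ)
open import Function.Base using (_∘_)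
open import Function.Bundles using (mk⇔; Equivalence)
open import Relation.Binary.PropositionalEquality.Core as ≡ using (_≡_)
import Relation.Binary.Reasoning.Setoid as SetoidReasoning
open import Relation.Binary.Structures using (IsEquivalence; IsTotalOrder)
open import Relation.Nullary.Decidable.Core using (yes; no)
open import Relation.Nullary.Negation.Core using (¬_)
open import Relation.Unary using (Pred)

-- The language has all complex scalars and all continuous connectives, so it is uncountable, while
-- a Baire argument meets only countably many conditions. Terms and formulas are therefore rounded
-- to finite codes. Expressions with equal codes are close in all structures at once, and this
-- uniformity turns codes into countable nets of closed terms and of axioms.
--
-- The limit of a sequence of points of models is not known to be a model while it is being built.
-- Hence a condition is a set of arbitrary valuations of quantifier-free sentences, and only its
-- density refers to models; that the limit is a model is read off afterwards from the conditions
-- that it meets. This is where the shape of the axioms enters: the matrix of an ∀∃-axiom is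
-- quantifier-free, so having witnesses among the constants is an open condition on valuations.
--
-- The value of a quantified sentence is a function of the algebra, not of the valuation. Its
-- continuity is therefore stated for functions of points, restricted to the points that meet the
-- conditions.

cases : ∀ {a b c} {A : Set a} {B : Set b} {C : Set c} → A ⊎ B → (A → C) → (B → C) → C
cases x f g = [ f , g ]′ x

-- Countable sets

Enumerable : ∀ {a} → Set a → Set a
Enumerable A = Σ[ e ∈ (ℕ → A) ] ∀ x → ∃[ n ] e n ≡ x

-- The successor in Cantor's walk along the antidiagonals; from `(0 , b)` it jumps to the start of
-- the next one.
nextPair : ℕ × ℕ → ℕ × ℕ
nextPair (zero  , b) = suc b , zero
nextPair (suc a , b) = a , suc b

unpair : ℕ → ℕ × ℕ
unpair zero    = 0 , 0
unpair (suc n) = nextPair (unpair n)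

unpair-surjective : ∀ a b → ∃[ n ] unpair n ≡ (a , b)
unpair-surjective a b = onDiagonal (a ℕ.+ b) b a ≡.refl
  where
  -- The sum `s` of the coordinates is an argument of its own, so that the recursion is
  -- lexicographic in `s` and `b`: `b` falls along a diagonal, `s` falls at its start.
  onDiagonal : ∀ s b a → a ℕ.+ b ≡ s → ∃[ n ] unpair n ≡ (a , b)
  onDiagonal s (suc b) a p
    with onDiagonal s b (suc a) (≡.trans (≡.sym (ℕ.+-suc a b)) p)
  ... | n , q = suc n , ≡.cong nextPair q
  onDiagonal (suc s) zero (suc a) p
    with onDiagonal s a zero (≡.trans (≡.sym (ℕ.+-identityʳ a)) (ℕ.suc-injective p))
  ... | n , q = suc n , ≡.cong nextPair q
  onDiagonal s zero zero p = 0 , ≡.refl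

enumerable-ℕ : Enumerable ℕ
enumerable-ℕ = (λ n → n) , λ n → n , ≡.refl

enumerable-Σ : ∀ {a b} {A : Set a} {B : A → Set b} →
               Enumerable A → (∀ x → Enumerable (B x)) → Enumerable (Σ A B)
enumerable-Σ {A = A} {B} (e , e-surj) f = enumerate , surjective
  where
  pick : ℕ × ℕ → Σ A B
  pick (i , j) = e i , proj₁ (f (e i)) j
  enumerate : ℕ → Σ A B
  enumerate n = pick (unpair n)
  surjective : ∀ p → ∃[ n ] enumerate n ≡ p
  surjective (x , y) with e-surj x
  ... | i , ≡.refl with proj₂ (f (e i)) y
  ... | j , ≡.refl with unpair-surjective i j
  ... | n , q = n , ≡.cong pick q

enumerable-× : ∀ {a b} {A : Set a} {B : Set b} → Enumerable A → Enumerable B → Enumerable (A × B)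
enumerable-× eA eB = enumerable-Σ eA λ _ → eB

enumerable-⊎ : ∀ {a b} {A : Set a} {B : Set b} → Enumerable A → Enumerable B → Enumerable (A ⊎ B)
enumerable-⊎ {A = A} {B} (e , e-surj) (f , f-surj) = pick ∘ unpair , surjective
  where
  pick : ℕ × ℕ → A ⊎ B
  pick (zero  , n) = inj₁ (e n)
  pick (suc _ , n) = inj₂ (f n)
  surjective : ∀ x → ∃[ n ] pick (unpair n) ≡ x
  surjective (inj₁ x) with e-surj x
  ... | i , ≡.refl with unpair-surjective 0 i
  ... | n , q = n , ≡.cong pick q
  surjective (inj₂ y) with f-surj y
  ... | i , ≡.refl with unpair-surjective 1 i
  ... | n , q = n , ≡.cong pick q

enumerable-image : ∀ {a b} {A : Set a} {B : Set b} (f : A → B) → (∀ y → ∃[ x ] f x ≡ y) →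
                   Enumerable A → Enumerable B
enumerable-image f f-surj (e , e-surj) = f ∘ e , λ y → helper y (f-surj y)
  where
  helper : ∀ y → ∃[ x ] f x ≡ y → ∃[ n ] f (e n) ≡ y
  helper _ (x , ≡.refl) = let (n , p) = e-surj x in n , ≡.cong f p

enumerable-All : ∀ {a} {A : Set a} (Γ : List A) → Enumerable (All (λ _ → ℕ) Γ)
enumerable-All []      = (λ _ → All.[]) , λ { All.[] → 0 , ≡.refl }
enumerable-All (x ∷ Γ) = enumerable-image
  (λ (n , ns) → n All.∷ ns) (λ { (n All.∷ ns) → (n , ns) , ≡.refl })
  (enumerable-× enumerable-ℕ (enumerable-All Γ))

-- Binary trees as codes

-- Codes are trees rather than numbers so that the code of a compound expression can be taken apart
-- by pattern matching.
data Tree : Set where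
  leaf : ℕ → Tree
  node : Tree → Tree → Tree

-- The fuel makes decoding structurally recursive. Leaves can be decoded with any fuel, so a tree is
-- reached as soon as the fuel is at least its depth.
enumerable-Tree : Enumerable Tree
enumerable-Tree = enumerable-image (λ (fuel , n) → decode fuel n)
  (λ t → (depth t , proj₁ (decode-surjective t (depth t) ℕ.≤-refl)) ,
         proj₂ (decode-surjective t (depth t) ℕ.≤-refl))
  (enumerable-× enumerable-ℕ enumerable-ℕ)
  where
  mutual
    decode : ℕ → ℕ → Tree
    decode zero       n = leaf n
    decode (suc fuel) n = decode′ fuel (unpair n)

    decode′ : ℕ → ℕ × ℕ → Tree
    decode′ fuel (zero  , n) = leaf n
    decode′ fuel (suc m , n) = node (decode fuel m) (decode fuel n)

  depth : Tree → ℕ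
  depth (leaf n)   = 0
  depth (node t u) = suc (depth t ℕ.⊔ depth u)

  decode-surjective : ∀ t fuel → depth t ≤ℕ fuel → ∃[ n ] decode fuel n ≡ t
  decode-surjective (leaf n) zero _ = n , ≡.refl
  decode-surjective (leaf n) (suc fuel) _ with unpair-surjective 0 n
  ... | k , q = k , ≡.cong (decode′ fuel) q
  decode-surjective (node t u) (suc fuel) (ℕ.s≤s p)
    with decode-surjective t fuel (ℕ.≤-trans (ℕ.m≤m⊔n (depth t) (depth u)) p)
       | decode-surjective u fuel (ℕ.≤-trans (ℕ.m≤n⊔m (depth t) (depth u)) p)
  ... | m , ≡.refl | n , ≡.refl with unpair-surjective (suc m) n
  ... | k , q = k , ≡.cong (decode′ fuel) q

leaf-injective : ∀ {m n} → leaf m ≡ leaf n → m ≡ n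
leaf-injective ≡.refl = ≡.refl

node-injective : ∀ {t u t′ u′} → node t u ≡ node t′ u′ → t ≡ t′ × u ≡ u′
node-injective ≡.refl = ≡.refl , ≡.refl

tabulateTree : ∀ {n} → (Fin n → Tree) → Tree
tabulateTree {zero}  f = leaf 0
tabulateTree {suc n} f = node (f fzero) (tabulateTree (f ∘ fsuc))

tabulateTree-injective : ∀ {n} {f g : Fin n → Tree} → tabulateTree f ≡ tabulateTree g → ∀ i → f i ≡ g i
tabulateTree-injective p fzero    = proj₁ (node-injective p)
tabulateTree-injective p (fsuc i) = tabulateTree-injective (proj₂ (node-injective p)) i

module Development (em : ∀ {ℓ} → ExcludedMiddle ℓ) (R : RealNumbers) (unital : Bool) where
  open RealNumbers R hiding (isRingWithoutOne; zero)
  open RingProperties ring using (-1*x≈-x; -‿involutive)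
  open ComplexNumbers R using (complexRing; conj; IsModulus; 1ᶜ)
  private module ℂ = CommutativeRing complexRing
  open ℂ using () renaming (Carrier to ℂ)
  open ContinuousLogic R unital
  open CStarAlgebra using (Carrier; Ball)
  open Connective using (apply; continuous)

  abstract
    byContradiction : ∀ {ℓ} {P : Set ℓ} → ¬ ¬ P → P
    byContradiction {P = P} ¬¬p with em {P = P}
    ... | yes p = p
    ... | no ¬p = ⊥-elim (¬¬p ¬p)

    decide : ∀ {ℓ} (P : Set ℓ) → P ⊎ ¬ P
    decide P with em {P = P}
    ... | yes p = inj₁ p
    ... | no ¬p = inj₂ ¬p

  private module O = IsTotalOrder isTotalOrder

  -- Ordered field

  -- A ring solver with differences of natural numbers as coefficients, so that subtraction cancels.
  -- Its correctness is checked with the semiring solver, in which negation is multiplication by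
  -- `m`.
  module Solver where
    private
      open OptMult semiring using (×-homo-+; ×1-homo-*) renaming (_×_ to _×′_)
      open SemiringSolver commutativeSemiring using (solve; _:+_; _:*_; _:=_)
      open SetoidReasoning setoid

      Difference : Set
      Difference = ℕ × ℕ

      embed : Difference → ℝ
      embed (a , zero)  = a ×′ 1#
      embed (a , suc b) = a ×′ 1# - suc b ×′ 1#

      m : ℝ
      m = - 1#

      unfold : ∀ a b → embed (a , b) ≈ a ×′ 1# + m * (b ×′ 1#)
      unfold a zero    = sym (trans (+-congˡ (zeroʳ m)) (+-identityʳ _))
      unfold a (suc b) = +-congˡ (sym (-1*x≈-x _))

      cancel : ∀ x → x + m * x ≈ 0#
      cancel x = trans (+-congˡ (-1*x≈-x x)) (-‿inverseʳ x)

      -- Equality of normal forms in the solver is tested by conversion.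
      normalise : ℕ → ℕ → Difference
      normalise (suc a) (suc b) = normalise a b
      normalise a       b       = a , b

      normalise-correct : ∀ a b → embed (normalise a b) ≈ a ×′ 1# + m * (b ×′ 1#)
      normalise-correct zero    zero    = unfold 0 0
      normalise-correct zero    (suc b) = unfold 0 (suc b)
      normalise-correct (suc a) zero    = unfold (suc a) 0
      normalise-correct (suc a) (suc b) = begin
        embed (normalise a b)        ≈⟨ normalise-correct a b ⟩
        A + m * B                ≈⟨ +-identityˡ _ ⟨
        0# + (A + m * B)         ≈⟨ +-congʳ (cancel 1#) ⟨
        (1# + m * 1#) + (A + m * B)
          ≈⟨ solve 4 (λ m u A B → (u :+ m :* u) :+ (A :+ m :* B) :=
               (u :+ A) :+ m :* (u :+ B)) refl m 1# A B ⟩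
        (1# + A) + m * (1# + B)
          ≈⟨ +-cong (×-homo-+ 1# 1 a) (*-congˡ (×-homo-+ 1# 1 b)) ⟨
        suc a ×′ 1# + m * (suc b ×′ 1#) ∎
        where
        A = a ×′ 1#
        B = b ×′ 1#

      m*m≈1 : m * m ≈ 1#
      m*m≈1 = trans (-1*x≈-x m) (-‿involutive 1#)

      differences : RawRing 0ℓ 0ℓ
      differences = record
        { Carrier = Difference ; _≈_ = _≡_
        ; _+_ = λ (a , b) (c , d) → normalise (a ℕ.+ c) (b ℕ.+ d)
        ; _*_ = λ (a , b) (c , d) → normalise (a ℕ.* c ℕ.+ b ℕ.* d) (a ℕ.* d ℕ.+ b ℕ.* c)
        ; -_  = λ (a , b) → b , a
        ; 0# = 0 , 0 ; 1# = 1 , 0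
        }
      module D = RawRing differences

      +-homo : ∀ x y → embed (x D.+ y) ≈ embed x + embed y
      +-homo (a , b) (c , d) = begin
        embed (normalise (a ℕ.+ c) (b ℕ.+ d))
          ≈⟨ normalise-correct (a ℕ.+ c) (b ℕ.+ d) ⟩
        (a ℕ.+ c) ×′ 1# + m * ((b ℕ.+ d) ×′ 1#)
          ≈⟨ +-cong (×-homo-+ 1# a c) (*-congˡ (×-homo-+ 1# b d)) ⟩
        (A + C) + m * (B + D)
          ≈⟨ solve 5 (λ m A B C D → (A :+ C) :+ m :* (B :+ D) :=
               (A :+ m :* B) :+ (C :+ m :* D)) refl m A B C D ⟩
        (A + m * B) + (C + m * D)
          ≈⟨ +-cong (unfold a b) (unfold c d) ⟨
        embed (a , b) + embed (c , d) ∎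
        where
        A = a ×′ 1#
        B = b ×′ 1#
        C = c ×′ 1#
        D = d ×′ 1#

      *-homo : ∀ x y → embed (x D.* y) ≈ embed x * embed y
      *-homo (a , b) (c , d) = begin
        embed ((a , b) D.* (c , d))
          ≈⟨ normalise-correct (a ℕ.* c ℕ.+ b ℕ.* d) (a ℕ.* d ℕ.+ b ℕ.* c) ⟩
        (a ℕ.* c ℕ.+ b ℕ.* d) ×′ 1# + m * ((a ℕ.* d ℕ.+ b ℕ.* c) ×′ 1#)
          ≈⟨ +-cong (trans (×-homo-+ 1# (a ℕ.* c) (b ℕ.* d)) (+-cong (×1-homo-* a c) (×1-homo-* b d)))
               (*-congˡ (trans (×-homo-+ 1# (a ℕ.* d) (b ℕ.* c)) (+-cong (×1-homo-* a d) (×1-homo-* b c)))) ⟩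
        (A * C + B * D) + m * (A * D + B * C)
          ≈⟨ +-congʳ (+-congˡ (trans (sym (*-identityˡ _)) (*-congʳ (sym m*m≈1)))) ⟩
        (A * C + (m * m) * (B * D)) + m * (A * D + B * C)
          ≈⟨ solve 5 (λ m A B C D → (A :* C :+ (m :* m) :* (B :* D)) :+ m :* (A :* D :+ B :* C) :=
               (A :+ m :* B) :* (C :+ m :* D)) refl m A B C D ⟩
        (A + m * B) * (C + m * D)
          ≈⟨ *-cong (unfold a b) (unfold c d) ⟨
        embed (a , b) * embed (c , d) ∎
        where
        A = a ×′ 1#
        B = b ×′ 1#
        C = c ×′ 1#
        D = d ×′ 1#

      -‿homo : ∀ x → embed (D.- x) ≈ - embed x
      -‿homo (a , b) = begin
        embed (b , a) ≈⟨ unfold b a ⟩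
        B + m * A ≈⟨ +-congʳ (trans (sym (*-identityˡ B)) (*-congʳ (sym m*m≈1))) ⟩
        (m * m) * B + m * A
          ≈⟨ solve 3 (λ m A B → (m :* m) :* B :+ m :* A := m :* (A :+ m :* B)) refl m A B ⟩
        m * (A + m * B) ≈⟨ -1*x≈-x _ ⟩
        - (A + m * B) ≈⟨ -‿cong (unfold a b) ⟨
        - embed (a , b) ∎
        where
        A = a ×′ 1#
        B = b ×′ 1#

      homomorphism : differences -Raw-AlmostCommutative⟶ fromCommutativeRing commutativeRing
      homomorphism = record
        { ⟦_⟧ = embed ; +-homo = +-homo ; *-homo = *-homo ; -‿homo = -‿homo
        ; 0-homo = refl ; 1-homo = refl }

      equal? : ∀ x y → Maybe (embed x ≈ embed y)
      equal? (a , b) (c , d) with a ℕ.+ d ℕ.≟ b ℕ.+ c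
      ... | no _  = nothing
      ... | yes p = just (begin
        embed (a , b) ≈⟨ unfold a b ⟩
        A + m * B ≈⟨ +-identityʳ _ ⟨
        (A + m * B) + 0# ≈⟨ +-congˡ (cancel D) ⟨
        (A + m * B) + (D + m * D)
          ≈⟨ solve 4 (λ m A B D → (A :+ m :* B) :+ (D :+ m :* D) :=
               (A :+ D) :+ m :* (B :+ D)) refl m A B D ⟩
        (A + D) + m * (B + D) ≈⟨ +-congʳ A+D≈B+C ⟩
        (B + C) + m * (B + D)
          ≈⟨ solve 4 (λ m B C D → (B :+ C) :+ m :* (B :+ D) :=
               (C :+ m :* D) :+ (B :+ m :* B)) refl m B C D ⟩
        (C + m * D) + (B + m * B) ≈⟨ +-congˡ (cancel B) ⟩
        (C + m * D) + 0# ≈⟨ +-identityʳ _ ⟩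
        C + m * D ≈⟨ unfold c d ⟨
        embed (c , d) ∎)
        where
        A = a ×′ 1#
        B = b ×′ 1#
        C = c ×′ 1#
        D = d ×′ 1#
        A+D≈B+C : A + D ≈ B + C
        A+D≈B+C = trans (sym (×-homo-+ 1# a d))
          (trans (reflexive (≡.cong (_×′ 1#) p)) (×-homo-+ 1# b c))

    open RingSolver differences (fromCommutativeRing commutativeRing) homomorphism equal?
      public using (solve; con; _:+_; _:*_; _:-_; :-_; _:=_)

  open Solver public using (solve; con; _:+_; _:*_; _:-_; :-_; _:=_)
  private module M = Max totalOrder

  ≤-refl : ∀ {x} → x ≤ x
  ≤-refl = O.refl

  ≤-reflexive : ∀ {x y} → x ≈ y → x ≤ y
  ≤-reflexive = O.reflexive

  ≤-trans : ∀ {x y z} → x ≤ y → y ≤ z → x ≤ z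
  ≤-trans = O.trans

  ≤-antisym : ∀ {x y} → x ≤ y → y ≤ x → x ≈ y
  ≤-antisym = O.antisym

  <⇒≤ : ∀ {x y} → x < y → x ≤ y
  <⇒≤ = proj₁

  ≰⇒> : ∀ {x y} → ¬ x ≤ y → y < x
  ≰⇒> {x} {y} x≰y with O.total x y
  ... | inj₁ x≤y = ⊥-elim (x≰y x≤y)
  ... | inj₂ y≤x = y≤x , λ y≈x → x≰y (≤-reflexive (sym y≈x))

  <⇒≱ : ∀ {x y} → x < y → ¬ y ≤ x
  <⇒≱ (x≤y , x≉y) y≤x = x≉y (≤-antisym x≤y y≤x)

  ≮⇒≥ : ∀ {x y} → ¬ x < y → y ≤ x
  ≮⇒≥ x≮y = byContradiction (λ y≰x → x≮y (≰⇒> y≰x))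

  ≤⊎> : ∀ x y → x ≤ y ⊎ y < x
  ≤⊎> x y with decide (x ≤ y)
  ... | inj₁ x≤y = inj₁ x≤y
  ... | inj₂ x≰y = inj₂ (≰⇒> x≰y)

  <-≤-trans : ∀ {x y z} → x < y → y ≤ z → x < z
  <-≤-trans x<y y≤z = ≰⇒> (λ z≤x → <⇒≱ x<y (≤-trans y≤z z≤x))

  ≤-<-trans : ∀ {x y z} → x ≤ y → y < z → x < z
  ≤-<-trans x≤y y<z = ≰⇒> (λ z≤x → <⇒≱ y<z (≤-trans z≤x x≤y))

  <-trans : ∀ {x y z} → x < y → y < z → x < z
  <-trans x<y y<z = ≤-<-trans (<⇒≤ x<y) y<z

  ≤-resp : ∀ {x x′ y y′} → x ≈ x′ → y ≈ y′ → x ≤ y → x′ ≤ y′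
  ≤-resp p q r = ≤-trans (≤-reflexive (sym p)) (≤-trans r (≤-reflexive q))

  infixl 6 _⊕_ _⊕<_

  _⊕_ : ∀ {a b c d} → a ≤ b → c ≤ d → a + c ≤ b + d
  _⊕_ {a} {b} {c} {d} p q = ≤-trans (+-monoˡ-≤ c p)
    (≤-resp (+-comm c b) (+-comm d b) (+-monoˡ-≤ b q))

  -- x ≤ y whenever y - x ≈ b - a for some a ≤ b, with both sides moved so that
  -- the side condition can be passed to the ring solver as it stands.
  linear : ∀ {a b x y} → a ≤ b → y + a ≈ x + b → x ≤ y
  linear {a} {b} {x} {y} p eq = ≤-resp (cancel x b) (cancel y b)
    (+-monoˡ-≤ (- b) (≤-resp eq refl (≤-refl {y} ⊕ p)))
    where
    cancel : ∀ x b → (x + b) + - b ≈ x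
    cancel = solve 2 (λ x b → (x :+ b) :+ :- b := x) refl

  linear< : ∀ {a b x y} → a < b → y + a ≈ x + b → x < y
  linear< {a} {b} {x} {y} p eq = ≰⇒> λ y≤x → <⇒≱ p
    (linear y≤x (trans (+-comm a y) (trans eq (+-comm x b))))

  _⊕<_ : ∀ {a b c d} → a ≤ b → c < d → a + c < b + d
  _⊕<_ {a} {b} {c} {d} p q = ≤-<-trans (p ⊕ ≤-refl {c})
    (linear< q (solve 3 (λ b c d → (b :+ d) :+ c := (b :+ c) :+ d) refl b c d))

  <⊕< : ∀ {a b c d} → a < b → c < d → a + c < b + d
  <⊕< p q = <⇒≤ p ⊕< q

  x+[y-x]≈y : ∀ x y → x + (y - x) ≈ y
  x+[y-x]≈y = solve 2 (λ x y → x :+ (y :- x) := y) refl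

  x≤x+y : ∀ {x y} → 0# ≤ y → x ≤ x + y
  x≤x+y {x} {y} p = linear p (solve 2 (λ x y → x :+ y :+ con (0 , 0) := x :+ y) refl x y)

  x<x+y : ∀ {x y} → 0# < y → x < x + y
  x<x+y {x} {y} p = linear< p (solve 2 (λ x y → x :+ y :+ con (0 , 0) := x :+ y) refl x y)

  x-y<x : ∀ {x y} → 0# < y → x - y < x
  x-y<x {x} {y} p = linear< p (solve 2 (λ x y → x :+ con (0 , 0) := (x :- y) :+ y) refl x y)

  ≤⇒0≤- : ∀ {x y} → x ≤ y → 0# ≤ y - x
  ≤⇒0≤- {x} {y} p = linear p (solve 2 (λ x y → (y :- x) :+ x := con (0 , 0) :+ y) refl x y)

  <⇒0<- : ∀ {x y} → x < y → 0# < y - x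
  <⇒0<- {x} {y} p = linear< p (solve 2 (λ x y → (y :- x) :+ x := con (0 , 0) :+ y) refl x y)

  -‿anti-≤ : ∀ {x y} → x ≤ y → - y ≤ - x
  -‿anti-≤ {x} {y} p = linear p (solve 2 (λ x y → :- x :+ x := :- y :+ y) refl x y)

  *-monoʳ : ∀ {x y z} → 0# ≤ x → y ≤ z → x * y ≤ x * z
  *-monoʳ {x} {y} {z} p q = linear (*-nonneg p (≤⇒0≤- q))
    (solve 3 (λ x y z → x :* z :+ con (0 , 0) := x :* y :+ x :* (z :- y)) refl x y z)

  *-mono : ∀ {a b c d} → 0# ≤ a → 0# ≤ d → a ≤ b → c ≤ d → a * c ≤ b * d
  *-mono {a} {b} {c} {d} 0≤a 0≤d p q = ≤-trans (*-monoʳ 0≤a q)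
    (≤-resp (*-comm d a) (*-comm d b) (*-monoʳ 0≤d p))

  x*x≥0 : ∀ x → 0# ≤ x * x
  x*x≥0 x with O.total 0# x
  ... | inj₁ p = *-nonneg p p
  ... | inj₂ p = ≤-resp refl (solve 1 (λ x → (:- x) :* (:- x) := x :* x) refl x)
    (*-nonneg 0≤-x 0≤-x)
    where 0≤-x = ≤-resp (solve 0 (:- con (0 , 0) := con (0 , 0)) refl) refl (-‿anti-≤ p)

  0<1 : 0# < 1#
  0<1 = ≤-resp refl (*-identityˡ 1#) (x*x≥0 1#) , 0≉1

  0≤1 : 0# ≤ 1#
  0≤1 = <⇒≤ 0<1

  *-pos : ∀ {x y} → 0# < x → 0# < y → 0# < x * y
  *-pos {x} {y} p q = *-nonneg (<⇒≤ p) (<⇒≤ q) , λ 0≈xy →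
    let (x⁻¹ , xx⁻¹≈1) = inverse x (λ x≈0 → proj₂ p (sym x≈0)) in
    proj₂ q (trans (sym (zeroˡ x⁻¹)) (trans (*-congʳ 0≈xy)
      (trans (solve 3 (λ x y z → x :* y :* z := y :* (x :* z)) refl x y x⁻¹)
        (trans (*-congˡ xx⁻¹≈1) (*-identityʳ y)))))

  abstract
    reciprocal : ∀ x → 0# < x → Σ[ y ∈ ℝ ] 0# < y × x * y ≈ 1#
    reciprocal x p with inverse x (λ x≈0 → proj₂ p (sym x≈0))
    ... | y , xy≈1 = y , ≰⇒> (λ y≤0 → <⇒≱ 0<1 (≤-resp xy≈1 (zeroʳ x) (*-monoʳ (<⇒≤ p) y≤0))) , xy≈1

  0<2 : 0# < 1# + 1#
  0<2 = <-trans 0<1 (x<x+y 0<1)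

  abstract
    ½ : ℝ
    ½ = proj₁ (reciprocal (1# + 1#) 0<2)

    half : ℝ → ℝ
    half x = ½ * x

    half-pos : ∀ {x} → 0# < x → 0# < half x
    half-pos = *-pos (proj₁ (proj₂ (reciprocal (1# + 1#) 0<2)))

    half+half : ∀ x → half x + half x ≈ x
    half+half x = trans (solve 2 (λ h x → h :* x :+ h :* x := con (2 , 0) :* h :* x) refl ½ x)
      (trans (*-congʳ (proj₂ (proj₂ (reciprocal (1# + 1#) 0<2)))) (*-identityˡ x))

  half< : ∀ {x} → 0# < x → half x < x
  half< {x} p = <-≤-trans (x<x+y (half-pos p)) (≤-reflexive (half+half x))

  abstract
    positive-minimum : ∀ {x y} → 0# < x → 0# < y → Σ[ z ∈ ℝ ] 0# < z × z ≤ x × z ≤ y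
    positive-minimum {x} {y} p q with O.total x y
    ... | inj₁ x≤y = x , p , ≤-refl , x≤y
    ... | inj₂ y≤x = y , q , y≤x , ≤-refl

  ≤-approx : ∀ {x y} → (∀ ε → 0# < ε → x ≤ y + ε) → x ≤ y
  ≤-approx {x} {y} h = ≮⇒≥ λ y<x → <⇒≱
    (linear< (half< (<⇒0<- y<x))
      (solve 3 (λ x y h → x :+ h := (y :+ h) :+ (x :- y)) refl x y (half (x - y))))
    (h (half (x - y)) (half-pos (<⇒0<- y<x)))

  ≤-max₁ : ∀ {x y} → x ≤ max x y
  ≤-max₁ {x} {y} = M.x≤x⊔y x y

  ≤-max₂ : ∀ {x y} → y ≤ max x y
  ≤-max₂ {x} {y} = M.x≤y⊔x _ _

  max-lub : ∀ {x y z} → x ≤ z → y ≤ z → max x y ≤ z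
  max-lub = M.⊔-lub

  max-lub< : ∀ {x y z} → x < z → y < z → max x y < z
  max-lub< {x} {y} p q with M.⊔-sel x y
  ... | inj₁ e = ≤-<-trans (≤-reflexive e) p
  ... | inj₂ e = ≤-<-trans (≤-reflexive e) q

  ∣∣-lub : ∀ {x y} → x ≤ y → - x ≤ y → ∣ x ∣ ≤ y
  ∣∣-lub = max-lub

  x≤∣x∣ : ∀ x → x ≤ ∣ x ∣
  x≤∣x∣ x = ≤-max₁

  -x≤∣x∣ : ∀ x → - x ≤ ∣ x ∣
  -x≤∣x∣ x = ≤-max₂

  ∣∣-cong : ∀ {x y} → x ≈ y → ∣ x ∣ ≈ ∣ y ∣
  ∣∣-cong p = M.⊔-cong p (-‿cong p)

  0≤∣∣ : ∀ x → 0# ≤ ∣ x ∣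
  0≤∣∣ x with O.total 0# x
  ... | inj₁ p = ≤-trans p (x≤∣x∣ x)
  ... | inj₂ p = ≤-trans (≤-resp (solve 0 (:- con (0 , 0) := con (0 , 0)) refl) refl (-‿anti-≤ p)) (-x≤∣x∣ x)

  ∣∣-nonneg : ∀ {x} → 0# ≤ x → ∣ x ∣ ≈ x
  ∣∣-nonneg {x} p = ≤-antisym (∣∣-lub ≤-refl
    (linear (p ⊕ p) (solve 1 (λ x → x :+ (con (0 , 0) :+ con (0 , 0)) := :- x :+ (x :+ x)) refl x)))
    (x≤∣x∣ x)

  ∣∣-neg : ∀ x → ∣ - x ∣ ≈ ∣ x ∣
  ∣∣-neg x = ≤-antisym
    (∣∣-lub (-x≤∣x∣ x) (≤-trans (≤-reflexive (-‿involutive x)) (x≤∣x∣ x)))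
    (∣∣-lub (≤-trans (≤-reflexive (sym (-‿involutive x))) (-x≤∣x∣ (- x))) (x≤∣x∣ (- x)))

  ∣∣-sym : ∀ x y → ∣ x - y ∣ ≈ ∣ y - x ∣
  ∣∣-sym x y = trans (∣∣-cong (solve 2 (λ x y → x :- y := :- (y :- x)) refl x y)) (∣∣-neg (y - x))

  ∣∣-0 : ∀ {x} → x ≈ 0# → ∣ x ∣ ≈ 0#
  ∣∣-0 p = trans (∣∣-cong p) (∣∣-nonneg ≤-refl)

  ∣x-x∣≈0 : ∀ {x y} → x ≈ y → ∣ x - y ∣ ≈ 0#
  ∣x-x∣≈0 {x} {y} p = ∣∣-0 (trans (+-congʳ p) (-‿inverseʳ y))

  ∣∣-+ : ∀ x y → ∣ x + y ∣ ≤ ∣ x ∣ + ∣ y ∣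
  ∣∣-+ x y = ∣∣-lub (x≤∣x∣ x ⊕ x≤∣x∣ y)
    (≤-resp (solve 2 (λ x y → :- x :+ :- y := :- (x :+ y)) refl x y) refl (-x≤∣x∣ x ⊕ -x≤∣x∣ y))

  ∣∣-triangle : ∀ x y z → ∣ x - z ∣ ≤ ∣ x - y ∣ + ∣ y - z ∣
  ∣∣-triangle x y z = ≤-resp
    (∣∣-cong (solve 3 (λ x y z → (x :- y) :+ (y :- z) := x :- z) refl x y z)) refl
    (∣∣-+ (x - y) (y - z))

  ∣-∣≤⇒≤+ : ∀ {x y ε} → ∣ x - y ∣ ≤ ε → x ≤ y + ε
  ∣-∣≤⇒≤+ {x} {y} {ε} p = linear (≤-trans (x≤∣x∣ (x - y)) p)
    (solve 3 (λ x y e → (y :+ e) :+ (x :- y) := x :+ e) refl x y ε)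

  ∣-∣<⇒<+ : ∀ {x y ε} → ∣ x - y ∣ < ε → x < y + ε
  ∣-∣<⇒<+ {x} {y} {ε} p = linear< (≤-<-trans (x≤∣x∣ (x - y)) p)
    (solve 3 (λ x y e → (y :+ e) :+ (x :- y) := x :+ e) refl x y ε)

  ∣-∣≤ : ∀ {x y ε} → x ≤ y + ε → y ≤ x + ε → ∣ x - y ∣ ≤ ε
  ∣-∣≤ {x} {y} {ε} p q = ∣∣-lub
    (linear p (solve 3 (λ x y e → e :+ x := (x :- y) :+ (y :+ e)) refl x y ε))
    (linear q (solve 3 (λ x y e → e :+ y := :- (x :- y) :+ (x :+ e)) refl x y ε))

  ∣-∣< : ∀ {x y ε} → x < y + ε → y < x + ε → ∣ x - y ∣ < ε
  ∣-∣< {x} {y} {ε} p q = max-lub<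
    (linear< p (solve 3 (λ x y e → e :+ x := (x :- y) :+ (y :+ e)) refl x y ε))
    (linear< q (solve 3 (λ x y e → e :+ y := :- (x :- y) :+ (x :+ e)) refl x y ε))

  halves< : ∀ {x y ε} → x < half ε → y < half ε → x + y < ε
  halves< {ε = ε} p q = <-≤-trans (<⊕< p q) (≤-reflexive (half+half ε))

  ≈-≤-trans : ∀ {x y z} → x ≈ y → y ≤ z → x ≤ z
  ≈-≤-trans p q = ≤-trans (≤-reflexive p) q

  ≤-≈-trans : ∀ {x y z} → x ≤ y → y ≈ z → x ≤ z
  ≤-≈-trans p q = ≤-trans p (≤-reflexive q)

  ≈-<-trans : ∀ {x y z} → x ≈ y → y < z → x < z
  ≈-<-trans p q = ≤-<-trans (≤-reflexive p) q

  <-≈-trans : ∀ {x y z} → x < y → y ≈ z → x < z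
  <-≈-trans p q = <-≤-trans p (≤-reflexive q)

  ∣∣-swap≤ : ∀ {x y z} → ∣ x - y ∣ ≤ z → ∣ y - x ∣ ≤ z
  ∣∣-swap≤ {x} {y} = ≈-≤-trans (∣∣-sym y x)

  ∣∣-swap< : ∀ {x y z} → ∣ x - y ∣ < z → ∣ y - x ∣ < z
  ∣∣-swap< {x} {y} = ≈-<-trans (∣∣-sym y x)

  ≈-approx : ∀ {x y} → (∀ ε → 0# < ε → ∣ x - y ∣ ≤ ε) → x ≈ y
  ≈-approx {x} {y} h = ≤-antisym (≤-approx λ ε p → ∣-∣≤⇒≤+ (h ε p))
    (≤-approx λ ε p → ∣-∣≤⇒≤+ (∣∣-swap≤ (h ε p)))

  fromℕ-+ : ∀ m n → fromℕ (m ℕ.+ n) ≈ fromℕ m + fromℕ n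
  fromℕ-+ = Mult.×-homo-+ semiring 1#

  fromℕ-* : ∀ m n → fromℕ (m ℕ.* n) ≈ fromℕ m * fromℕ n
  fromℕ-* = Mult.×1-homo-* semiring

  0≤fromℕ : ∀ n → 0# ≤ fromℕ n
  0≤fromℕ zero    = ≤-refl
  0≤fromℕ (suc n) = ≤-trans (0≤fromℕ n) (≤-≈-trans (x≤x+y 0≤1) (+-comm (fromℕ n) 1#))

  fromℕ-mono : ∀ {m n} → m ≤ℕ n → fromℕ m ≤ fromℕ n
  fromℕ-mono {n = n} ℕ.z≤n = 0≤fromℕ n
  fromℕ-mono (ℕ.s≤s p)     = ≤-refl ⊕ fromℕ-mono p

  abstract
    -- If the natural numbers were bounded, their supremum `m` would satisfy n + 1 ≤ m for all n,
    -- and m - 1 would be a smaller bound.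
    archimedean : ∀ x → ∃[ n ] x < fromℕ n
    archimedean x with decide (∃[ n ] x < fromℕ n)
    ... | inj₁ h = h
    ... | inj₂ h = ⊥-elim (contradiction (complete (λ v → ∃[ n ] v ≈ fromℕ n) (0# , 0 , refl)
            (x , λ (n , v≈n) → ≈-≤-trans v≈n (≮⇒≥ λ x<n → h (n , x<n)))))
      where
      contradiction : ¬ ∃ (IsSupremum _≤_ λ v → ∃[ n ] v ≈ fromℕ n)
      contradiction (m , upper , least) = <⇒≱ (x-y<x 0<1)
        (least λ {v} (n , v≈n) → linear (upper (suc n , refl))
          (trans (solve 2 (λ m n → (m :- con (1 , 0)) :+ (con (1 , 0) :+ n) := n :+ m) refl m (fromℕ n))
            (+-congʳ (sym v≈n))))

  private
    0<fromℕ-suc : ∀ n → 0# < fromℕ (suc n)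
    0<fromℕ-suc n = <-≤-trans 0<1 (x≤x+y (0≤fromℕ n))

  abstract
    -- The standard scale of precisions, 1 / (n + 1).
    ι : ℕ → ℝ
    ι n = proj₁ (reciprocal (fromℕ (suc n)) (0<fromℕ-suc n))

    0<ι : ∀ n → 0# < ι n
    0<ι n = proj₁ (proj₂ (reciprocal (fromℕ (suc n)) (0<fromℕ-suc n)))

    fromℕ*ι : ∀ n → fromℕ (suc n) * ι n ≈ 1#
    fromℕ*ι n = proj₂ (proj₂ (reciprocal (fromℕ (suc n)) (0<fromℕ-suc n)))

  ι-anti : ∀ {m n} → m ≤ℕ n → ι n ≤ ι m
  ι-anti {m} {n} p = ≤-resp
    (trans (sym (*-assoc (ι m) (fromℕ (suc m)) (ι n))) (trans (*-congʳ (trans (*-comm _ _) (fromℕ*ι m))) (*-identityˡ _)))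
    (trans (*-congˡ (fromℕ*ι n)) (*-identityʳ _))
    (*-monoʳ (<⇒≤ (0<ι m)) (*-mono (0≤fromℕ (suc m)) (<⇒≤ (0<ι n)) (fromℕ-mono (ℕ.s≤s p)) ≤-refl))

  reciprocal-anti : ∀ {x y z w} → 0# ≤ y → 0# ≤ w → x * y ≈ 1# → w * z ≈ 1# → x ≤ z → w ≤ y
  reciprocal-anti {x} {y} {z} {w} 0≤y 0≤w xy≈1 wz≈1 x≤z = ≤-resp
    (trans (solve 3 (λ x y w → y :* (w :* x) := w :* (x :* y)) refl x y w)
      (trans (*-congˡ xy≈1) (*-identityʳ w)))
    (trans (*-congˡ wz≈1) (*-identityʳ y))
    (*-monoʳ 0≤y (*-monoʳ 0≤w x≤z))

  abstract
    ι-small : ∀ ε → 0# < ε → ∃[ n ] ι n < ε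
    ι-small ε p =
      let (y , 0<y , εy≈1) = reciprocal ε p
          (n , y<n) = archimedean y
      in n , ≰⇒> λ ε≤ι → <⇒≱ y<n (≤-trans (fromℕ-mono (ℕ.n≤1+n n))
           (reciprocal-anti (<⇒≤ 0<y) (0≤fromℕ (suc n)) εy≈1 (fromℕ*ι n) ε≤ι))

  -- Infima, limits and compactness

  supremum-approx : ∀ {p} {S : Pred ℝ p} {m ε} → IsSupremum _≤_ S m → 0# < ε → ∃[ v ] S v × m - ε < v
  supremum-approx (_ , least) p = byContradiction λ none → <⇒≱ (x-y<x p)
    (least λ {v} Sv → ≮⇒≥ λ q → none (v , Sv , q))

  -- In contrast to `IsInfimum` this is about an indexed family, and approximation returns an index:
  -- an element of a ball or a tuple, which can then be named by constants.
  IsInf : ∀ {i} {I : Set i} → (I → ℝ) → ℝ → Set i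
  IsInf f m = (∀ i → m ≤ f i) × (∀ ε → 0# < ε → ∃[ i ] f i < m + ε)

  abstract
    -- Completeness is given for suprema, so the infimum is the supremum of the lower bounds.
    infimum-exists : {I : Set} (f : I → ℝ) → I → ∀ b → (∀ i → b ≤ f i) → ∃ (IsInf f)
    infimum-exists {I} f i₀ b b≤f = fromSupremum
      (complete (λ l → ∀ i → l ≤ f i) (b , b≤f) (f i₀ , λ l≤f → l≤f i₀))
      where
      fromSupremum : ∃ (IsSupremum _≤_ λ l → ∀ i → l ≤ f i) → ∃ (IsInf f)
      fromSupremum (m , upper , least) = m , (λ i → least λ m≤f → m≤f i) , λ ε p →
        byContradiction λ none → <⇒≱ (x<x+y p)
          (upper (λ i → ≮⇒≥ λ fi<m+ε → none (i , fi<m+ε)))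

  inf-mono : ∀ {i j} {I : Set i} {J : Set j} {f : I → ℝ} {g : J → ℝ} {m n ε} →
             IsInf f m → IsInf g n → (∀ i δ → 0# < δ → ∃[ j ] g j ≤ f i + ε + δ) → n ≤ m + ε
  inf-mono {f = f} {g} {m} {n} {ε} (_ , f-approx) (n≤g , _) h = ≤-approx λ δ p →
    let (i , fi<)  = f-approx (half δ) (half-pos p)
        (j , gj≤)  = h i (half δ) (half-pos p)
    in ≤-trans (n≤g j) (≤-trans gj≤ (linear (<⇒≤ fi<)
         (trans (solve 5 (λ m e d h x → (m :+ e :+ d) :+ x := (m :+ e :+ x) :+ d) refl m ε δ (half δ) (f i))
           (trans (+-congˡ (sym (half+half δ)))
             (solve 4 (λ m e h x → (m :+ e :+ x) :+ (h :+ h) := (x :+ e :+ h) :+ (m :+ h)) refl m ε (half δ) (f i))))))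

  inf-unique : ∀ {i} {I : Set i} {f : I → ℝ} {m n} → IsInf f m → IsInf f n → m ≈ n
  inf-unique p q = ≤-antisym (le q p) (le p q)
    where
    le : ∀ {m n} → IsInf _ m → IsInf _ n → n ≤ m
    le p q = ≤-resp refl (+-identityʳ _)
      (inf-mono p q λ i δ 0<δ → i , ≤-trans (x≤x+y ≤-refl) (x≤x+y (<⇒≤ 0<δ)))

  isInfimum⇒≤ : ∀ {p} {S : Pred ℝ p} {m} → IsInfimum S m → ∀ ε → 0# < ε → ∃[ v ] S v × v < m + ε
  isInfimum⇒≤ {S = S} {m} (_ , greatest) ε p = byContradiction λ none →
    <⇒≱ (x<x+y p) (greatest λ {v} Sv → ≮⇒≥ λ v<m+ε → none (v , Sv , v<m+ε))

  isInfimum : ∀ {p} {S : Pred ℝ p} {m} → (∀ v → S v → m ≤ v) →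
              (∀ ε → 0# < ε → ∃[ v ] S v × v < m + ε) → IsInfimum S m
  isInfimum lower approx = (λ {v} → lower v) , λ u≤S → ≤-approx λ ε p →
    let (v , Sv , v<m+ε) = approx ε p in ≤-trans (u≤S Sv) (<⇒≤ v<m+ε)

  -- Limits of real sequences

  Eventually : ∀ {p} → Pred ℕ p → Set p
  Eventually P = ∃[ N ] ∀ {n} → N ≤ℕ n → P n

  eventually-map : ∀ {p q} {P : Pred ℕ p} {Q : Pred ℕ q} →
                   (∀ {n} → P n → Q n) → Eventually P → Eventually Q
  eventually-map f (N , h) = N , λ p → f (h p)

  eventually-× : ∀ {p q} {P : Pred ℕ p} {Q : Pred ℕ q} →
                 Eventually P → Eventually Q → Eventually (λ n → P n × Q n)
  eventually-× (M , g) (N , h) = M ℕ.⊔ N ,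
    λ p → g (ℕ.≤-trans (ℕ.m≤m⊔n M N) p) , h (ℕ.≤-trans (ℕ.m≤n⊔m M N) p)

  eventually-Fin : ∀ {p} k {P : Fin k → Pred ℕ p} →
                   (∀ i → Eventually (P i)) → Eventually (λ n → ∀ i → P i n)
  eventually-Fin zero    h = 0 , λ _ ()
  eventually-Fin (suc k) h = eventually-map
    (λ { (p , q) fzero → p ; (p , q) (fsuc i) → q i })
    (eventually-× (h fzero) (eventually-Fin k (h ∘ fsuc)))

  eventually-∃ : ∀ {p} {P : Pred ℕ p} → Eventually P → ∃ P
  eventually-∃ (N , h) = N , h ℕ.≤-refl

  infix 4 _⟶_

  _⟶_ : (ℕ → ℝ) → ℝ → Set
  x ⟶ l = ∀ ε → 0# < ε → Eventually λ n → ∣ x n - l ∣ < ε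

  IsCauchy : (ℕ → ℝ) → Set
  IsCauchy x = ∀ ε → 0# < ε → ∃[ N ] ∀ {j k} → N ≤ℕ j → N ≤ℕ k → ∣ x j - x k ∣ < ε

  lim-cong : ∀ {x y l m} → (∀ n → x n ≈ y n) → l ≈ m → x ⟶ l → y ⟶ m
  lim-cong x≈y l≈m x⟶l ε p = eventually-map
    (λ {n} q → ≈-<-trans (∣∣-cong (+-cong (sym (x≈y n)) (-‿cong (sym l≈m)))) q) (x⟶l ε p)

  lim-const : ∀ {l} → (λ _ → l) ⟶ l
  lim-const ε p = 0 , λ _ → ≈-<-trans (∣x-x∣≈0 refl) p

  lim-≤ : ∀ {x y l m} → Eventually (λ n → x n ≤ y n) → x ⟶ l → y ⟶ m → l ≤ m
  lim-≤ {x} {y} {l} {m} x≤y x⟶l y⟶m = ≤-approx λ ε p →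
    let (n , x≤y , x~l , y~m) = eventually-∃ (eventually-× x≤y
          (eventually-× (x⟶l (half ε) (half-pos p)) (y⟶m (half ε) (half-pos p))))
        l≤x = ∣-∣≤⇒≤+ (∣∣-swap≤ (<⇒≤ x~l))
        y≤m = ∣-∣≤⇒≤+ (<⇒≤ y~m)
    in ≤-≈-trans (linear (l≤x ⊕ x≤y ⊕ y≤m)
         (solve 5 (λ l m x y h → (m :+ (h :+ h)) :+ (l :+ x :+ y) := l :+ ((x :+ h) :+ y :+ (m :+ h)))
           refl l m (x n) (y n) (half ε))) (+-congˡ (half+half ε))

  lim-unique : ∀ {x l m} → x ⟶ l → x ⟶ m → l ≈ m
  lim-unique p q = ≤-antisym (lim-≤ (0 , λ _ → ≤-refl) p q) (lim-≤ (0 , λ _ → ≤-refl) q p)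

  lim-+ : ∀ {x y l m} → x ⟶ l → y ⟶ m → (λ n → x n + y n) ⟶ l + m
  lim-+ {x} {y} {l} {m} x⟶l y⟶m ε p = eventually-map
    (λ {n} (q , r) → ≤-<-trans
      (≤-resp (∣∣-cong (solve 4 (λ x y l m → (x :- l) :+ (y :- m) := (x :+ y) :- (l :+ m)) refl (x n) (y n) l m))
        refl (∣∣-+ (x n - l) (y n - m)))
      (halves< q r))
    (eventually-× (x⟶l (half ε) (half-pos p)) (y⟶m (half ε) (half-pos p)))

  double-≤ : ∀ {x y} → x + x ≤ y + y → x ≤ y
  double-≤ p = ≮⇒≥ λ y<x → <⇒≱ (<⊕< y<x y<x) p

  -- A case split on signs is avoided by 2(ab - xy) = (a - x)(b + y) + (a + x)(b - y), which is
  -- nonnegative; changing the sign of y gives the bound for -xy.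
  ∣∣-* : ∀ {x y a b} → ∣ x ∣ ≤ a → ∣ y ∣ ≤ b → ∣ x * y ∣ ≤ a * b
  ∣∣-* {x} {y} {a} {b} p q = ∣∣-lub
    (double-≤ (linear (*-nonneg (≤⇒0≤- a≥x) (≤⇒0≤- b≥-y) ⊕ *-nonneg (≤⇒0≤- a≥-x) (≤⇒0≤- b≥y))
      (solve 4 (λ x y a b → (a :* b :+ a :* b) :+ (con (0 , 0) :+ con (0 , 0)) :=
        (x :* y :+ x :* y) :+ ((a :- x) :* (b :- :- y) :+ (a :- :- x) :* (b :- y))) refl x y a b)))
    (double-≤ (linear (*-nonneg (≤⇒0≤- a≥x) (≤⇒0≤- b≥y) ⊕ *-nonneg (≤⇒0≤- a≥-x) (≤⇒0≤- b≥-y))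
      (solve 4 (λ x y a b → (a :* b :+ a :* b) :+ (con (0 , 0) :+ con (0 , 0)) :=
        (:- (x :* y) :+ :- (x :* y)) :+ ((a :- x) :* (b :- y) :+ (a :- :- x) :* (b :- :- y))) refl x y a b)))
    where
    a≥x  = ≤-trans (x≤∣x∣ x) p
    a≥-x = ≤-trans (-x≤∣x∣ x) p
    b≥y  = ≤-trans (x≤∣x∣ y) q
    b≥-y = ≤-trans (-x≤∣x∣ y) q

  fromℕ*ι≤1 : ∀ n → fromℕ n * ι n ≤ 1#
  fromℕ*ι≤1 n = ≤-≈-trans
    (*-mono (0≤fromℕ n) (<⇒≤ (0<ι n)) (fromℕ-mono (ℕ.n≤1+n n)) ≤-refl)
    (fromℕ*ι n)

  abstract
    shrink : ∀ B ε → 0# < ε → Σ[ δ ∈ ℝ ] 0# < δ × fromℕ B * δ ≤ ε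
    shrink B ε p = ι B * ε , *-pos (0<ι B) p , ≤-resp (*-assoc _ _ _) (*-identityˡ ε)
      (*-mono (*-nonneg (0≤fromℕ B) (<⇒≤ (0<ι B))) (<⇒≤ p) (fromℕ*ι≤1 B) ≤-refl)

  lim-* : ∀ {x y l m} → x ⟶ l → y ⟶ m → (λ n → x n * y n) ⟶ l * m
  lim-* {x} {y} {l} {m} x⟶l y⟶m ε p = eventually-map
    (λ {n} (q , r , s) → ≤-<-trans
      (≤-resp (∣∣-cong (solve 4 (λ x y l m → x :* (y :- m) :+ (x :- l) :* m := x :* y :- l :* m)
                         refl (x n) (y n) l m)) refl
        (∣∣-+ (x n * (y n - m)) ((x n - l) * m)))
      (≤-<-trans
        (∣∣-* (<⇒≤ (bound q)) (<⇒≤ r) ⊕ ∣∣-* (<⇒≤ s) (<⇒≤ m<M))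
        (≈-<-trans (trans (solve 3 (λ L M d → L :* d :+ d :* M := (L :+ M) :* d) refl (fromℕ L) (fromℕ M) δ)
            (*-congʳ (sym (fromℕ-+ L M))))
          (≤-<-trans δ-small (half< p)))))
    (eventually-× (x⟶l 1# 0<1) (eventually-× (y⟶m δ 0<δ) (x⟶l δ 0<δ)))
    where
    L = proj₁ (archimedean (1# + ∣ l ∣))
    M = proj₁ (archimedean ∣ m ∣)
    m<M = proj₂ (archimedean ∣ m ∣)
    shrunk = shrink (L ℕ.+ M) (half ε) (half-pos p)
    δ = proj₁ shrunk
    0<δ = proj₁ (proj₂ shrunk)
    δ-small = proj₂ (proj₂ shrunk)
    bound : ∀ {n} → ∣ x n - l ∣ < 1# → ∣ x n ∣ < fromℕ L
    bound {n} q = ≤-<-trans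
      (≤-resp (∣∣-cong (solve 2 (λ x l → (x :- l) :+ l := x) refl (x n) l)) refl
        (≤-trans (∣∣-+ (x n - l) l) (<⇒≤ q ⊕ ≤-refl)))
      (proj₂ (archimedean (1# + ∣ l ∣)))

  -- The supremum of these numbers is the limit inferior, which for a Cauchy sequence is the limit;
  -- this reduces convergence of Cauchy sequences to `complete`.
  EventualLowerBound : (ℕ → ℝ) → Pred ℝ 0ℓ
  EventualLowerBound x y = Eventually λ n → y ≤ x n

  module _ {x : ℕ → ℝ} {ε : ℝ} {N : ℕ} (c : ∀ {j k} → N ≤ℕ j → N ≤ℕ k → ∣ x j - x k ∣ < ε) where

    eventual-lower : EventualLowerBound x (x N - ε)
    eventual-lower = N , λ {n} q → linear (∣-∣≤⇒≤+ (<⇒≤ (c ℕ.≤-refl q)))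
      (solve 3 (λ x y e → y :+ x := (x :- e) :+ (y :+ e)) refl (x N) (x n) ε)

    eventual-upper : ∀ {y} → EventualLowerBound x y → y ≤ x N + ε
    eventual-upper (M , h) = ≤-trans (h (ℕ.m≤m⊔n M N))
      (∣-∣≤⇒≤+ (<⇒≤ (c (ℕ.m≤n⊔m M N) ℕ.≤-refl)))

    eventual-close : ∀ {l} → IsSupremum _≤_ (EventualLowerBound x) l → ∣ x N - l ∣ ≤ ε
    eventual-close {l} (upper , least) = ∣-∣≤
      (linear (upper eventual-lower) (solve 3 (λ x l h → (l :+ h) :+ (x :- h) := x :+ l) refl (x N) l ε))
      (least eventual-upper)

  abstract
    cauchy⇒limit : ∀ {x} → IsCauchy x → ∃[ l ] x ⟶ l
    cauchy⇒limit {x} cauchy =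
      let (N , c) = cauchy 1# 0<1
          (l , sup) = complete (EventualLowerBound x)
            (_ , eventual-lower {x} c) (_ , eventual-upper {x} c)
      in l , λ ε p →
        let h = half (half ε)
            (N , c) = cauchy h (half-pos (half-pos p))
        in N , λ {n} q → ≤-<-trans
          (≤-trans (∣∣-triangle (x n) (x N) l) (<⇒≤ (c q ℕ.≤-refl) ⊕ eventual-close {x} c sup))
          (≈-<-trans (half+half (half ε)) (half< p))

  -- Continuous functions on compact boxes

  ContinuousFunction : ∀ {k} → (Vector ℝ k → ℝ) → Set
  ContinuousFunction {k} f = ∀ x ε → 0# < ε → ∃[ δ ] 0# < δ ×
    (∀ y → (∀ i → ∣ x i - y i ∣ < δ) → ∣ f x - f y ∣ < ε)

  continuous-cong : ∀ {k} {f : Vector ℝ k → ℝ} → ContinuousFunction f →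
                    ∀ {x y} → (∀ i → x i ≈ y i) → f x ≈ f y
  continuous-cong c {x} {y} x≈y = ≈-approx λ ε p →
    let (δ , 0<δ , h) = c x ε p in
    <⇒≤ (h y λ i → ≈-<-trans (∣x-x∣≈0 (x≈y i)) 0<δ)

  continuous-lim : ∀ {k} {f : Vector ℝ k → ℝ} → ContinuousFunction f →
                   ∀ {v : ℕ → Vector ℝ k} {l} → (∀ i → (λ n → v n i) ⟶ l i) → (λ n → f (v n)) ⟶ f l
  continuous-lim {f = f} c {v} {l} v⟶l ε p =
    let (δ , 0<δ , h) = c l ε p in
    eventually-map
      (λ {n} q → ∣∣-swap<
        (h (v n) λ i → ∣∣-swap< (q i)))
      (eventually-Fin _ λ i → v⟶l i δ 0<δ)

  Increasing : ∀ {a p} {A : Set a} → (A → Pred ℕ p) → Set _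
  Increasing G = ∀ {x m n} → m ≤ℕ n → G x m → G x n

  abstract
    -- Heine-Borel by a least upper bound. At the supremum of the `x` up to which a single `n`
    -- works, the local neighbourhood carries `x` further unless `hi` has been passed. Since `H` is
    -- increasing, a finite subcover amounts to a maximum of indices.
    compact-interval : ∀ lo hi (H : ℝ → Pred ℕ 0ℓ) → Increasing H →
      (∀ t → ∃[ n ] ∃[ η ] 0# < η × (∀ s → ∣ s - t ∣ < η → H s n)) →
      ∃[ n ] ∀ t → lo ≤ t → t ≤ hi → H t n
    compact-interval lo hi H inc local =
      cases (≤⊎> lo hi) covers
        (λ hi<lo → 0 , λ t lo≤t t≤hi → ⊥-elim (<⇒≱ hi<lo (≤-trans lo≤t t≤hi)))
      where
      Good : Pred ℝ 0ℓ
      Good x = x ≤ hi × ∃[ n ] ∀ t → lo ≤ t → t ≤ x → H t n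

      extend : ∀ {c η n₁ x n₂} → 0# < η → (∀ s → ∣ s - c ∣ < η → H s n₁) →
               (∀ t → lo ≤ t → t ≤ x → H t n₂) → c - η < x →
               ∀ t → lo ≤ t → t ≤ c + half η → H t (n₁ ℕ.⊔ n₂)
      extend {c} {η} {n₁} {x} {n₂} 0<η near h c-η<x t lo≤t t≤ =
        cases (≤⊎> t x)
          (λ t≤x → inc (ℕ.m≤n⊔m n₁ n₂) (h t lo≤t t≤x))
          (λ x<t → inc (ℕ.m≤m⊔n n₁ n₂) (near t (∣-∣<
             (≤-<-trans t≤ (linear< (half< 0<η) (solve 3 (λ c e h → (c :+ e) :+ h := (c :+ h) :+ e) refl c η (half η))))
             (linear< (<-trans c-η<x x<t) (solve 3 (λ c e t → (t :+ e) :+ (c :- e) := c :+ t) refl c η t)))))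
      finish : ∀ {c η n₁} → IsSupremum _≤_ Good c → 0# < η → (∀ s → ∣ s - c ∣ < η → H s n₁) →
               ∃[ x ] Good x × c - η < x → ∃[ n ] ∀ t → lo ≤ t → t ≤ hi → H t n
      finish {c} {η} {n₁} (upper , least) 0<η near (x , (_ , n₂ , h) , c-η<x) =
        cases (≤⊎> (c + half η) hi)
          (λ p → ⊥-elim (<⇒≱ (x<x+y (half-pos 0<η)) (upper (p , n₁ ℕ.⊔ n₂ , extend 0<η near h c-η<x))))
          (λ p → n₁ ℕ.⊔ n₂ , λ t lo≤t t≤hi → extend 0<η near h c-η<x t lo≤t (≤-trans t≤hi (<⇒≤ p)))

      fromSupremum : ∃ (IsSupremum _≤_ Good) → ∃[ n ] ∀ t → lo ≤ t → t ≤ hi → H t n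
      fromSupremum (c , sup) = let (n₁ , η , 0<η , near) = local c in
        finish sup 0<η near (supremum-approx sup 0<η)

      covers : lo ≤ hi → ∃[ n ] ∀ t → lo ≤ t → t ≤ hi → H t n
      covers lo≤hi = let (n , η , 0<η , near) = local lo in
        fromSupremum (complete Good
          (lo , lo≤hi , n , λ t lo≤t t≤lo →
            near t (≈-<-trans (∣x-x∣≈0 (≤-antisym t≤lo lo≤t)) 0<η))
          (hi , proj₁))

  InBox : ∀ {k} → ℝ → Pred (Vector ℝ k) 0ℓ
  InBox M x = ∀ i → ∣ x i ∣ ≤ M

  abstract
    -- Induction on the dimension, with the interval as first coordinate. Vectors are functions
    -- without extensionality, so `G` is required to respect pointwise equality.
    compact-box : ∀ k M (G : Vector ℝ k → Pred ℕ 0ℓ) → Increasing G →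
      (∀ {x y : Vector ℝ k} {n} → (∀ i → x i ≡ y i) → G x n → G y n) →
      (∀ (x : Vector ℝ k) → ∃[ n ] ∃[ η ] 0# < η × (∀ y → (∀ i → ∣ y i - x i ∣ < η) → G y n)) →
      ∃[ n ] ∀ y → InBox M y → G y n
    compact-box zero M G inc resp local =
      let (n , _ , _ , h) = local (λ ()) in n , λ y _ → h y λ ()
    compact-box (suc k) M G inc resp local =
      let (n , h) = compact-interval (- M) M H (λ p h y b → inc p (h y b)) H-local in
      n , λ y b → resp (λ { fzero → ≡.refl ; (fsuc i) → ≡.refl })
        (h (y fzero)
          (≤-resp refl (solve 1 (λ x → :- :- x := x) refl (y fzero)) (-‿anti-≤ (≤-trans (-x≤∣x∣ (y fzero)) (b fzero))))
          (≤-trans (x≤∣x∣ (y fzero)) (b fzero)) (y ∘ fsuc) (b ∘ fsuc))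
      where
      H : ℝ → Pred ℕ 0ℓ
      H t n = ∀ y → InBox M y → G (t ∷ᵛ y) n

      -- The tube lemma: the slice over t is covered by boxes of height ι n.
      tube : ∀ t → ∃[ n ] ∀ y → InBox M y → ∀ s → ∣ s - t ∣ < ι n → G (s ∷ᵛ y) n
      tube t = compact-box k M (λ y n → ∀ s → ∣ s - t ∣ < ι n → G (s ∷ᵛ y) n)
        (λ p h s q → inc p (h s (<-≤-trans q (ι-anti p))))
        (λ x≡y h s q → resp (λ { fzero → ≡.refl ; (fsuc i) → x≡y i }) (h s q))
        λ x → let (n , η , 0<η , h) = local (t ∷ᵛ x)
                  (m , ιm<η) = ι-small η 0<η
              in n ℕ.⊔ m , η , 0<η , λ y q s r → inc (ℕ.m≤m⊔n n m) (h (s ∷ᵛ y)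
                   λ { fzero → <-trans (<-≤-trans r (ι-anti (ℕ.m≤n⊔m n m))) ιm<η ; (fsuc i) → q i })

      H-local : ∀ t → ∃[ n ] ∃[ η ] 0# < η × (∀ s → ∣ s - t ∣ < η → H s n)
      H-local t = let (n , h) = tube t in n , ι n , 0<ι n , λ s q y b → h y b s q

  module _ {k : ℕ} {f : Vector ℝ k → ℝ} (c : ContinuousFunction f) (M : ℝ) where

    abstract
      bounded-on-box : ∃[ n ] ∀ x → InBox M x → ∣ f x ∣ ≤ fromℕ n
      bounded-on-box = compact-box k M (λ x n → ∣ f x ∣ ≤ fromℕ n)
        (λ p q → ≤-trans q (fromℕ-mono p))
        (λ x≡y → ≤-resp (∣∣-cong (continuous-cong c λ i → reflexive (x≡y i))) refl)
        λ x → let (δ , 0<δ , h) = c x 1# 0<1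
                  (n , fx+1<n) = archimedean (∣ f x ∣ + 1#)
              in n , δ , 0<δ , λ y q → ≤-trans
                (≤-trans (≤-resp (∣∣-cong (x+[y-x]≈y (f x) (f y))) refl (∣∣-+ (f x) (f y - f x)))
                  (≤-refl ⊕ ∣∣-swap≤
                    (<⇒≤ (h y λ i → ∣∣-swap< (q i)))))
                (<⇒≤ fx+1<n)

      -- Only `x` is confined to the box. The radius of continuity at a centre is halved: one half
      -- for the points covered by the centre, the other for their distance to `y`.
      uniform-on-box : ∀ ε → 0# < ε →
        ∃[ n ] ∀ x → InBox M x → ∀ y → (∀ i → ∣ x i - y i ∣ ≤ ι n) → ∣ f x - f y ∣ < ε
      uniform-on-box ε p = compact-box k M
        (λ x n → ∀ y → (∀ i → ∣ x i - y i ∣ ≤ ι n) → ∣ f x - f y ∣ < ε)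
        (λ m≤n h y q → h y λ i → ≤-trans (q i) (ι-anti m≤n))
        (λ {x} {x′} x≡x′ h y q → ≈-<-trans (∣∣-cong (+-congʳ (continuous-cong c λ i → reflexive (≡.sym (x≡x′ i)))))
          (h y λ i → ≈-≤-trans (∣∣-cong (+-congʳ (reflexive (x≡x′ i)))) (q i)))
        λ x → let (δ , 0<δ , h) = c x (half ε) (half-pos p)
                  (n , ιn<) = ι-small (half δ) (half-pos 0<δ)
              in n , half δ , half-pos 0<δ , λ y q z r → ≤-<-trans (∣∣-triangle (f y) (f x) (f z))
                (halves< (∣∣-swap<
                    (h y λ i → ∣∣-swap< (<-trans (q i) (half< 0<δ))))
                  (h z λ i → ≤-<-trans (∣∣-triangle (x i) (y i) (z i))
                    (halves< (∣∣-swap< (q i)) (≤-<-trans (r i) ιn<))))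

  -- Separability is shown by classifying the elements, up to distance ι n, by
  -- codes in the countable set Tree.
  module _ {x c : Level} {X : Set x} (x₀ : X) (Close : ℕ → X → X → Set c) (code : ℕ → X → Tree)
           (close : ∀ n {x y} → code n x ≡ code n y → Close n x y) where

    private
      representative : ∀ n t → X
      representative n t with decide (∃[ x ] code n x ≡ t)
      ... | inj₁ (x , _) = x
      ... | inj₂ _       = x₀

      representative-close : ∀ n x → Close n x (representative n (code n x))
      representative-close n x with decide (∃[ y ] code n y ≡ code n x)
      ... | inj₁ (y , p) = close n (≡.sym p)
      ... | inj₂ none    = ⊥-elim (none (x , ≡.refl))

      pairs : Enumerable (ℕ × Tree)
      pairs = enumerable-× enumerable-ℕ enumerable-Tree

    abstract
      countable-net : Σ[ e ∈ (ℕ → X) ] ∀ x n → ∃[ i ] Close n x (e i)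
      countable-net = (λ i → representative (proj₁ (proj₁ pairs i)) (proj₂ (proj₁ pairs i))) ,
        λ x n → let (i , p) = proj₂ pairs (n , code n x) in
          i , ≡.subst (λ q → Close n x (representative (proj₁ q) (proj₂ q))) (≡.sym p) (representative-close n x)

  rational : ℕ × ℕ × ℕ → ℝ
  rational (i , j , k) = ι k * (fromℕ i - fromℕ j)

  abstract
    floor : ∀ N {y} → 0# ≤ y → y < fromℕ N → ∃[ j ] ∣ y - fromℕ j ∣ ≤ 1#
    floor zero    0≤y y<0 = ⊥-elim (<⇒≱ y<0 0≤y)
    floor (suc N) {y} 0≤y y<N = cases (≤⊎> 1# y)
      (λ 1≤y → let (j , h) = floor N (≤⇒0≤- 1≤y)
                     (linear< y<N (solve 2 (λ y n → n :+ y := (y :- con (1 , 0)) :+ (con (1 , 0) :+ n)) refl y (fromℕ N)))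
               in suc j , ≤-resp (∣∣-cong (solve 2 (λ y n → (y :- con (1 , 0)) :- n := y :- (con (1 , 0) :+ n)) refl y (fromℕ j))) refl h)
      (λ y<1 → 0 , ≈-≤-trans (trans (∣∣-cong (solve 1 (λ y → y :- con (0 , 0) := y) refl y)) (∣∣-nonneg 0≤y)) (<⇒≤ y<1))

    rational-dense : ∀ x n → ∃[ q ] ∣ x - rational q ∣ ≤ ι n
    rational-dense x n =
      let N = fromℕ (suc n)
          (B , Nx<B) = archimedean ∣ N * x ∣
          -- Adding `B` makes N x nonnegative, as `floor` asks; `rational` subtracts the same `B`
          -- again.
          (i , h) = floor (B ℕ.+ B) {N * x + fromℕ B}
            (linear (≤-trans (-x≤∣x∣ (N * x)) (<⇒≤ Nx<B)) (solve 2 (λ y n → (y :+ n) :+ :- y := con (0 , 0) :+ n) refl (N * x) (fromℕ B)))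
            (<-≈-trans (linear< (≤-<-trans (x≤∣x∣ (N * x)) Nx<B) (solve 2 (λ y n → (n :+ n) :+ y := (y :+ n) :+ n) refl (N * x) (fromℕ B)))
              (sym (fromℕ-+ B B)))
      in (i , B , n) , ≤-resp
           (∣∣-cong (trans (solve 5 (λ ι N x B i → ι :* ((N :* x :+ B) :- i) := (N :* ι) :* x :- ι :* (i :- B)) refl (ι n) N x (fromℕ B) (fromℕ i))
             (+-congʳ (trans (*-congʳ (fromℕ*ι n)) (*-identityˡ x)))))
           (*-identityʳ (ι n))
           (∣∣-* (≤-reflexive (∣∣-nonneg (<⇒≤ (0<ι n)))) h)

    countable-dense-reals : Σ[ q ∈ (ℕ → ℝ) ] ∀ x n → ∃[ i ] ∣ x - q i ∣ ≤ ι n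
    countable-dense-reals =
      let (e , e-surj) = enumerable-× enumerable-ℕ (enumerable-× enumerable-ℕ enumerable-ℕ)
      in (λ i → rational (e i)) , λ x n →
           let (q , h) = rational-dense x n
               (i , p) = e-surj q
           in i , ≡.subst (λ q → ∣ x - rational q ∣ ≤ ι n) (≡.sym p) h

  abstract
    divide : ∀ B n → ∃[ m ] fromℕ B * ι m ≤ ι n
    divide B n =
      let (δ , 0<δ , h) = shrink B (ι n) (0<ι n)
          (m , ιm<δ) = ι-small δ 0<δ
      in m , ≤-trans (*-monoʳ (0≤fromℕ B) (<⇒≤ ιm<δ)) h

  divide₂ : ∀ n → ∃[ m ] ι m + ι m ≤ ι n
  divide₂ n = let (m , h) = divide 2 n in m , ≤-resp
    (solve 1 (λ x → (con (1 , 0) :+ (con (1 , 0) :+ con (0 , 0))) :* x := x :+ x) refl (ι m)) refl h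

  abstract
    realCode : ℕ → ℝ → Tree
    realCode n x = leaf (proj₁ (proj₂ countable-dense-reals x (proj₁ (divide₂ n))))

    -- Equal codes name the same point of the dense sequence, which is within half of the precision
    -- of both numbers.
    realCode-close : ∀ n {x y} → realCode n x ≡ realCode n y → ∣ x - y ∣ ≤ ι n
    realCode-close n {x} {y} p =
      let (i , x~q) = proj₂ countable-dense-reals x (proj₁ (divide₂ n))
          (j , y~q) = proj₂ countable-dense-reals y (proj₁ (divide₂ n))
          q = proj₁ countable-dense-reals
      in ≤-trans (∣∣-triangle x (q i) y) (≤-trans
           (x~q ⊕ ≤-resp (trans (∣∣-sym y (q j)) (∣∣-cong (+-congʳ (reflexive (≡.cong q (≡.sym (leaf-injective p))))))) refl y~q)
           (proj₂ (divide₂ n)))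

  -- Functions on the box [-M, M]^k are coded by their rounded values on a finite
  -- grid of rationals that meets every interval of radius ι N.
  module _ (M N n : ℕ) where

    private
      gridPoint : ℕ → ℝ
      gridPoint = proj₁ countable-dense-reals

    abstract
      gridBound : ∃[ K ] ∀ x → - fromℕ M ≤ x → x ≤ fromℕ M → ∃[ j ] j ≤ℕ K × ∣ x - gridPoint j ∣ ≤ ι N
      gridBound = compact-interval (- fromℕ M) (fromℕ M) (λ x K → ∃[ j ] j ≤ℕ K × ∣ x - gridPoint j ∣ ≤ ι N)
        (λ m≤n (j , j≤m , h) → j , ℕ.≤-trans j≤m m≤n , h)
        λ x → let (m , h) = divide₂ N
                  (j , near) = proj₂ countable-dense-reals x m
              in j , ι m , 0<ι m , λ y y~x → j , ℕ.≤-refl ,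
                   ≤-trans (∣∣-triangle y x (gridPoint j)) (≤-trans (<⇒≤ y~x ⊕ near) h)

    private
      K : ℕ
      K = suc (proj₁ gridBound)

    gridPoint-near : ∀ {x} → ∣ x ∣ ≤ fromℕ M → Σ[ j ∈ Fin K ] ∣ x - gridPoint (toℕ j) ∣ ≤ ι N
    gridPoint-near {x} p =
      let (j , j≤K , h) = proj₂ gridBound x
            (linear (≤-trans (-x≤∣x∣ x) p) (solve 2 (λ x m → x :+ :- x := :- m :+ m) refl x (fromℕ M))) (≤-trans (x≤∣x∣ x) p)
      in fromℕ< (ℕ.s≤s j≤K) , ≡.subst (λ j → ∣ x - gridPoint j ∣ ≤ ι N) (≡.sym (toℕ-fromℕ< (ℕ.s≤s j≤K))) h

    mutual
      functionCode : ∀ k → (Vector ℝ k → ℝ) → Tree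
      functionCode zero    f = realCode n (f []ᵛ)
      functionCode (suc k) f = tabulateTree (sliceCode k f)

      sliceCode : ∀ k → (Vector ℝ (suc k) → ℝ) → Fin K → Tree
      sliceCode k f j = functionCode k λ x → f (gridPoint (toℕ j) ∷ᵛ x)

    -- Equal codes tell something only about grid points, hence the nearby `z` in place of `x`. The
    -- way back to `x` is by uniform continuity, in `conn-close`.
    functionCode-close : ∀ k {f g : Vector ℝ k → ℝ} → functionCode k f ≡ functionCode k g →
      ∀ x → InBox (fromℕ M) x → ∃[ z ] (∀ i → ∣ x i - z i ∣ ≤ ι N) × ∣ f z - g z ∣ ≤ ι n
    functionCode-close zero    p x b = []ᵛ , (λ ()) , realCode-close n p
    functionCode-close (suc k) {f} {g} p x b = prepend (gridPoint-near (b fzero))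
      where
      prepend : Σ[ j ∈ Fin K ] ∣ x fzero - gridPoint (toℕ j) ∣ ≤ ι N →
                ∃[ z ] (∀ i → ∣ x i - z i ∣ ≤ ι N) × ∣ f z - g z ∣ ≤ ι n
      prepend (j , near) =
        let (z , h , q) = functionCode-close k
              (tabulateTree-injective {f = sliceCode k f} {sliceCode k g} p j) (x ∘ fsuc) (b ∘ fsuc)
        in gridPoint (toℕ j) ∷ᵛ z , (λ { fzero → near ; (fsuc i) → h i }) , q

  -- C*-algebras

  re im : ℂ → ℝ
  re (a , b) = a
  im (a , b) = b

  -- A substitute for the modulus without square roots. The real and imaginary parts of a scalar
  -- have moduli in the sense of `IsModulus`, so by the triangle inequality their sum bounds scalar
  -- multiplication.
  ∣_∣₁ : ℂ → ℝ
  ∣ a , b ∣₁ = ∣ a ∣ + ∣ b ∣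

  0≤∣∣₁ : ∀ z → 0# ≤ ∣ z ∣₁
  0≤∣∣₁ (a , b) = ≤-resp (+-identityʳ 0#) refl (0≤∣∣ a ⊕ 0≤∣∣ b)

  ∣∣*∣∣ : ∀ a → ∣ a ∣ * ∣ a ∣ ≈ a * a
  ∣∣*∣∣ a = cases (≤⊎> 0# a)
    (λ p → *-cong (∣∣-nonneg p) (∣∣-nonneg p))
    (λ p → let q = trans (sym (∣∣-neg a)) (∣∣-nonneg (linear (<⇒≤ p) (solve 1 (λ a → (:- a) :+ a := con (0 , 0) :+ con (0 , 0)) refl a)))
           in trans (*-cong q q) (solve 1 (λ a → :- a :* :- a := a :* a) refl a))

  isModulus-re : ∀ a → IsModulus (a , 0#) ∣ a ∣
  isModulus-re a = 0≤∣∣ a , trans (∣∣*∣∣ a) (solve 1 (λ a → a :* a := a :* a :+ con (0 , 0) :* con (0 , 0)) refl a)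

  isModulus-im : ∀ b → IsModulus (0# , b) ∣ b ∣
  isModulus-im b = 0≤∣∣ b , trans (∣∣*∣∣ b) (solve 1 (λ b → b :* b := con (0 , 0) :* con (0 , 0) :+ b :* b) refl b)

  square-injective : ∀ {x y} → 0# ≤ x → 0# ≤ y → x * x ≤ y * y → x ≤ y
  square-injective {x} {y} 0≤x 0≤y p = ≮⇒≥ λ y<x → <⇒≱
    (linear< (*-pos (<⇒0<- y<x) (≤-<-trans 0≤y (<-≤-trans y<x (x≤x+y 0≤y))))
      (solve 2 (λ x y → x :* x :+ con (0 , 0) := y :* y :+ (x :- y) :* (x :+ y)) refl x y)) p

  module _ (A : CStarAlgebra) where
    open CStarAlgebra A hiding (Carrier; Ball)
    open LeftModule leftModule public using
      (+ᴹ-cong; +ᴹ-assoc; +ᴹ-comm; +ᴹ-identityˡ; +ᴹ-identityʳ; -ᴹ‿cong; -ᴹ‿inverseˡ; -ᴹ‿inverseʳ;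
       *ₗ-cong; *ₗ-zeroˡ; *ₗ-zeroʳ; *ₗ-distribˡ; *ₗ-distribʳ; *ₗ-identityˡ; *ₗ-assoc;
       ≈ᴹ-refl; ≈ᴹ-sym; ≈ᴹ-trans; ≈ᴹ-reflexive; ≈ᴹ-setoid; +ᴹ-abelianGroup)
    private
      rng : RingWithoutOne 0ℓ 0ℓ
      rng = record { isRingWithoutOne = isRingWithoutOne }
      module G = AbelianGroupProperties +ᴹ-abelianGroup
      module S = CommutativeSemigroupProperties (AbelianGroup.commutativeSemigroup +ᴹ-abelianGroup)
      module P = RingWithoutOneProperties rng
    open RingWithoutOne rng public using () renaming
      (*-cong to ·-cong; *-assoc to ·-assoc; distribˡ to ·-distribˡ; distribʳ to ·-distribʳ)
    open SetoidReasoning ≈ᴹ-setoid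

    private
      infixl 6 _-ᴹ_
      _-ᴹ_ : Carrier A → Carrier A → Carrier A
      x -ᴹ y = x +ᴹ (-ᴹ y)

      _×-_ : ∀ {x x′ y y′} → x ≈ᴹ x′ → y ≈ᴹ y′ → x -ᴹ y ≈ᴹ x′ -ᴹ y′
      p ×- q = +ᴹ-cong p (-ᴹ‿cong q)

    -ᴹ≈-1*ₗ : ∀ x → (ℂ.- 1ᶜ) *ₗ x ≈ᴹ -ᴹ x
    -ᴹ≈-1*ₗ x = G.inverseˡ-unique ((ℂ.- 1ᶜ) *ₗ x) x (begin
      (ℂ.- 1ᶜ) *ₗ x +ᴹ x          ≈⟨ +ᴹ-cong ≈ᴹ-refl (*ₗ-identityˡ x) ⟨
      (ℂ.- 1ᶜ) *ₗ x +ᴹ 1ᶜ *ₗ x    ≈⟨ *ₗ-distribʳ x (ℂ.- 1ᶜ) 1ᶜ ⟨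
      ((ℂ.- 1ᶜ) ℂ.+ 1ᶜ) *ₗ x      ≈⟨ *ₗ-cong (ℂ.-‿inverseˡ 1ᶜ) ≈ᴹ-refl ⟩
      ℂ.0# *ₗ x                   ≈⟨ *ₗ-zeroˡ x ⟩
      0ᴹ                          ∎)

    telescope : ∀ x y z → x -ᴹ z ≈ᴹ (x -ᴹ y) +ᴹ (y -ᴹ z)
    telescope x y z = ≈ᴹ-sym (begin
      (x -ᴹ y) +ᴹ (y -ᴹ z)     ≈⟨ +ᴹ-assoc x (-ᴹ y) (y -ᴹ z) ⟩
      x +ᴹ (-ᴹ y +ᴹ (y -ᴹ z))  ≈⟨ +ᴹ-cong ≈ᴹ-refl (+ᴹ-assoc (-ᴹ y) y (-ᴹ z)) ⟨
      x +ᴹ ((-ᴹ y +ᴹ y) -ᴹ z)  ≈⟨ +ᴹ-cong ≈ᴹ-refl (+ᴹ-cong (-ᴹ‿inverseˡ y) ≈ᴹ-refl) ⟩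
      x +ᴹ (0ᴹ -ᴹ z)           ≈⟨ +ᴹ-cong ≈ᴹ-refl (+ᴹ-identityˡ (-ᴹ z)) ⟩
      x -ᴹ z                   ∎)

    ‖0‖≈0 : ‖ 0ᴹ ‖ ≈ 0#
    ‖0‖≈0 = trans (‖‖-cong (≈ᴹ-sym (*ₗ-zeroˡ 0ᴹ)))
      (trans (‖‖-homogeneous ℂ.0# 0ᴹ (≤-refl , solve 0 (con (0 , 0) :* con (0 , 0) := con (0 , 0) :* con (0 , 0) :+ con (0 , 0) :* con (0 , 0)) refl))
        (zeroˡ _))

    ‖-‖ : ∀ x → ‖ -ᴹ x ‖ ≈ ‖ x ‖
    ‖-‖ x = trans (‖‖-cong (≈ᴹ-sym (-ᴹ≈-1*ₗ x)))
      (trans (‖‖-homogeneous (ℂ.- 1ᶜ) x (0≤1 ,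
        solve 0 (con (1 , 0) :* con (1 , 0) := (:- con (1 , 0)) :* (:- con (1 , 0)) :+ (:- con (0 , 0)) :* (:- con (0 , 0))) refl))
        (*-identityˡ _))

    ‖*ₗ‖ : ∀ z x → ‖ z *ₗ x ‖ ≤ ∣ z ∣₁ * ‖ x ‖
    ‖*ₗ‖ (a , b) x = ≤-resp
      (‖‖-cong (≈ᴹ-trans (≈ᴹ-sym (*ₗ-distribʳ x (a , 0#) (0# , b)))
        (*ₗ-cong (+-identityʳ a , +-identityˡ b) ≈ᴹ-refl)))
      (sym (distribʳ ‖ x ‖ ∣ a ∣ ∣ b ∣))
      (≤-≈-trans (‖‖-triangle ((a , 0#) *ₗ x) ((0# , b) *ₗ x))
        (+-cong (‖‖-homogeneous _ x (isModulus-re a)) (‖‖-homogeneous _ x (isModulus-im b))))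

    -- The C*-identity and submultiplicativity give ‖x‖² ≤ ‖x⋆‖ ‖x‖, hence ‖x‖ ≤ ‖x⋆‖; the converse
    -- is the same inequality for x⋆.
    ‖⋆‖ : ∀ x → ‖ x ⋆ ‖ ≈ ‖ x ‖
    ‖⋆‖ x = ≤-antisym (≤-≈-trans (‖⋆‖≥ (x ⋆)) (‖‖-cong (⋆-involutive x))) (‖⋆‖≥ x)
      where
      ‖⋆‖≥ : ∀ x → ‖ x ‖ ≤ ‖ x ⋆ ‖
      ‖⋆‖≥ x = ≮⇒≥ λ p → <⇒≱
        (linear< (*-pos (≤-<-trans (‖‖-nonneg (x ⋆)) p) (<⇒0<- p))
          (solve 2 (λ x s → x :* x :+ con (0 , 0) := s :* x :+ x :* (x :- s)) refl ‖ x ‖ ‖ x ⋆ ‖))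
        (≈-≤-trans (sym (C*-identity x)) (‖‖-submult (x ⋆) x))

    -- By the C*-identity ‖1‖² = ‖1⋆ · 1‖ = ‖1⋆‖ = ‖1‖. Equality with 1 would fail in the zero
    -- algebra.
    ‖one‖≤1 : ∀ u → ‖ one u ‖ ≤ 1#
    ‖one‖≤1 u = square-injective (‖‖-nonneg (one u)) 0≤1 (≮⇒≥ λ 1<nn → <⇒≱ (too-large 1<nn)
      (≈-≤-trans (sym (C*-identity (one u)))
        (≈-≤-trans (‖‖-cong (one-identityʳ u (one u ⋆))) (≤-reflexive (‖⋆‖ (one u))))))
      where
      n = ‖ one u ‖
      too-large : 1# * 1# < n * n → n < n * n
      too-large p = cases (≤⊎> n 1#)
        (λ q → ≤-<-trans q (≈-<-trans (sym (*-identityˡ 1#)) p))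
        (λ q → linear< (*-pos (<-trans 0<1 q) (<⇒0<- q))
          (solve 1 (λ n → n :* n :+ con (0 , 0) := n :+ n :* (n :- con (1 , 0))) refl n))

    d-cong : ∀ {x x′ y y′} → x ≈ᴹ x′ → y ≈ᴹ y′ → d x y ≈ d x′ y′
    d-cong p q = ‖‖-cong (p ×- q)

    0≤d : ∀ x y → 0# ≤ d x y
    0≤d x y = ‖‖-nonneg (x -ᴹ y)

    ≈ᴹ⇒d≈0 : ∀ {x y} → x ≈ᴹ y → d x y ≈ 0#
    ≈ᴹ⇒d≈0 {x} {y} p = trans (‖‖-cong (≈ᴹ-trans (p ×- ≈ᴹ-refl) (-ᴹ‿inverseʳ y))) ‖0‖≈0

    d≈0⇒≈ᴹ : ∀ {x y} → d x y ≈ 0# → x ≈ᴹ y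
    d≈0⇒≈ᴹ {x} {y} p = G.x∙y⁻¹≈ε⇒x≈y x y (‖‖-definite (x -ᴹ y) p)

    d≤0⇒≈ᴹ : ∀ {x y} → d x y ≤ 0# → x ≈ᴹ y
    d≤0⇒≈ᴹ {x} {y} p = d≈0⇒≈ᴹ (≤-antisym p (0≤d x y))

    d-sym : ∀ x y → d x y ≈ d y x
    d-sym x y = trans (sym (‖-‖ (x -ᴹ y))) (‖‖-cong (G.⁻¹-anti-homo‿- x y))

    d-triangle : ∀ x y z → d x z ≤ d x y + d y z
    d-triangle x y z = ≈-≤-trans (‖‖-cong (telescope x y z)) (‖‖-triangle _ _)

    d-0ʳ : ∀ x → d x 0ᴹ ≈ ‖ x ‖
    d-0ʳ x = ‖‖-cong (≈ᴹ-trans (+ᴹ-cong ≈ᴹ-refl G.ε⁻¹≈ε) (+ᴹ-identityʳ x))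

    ‖‖≤‖‖+d : ∀ x y → ‖ x ‖ ≤ ‖ y ‖ + d x y
    ‖‖≤‖‖+d x y = ≤-resp (d-0ʳ x) (trans (+-comm _ _) (+-congʳ (d-0ʳ y))) (d-triangle x y 0ᴹ)

    ∣‖‖-‖‖∣≤d : ∀ x y → ∣ ‖ x ‖ - ‖ y ‖ ∣ ≤ d x y
    ∣‖‖-‖‖∣≤d x y = ∣-∣≤ (‖‖≤‖‖+d x y) (≤-trans (‖‖≤‖‖+d y x) (≤-refl ⊕ ≤-reflexive (d-sym y x)))

    d-+ᴹ : ∀ x x′ y y′ → d (x +ᴹ x′) (y +ᴹ y′) ≤ d x y + d x′ y′
    d-+ᴹ x x′ y y′ = ≈-≤-trans (‖‖-cong (begin
      (x +ᴹ x′) -ᴹ (y +ᴹ y′)            ≈⟨ +ᴹ-cong ≈ᴹ-refl (G.⁻¹-∙-comm y y′) ⟨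
      (x +ᴹ x′) +ᴹ (-ᴹ y +ᴹ -ᴹ y′)      ≈⟨ S.interchange x x′ (-ᴹ y) (-ᴹ y′) ⟩
      (x -ᴹ y) +ᴹ (x′ -ᴹ y′)            ∎)) (‖‖-triangle _ _)

    d-·ʳ : ∀ x y y′ → d (x · y) (x · y′) ≤ ‖ x ‖ * d y y′
    d-·ʳ x y y′ = ≈-≤-trans (‖‖-cong (≈ᴹ-sym (P.x[y-z]≈xy-xz x y y′))) (‖‖-submult x (y -ᴹ y′))

    d-·ˡ : ∀ x y y′ → d (y · x) (y′ · x) ≤ d y y′ * ‖ x ‖
    d-·ˡ x y y′ = ≈-≤-trans (‖‖-cong (≈ᴹ-sym (P.[y-z]x≈yx-zx x y y′))) (‖‖-submult (y -ᴹ y′) x)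

    d-· : ∀ x x′ y y′ → d (x · x′) (y · y′) ≤ ‖ x ‖ * d x′ y′ + d x y * ‖ y′ ‖
    d-· x x′ y y′ = ≤-trans (d-triangle (x · x′) (x · y′) (y · y′)) (d-·ʳ x x′ y′ ⊕ d-·ˡ y′ x y)

    d-⋆ : ∀ x y → d (x ⋆) (y ⋆) ≈ d x y
    d-⋆ x y = trans (‖‖-cong (≈ᴹ-sym (≈ᴹ-trans (⋆-homo-+ᴹ x (-ᴹ y)) (+ᴹ-cong ≈ᴹ-refl
      (G.inverseˡ-unique ((-ᴹ y) ⋆) (y ⋆) (≈ᴹ-trans (≈ᴹ-sym (⋆-homo-+ᴹ (-ᴹ y) y))
        (≈ᴹ-trans (⋆-cong (-ᴹ‿inverseˡ y)) 0⋆≈0))))))) (‖⋆‖ (x -ᴹ y))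
      where
      0⋆≈0 : 0ᴹ ⋆ ≈ᴹ 0ᴹ
      0⋆≈0 = ‖‖-definite (0ᴹ ⋆) (trans (‖⋆‖ 0ᴹ) ‖0‖≈0)

    d-*ₗ : ∀ z x y → d (z *ₗ x) (z *ₗ y) ≤ ∣ z ∣₁ * d x y
    d-*ₗ z x y = ≈-≤-trans (‖‖-cong (≈ᴹ-sym (≈ᴹ-trans (*ₗ-distribˡ z x (-ᴹ y))
      (+ᴹ-cong ≈ᴹ-refl (G.inverseˡ-unique (z *ₗ (-ᴹ y)) (z *ₗ y) (≈ᴹ-trans (≈ᴹ-sym (*ₗ-distribˡ z (-ᴹ y) y))
        (≈ᴹ-trans (*ₗ-cong ℂ.refl (-ᴹ‿inverseˡ y)) (*ₗ-zeroʳ z))))))))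
      (‖*ₗ‖ z (x -ᴹ y))

    d-*ₗˡ : ∀ z w x → d (z *ₗ x) (w *ₗ x) ≤ ∣ z ℂ.- w ∣₁ * ‖ x ‖
    d-*ₗˡ z w x = ≈-≤-trans (‖‖-cong (≈ᴹ-sym (≈ᴹ-trans (*ₗ-distribʳ x z (ℂ.- w))
      (+ᴹ-cong ≈ᴹ-refl (G.inverseˡ-unique ((ℂ.- w) *ₗ x) (w *ₗ x) (≈ᴹ-trans (≈ᴹ-sym (*ₗ-distribʳ x (ℂ.- w) w))
        (≈ᴹ-trans (*ₗ-cong (ℂ.-‿inverseˡ w) ≈ᴹ-refl) (*ₗ-zeroˡ x)))))))) (‖*ₗ‖ (z ℂ.- w) x)

  -- Terms

  -- Treats two languages at once: no constants for the sentences of theories, and the new constants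
  -- for quantifier-free sentences. `bound` serves the uniform bounds on values, `code` the
  -- countable nets.
  record Signature : Set₁ where
    field
      Constant       : Set
      bound          : Constant → ℕ
      code           : Constant → Tree
      code-injective : ∀ {c c′} → code c ≡ code c′ → c ≡ c′

  record Structure (𝒮 : Signature) : Set₁ where
    open Signature 𝒮
    field
      algebra  : CStarAlgebra
      constant : Constant → Carrier algebra
      bounded  : ∀ c → CStarAlgebra.‖_‖ algebra (constant c) ≤ fromℕ (bound c)

  maximum : ∀ {k} → (Fin k → ℕ) → ℕ
  maximum {zero}  f = 0
  maximum {suc k} f = f fzero ℕ.⊔ maximum (f ∘ fsuc)

  ≤-maximum : ∀ {k} (f : Fin k → ℕ) i → f i ≤ℕ maximum f
  ≤-maximum {suc k} f fzero    = ℕ.m≤m⊔n (f fzero) _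
  ≤-maximum {suc k} f (fsuc i) = ℕ.≤-trans (≤-maximum (f ∘ fsuc) i) (ℕ.m≤n⊔m (f fzero) _)

  zeroBall : ∀ A n → Ball A n
  zeroBall A n = CStarAlgebra.0ᴹ A , ≈-≤-trans (‖0‖≈0 A) (0≤fromℕ n)

  position : ∀ {n : ℕ} {Γ} → n ∈ Γ → ℕ
  position (here _)  = 0
  position (there i) = suc (position i)

  module _ (A : CStarAlgebra) where
    open CStarAlgebra A using (d)

    lookup-position : ∀ {Γ m n} (ρ : Env A Γ) (i : m ∈ Γ) (j : n ∈ Γ) → position i ≡ position j →
                      proj₁ (lookup ρ i) ≡ proj₁ (lookup ρ j)
    lookup-position (x ∷ ρ) (here ≡.refl) (here ≡.refl) p = ≡.refl
    lookup-position (x ∷ ρ) (there i) (there j) p = lookup-position ρ i j (ℕ.suc-injective p)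

    0≤dᴱ : ∀ {Γ} (ρ τ : Env A Γ) → 0# ≤ dᴱ A ρ τ
    0≤dᴱ [] [] = ≤-refl
    0≤dᴱ ((x , _) ∷ ρ) ((y , _) ∷ τ) = ≤-trans (0≤dᴱ ρ τ) ≤-max₂

    d-lookup : ∀ {Γ n} (ρ τ : Env A Γ) (i : n ∈ Γ) → d (proj₁ (lookup ρ i)) (proj₁ (lookup τ i)) ≤ dᴱ A ρ τ
    d-lookup (_ ∷ _) (_ ∷ _) (here ≡.refl) = ≤-max₁
    d-lookup ((_ , _) ∷ ρ) ((_ , _) ∷ τ) (there i) = ≤-trans (d-lookup ρ τ i) ≤-max₂

  module _ {𝒮 : Signature} where
    open Signature 𝒮

    private
      C : Set
      C = Constant

    ⟦_⟧ˢ : ∀ {Γ} → Term C Γ → (S : Structure 𝒮) → Env (Structure.algebra S) Γ → Carrier (Structure.algebra S)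
    ⟦ t ⟧ˢ S = ⟦_⟧ (Structure.algebra S) (Structure.constant S) t

    scalarBound : CommutativeRing.Carrier complexRing → ℕ
    scalarBound z = proj₁ (archimedean ∣ z ∣₁)

    ∣∣₁≤scalarBound : ∀ z → ∣ z ∣₁ ≤ fromℕ (scalarBound z)
    ∣∣₁≤scalarBound z = <⇒≤ (proj₂ (archimedean ∣ z ∣₁))

    -- Depends on the syntax only and bounds the norm in every structure; likewise `lipschitz`. All
    -- precisions in codes rest on this uniformity.
    termBound : ∀ {Γ} → Term C Γ → ℕ
    termBound (var {n} i) = n
    termBound (con c)     = bound c
    termBound zeroₜ       = 0
    termBound (oneₜ u)    = 1
    termBound (t +ₜ u)    = termBound t ℕ.+ termBound u
    termBound (t ·ₜ u)    = termBound t ℕ.* termBound u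
    termBound (t ⋆ₜ)      = termBound t
    termBound (z *ₜ t)    = scalarBound z ℕ.* termBound t

    lipschitz : ∀ {Γ} → Term C Γ → ℕ
    lipschitz (var i)  = 1
    lipschitz (con c)  = 0
    lipschitz zeroₜ    = 0
    lipschitz (oneₜ u) = 0
    lipschitz (t +ₜ u) = lipschitz t ℕ.+ lipschitz u
    lipschitz (t ·ₜ u) = termBound t ℕ.* lipschitz u ℕ.+ lipschitz t ℕ.* termBound u
    lipschitz (t ⋆ₜ)   = lipschitz t
    lipschitz (z *ₜ t) = scalarBound z ℕ.* lipschitz t

    -- TermCode n t c: at precision ι n the term t is coded by c.  Being a relation,
    -- it lets two terms with the same code be decomposed by a single match.
    data TermCode (n : ℕ) {Γ} : Term C Γ → Tree → Set where
      var   : ∀ {m} {i : m ∈ Γ} {k} → position i ≡ k → TermCode n (var i) (node (leaf 0) (leaf k))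
      con   : ∀ {c t} → code c ≡ t → TermCode n (con c) (node (leaf 1) t)
      zeroₜ : TermCode n zeroₜ (leaf 0)
      oneₜ  : ∀ {u} → TermCode n (oneₜ u) (leaf 1)
      sum   : ∀ {t u c c′} → TermCode (proj₁ (divide₂ n)) t c → TermCode (proj₁ (divide₂ n)) u c′ →
              TermCode n (t +ₜ u) (node (leaf 2) (node c c′))
      -- The bounds are recorded in the code, so that two terms with equal codes have factors coded
      -- at the same precision; the error of a product is at most b + b′ times that of its factors.
      prod  : ∀ {t u c c′ b b′} → termBound t ≡ b → termBound u ≡ b′ →
              TermCode (proj₁ (divide (b ℕ.+ b′) n)) t c → TermCode (proj₁ (divide (b ℕ.+ b′) n)) u c′ →
              TermCode n (t ·ₜ u) (node (leaf 3) (node (node (leaf b) (leaf b′)) (node c c′)))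
      star  : ∀ {t c} → TermCode n t c → TermCode n (t ⋆ₜ) (node (leaf 4) c)
      -- The error of the scalar counts b′ once for the real and once for the imaginary part, the
      -- error of the term counts b.
      scal  : ∀ {z t b b′ c c′ c″} → scalarBound z ≡ b → termBound t ≡ b′ →
              realCode (proj₁ (divide (b ℕ.+ (b′ ℕ.+ b′)) n)) (re z) ≡ c →
              realCode (proj₁ (divide (b ℕ.+ (b′ ℕ.+ b′)) n)) (im z) ≡ c′ →
              TermCode (proj₁ (divide (b ℕ.+ (b′ ℕ.+ b′)) n)) t c″ →
              TermCode n (z *ₜ t) (node (leaf 5) (node (node (leaf b) (leaf b′)) (node (node c c′) c″)))

    termCode : ∀ n {Γ} (t : Term C Γ) → ∃[ c ] TermCode n t c
    termCode n (var i)  = _ , var ≡.refl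
    termCode n (con c)  = _ , con ≡.refl
    termCode n zeroₜ    = _ , zeroₜ
    termCode n (oneₜ u) = _ , oneₜ
    termCode n (t +ₜ u) = _ , sum (proj₂ (termCode _ t)) (proj₂ (termCode _ u))
    termCode n (t ·ₜ u) = _ , prod ≡.refl ≡.refl (proj₂ (termCode _ t)) (proj₂ (termCode _ u))
    termCode n (t ⋆ₜ)   = _ , star (proj₂ (termCode n t))
    termCode n (z *ₜ t) = _ , scal ≡.refl ≡.refl ≡.refl ≡.refl (proj₂ (termCode _ t))

    module _ (S : Structure 𝒮) where
      open Structure S renaming (algebra to A)
      open CStarAlgebra A hiding (Carrier; Ball)

      termBound-correct : ∀ {Γ} (t : Term C Γ) ρ → ‖ ⟦ t ⟧ˢ S ρ ‖ ≤ fromℕ (termBound t)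
      termBound-correct (var i)  ρ = proj₂ (lookup ρ i)
      termBound-correct (con c)  ρ = bounded c
      termBound-correct zeroₜ    ρ = ≤-reflexive (‖0‖≈0 A)
      termBound-correct (oneₜ u) ρ = ≤-trans (‖one‖≤1 A u) (x≤x+y ≤-refl)
      termBound-correct (t +ₜ u) ρ = ≤-trans (‖‖-triangle _ _)
        (≤-≈-trans (termBound-correct t ρ ⊕ termBound-correct u ρ) (sym (fromℕ-+ (termBound t) (termBound u))))
      termBound-correct (t ·ₜ u) ρ = ≤-trans (‖‖-submult _ _)
        (≤-≈-trans (*-mono (‖‖-nonneg _) (0≤fromℕ (termBound u)) (termBound-correct t ρ) (termBound-correct u ρ))
          (sym (fromℕ-* (termBound t) (termBound u))))
      termBound-correct (t ⋆ₜ)   ρ = ≈-≤-trans (‖⋆‖ A _) (termBound-correct t ρ)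
      termBound-correct (z *ₜ t) ρ = ≤-trans (‖*ₗ‖ A z _)
        (≤-≈-trans (*-mono (0≤∣∣₁ z) (0≤fromℕ (termBound t)) (∣∣₁≤scalarBound z) (termBound-correct t ρ))
          (sym (fromℕ-* (scalarBound z) (termBound t))))

      lipschitz-correct : ∀ {Γ} (t : Term C Γ) ρ τ → d (⟦ t ⟧ˢ S ρ) (⟦ t ⟧ˢ S τ) ≤ fromℕ (lipschitz t) * dᴱ A ρ τ
      lipschitz-correct (var i)  ρ τ = ≤-≈-trans (d-lookup A ρ τ i)
        (solve 1 (λ x → x := (con (1 , 0) :+ con (0 , 0)) :* x) refl (dᴱ A ρ τ))
      lipschitz-correct (con c)  ρ τ = ≤-reflexive (trans (≈ᴹ⇒d≈0 A (≈ᴹ-refl A)) (sym (zeroˡ _)))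
      lipschitz-correct zeroₜ    ρ τ = ≤-reflexive (trans (≈ᴹ⇒d≈0 A (≈ᴹ-refl A)) (sym (zeroˡ _)))
      lipschitz-correct (oneₜ u) ρ τ = ≤-reflexive (trans (≈ᴹ⇒d≈0 A (≈ᴹ-refl A)) (sym (zeroˡ _)))
      lipschitz-correct (t +ₜ u) ρ τ = ≤-trans (d-+ᴹ A _ _ _ _)
        (≤-≈-trans (lipschitz-correct t ρ τ ⊕ lipschitz-correct u ρ τ)
          (trans (sym (distribʳ (dᴱ A ρ τ) _ _)) (*-congʳ (sym (fromℕ-+ (lipschitz t) (lipschitz u))))))
      lipschitz-correct (t ·ₜ u) ρ τ = ≤-trans (d-· A _ _ _ _) (≤-≈-trans
        (*-mono (‖‖-nonneg _) (*-nonneg (0≤fromℕ (lipschitz u)) (0≤dᴱ A ρ τ)) (termBound-correct t ρ) (lipschitz-correct u ρ τ)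
         ⊕ *-mono (0≤d A _ _) (0≤fromℕ (termBound u)) (lipschitz-correct t ρ τ) (termBound-correct u τ))
        (trans
          (solve 5 (λ a l k b x → a :* (l :* x) :+ (k :* x) :* b := (a :* l :+ k :* b) :* x) refl
            (fromℕ (termBound t)) (fromℕ (lipschitz u)) (fromℕ (lipschitz t)) (fromℕ (termBound u)) (dᴱ A ρ τ))
          (*-congʳ (trans (+-cong (sym (fromℕ-* (termBound t) (lipschitz u))) (sym (fromℕ-* (lipschitz t) (termBound u))))
            (sym (fromℕ-+ (termBound t ℕ.* lipschitz u) (lipschitz t ℕ.* termBound u)))))))
      lipschitz-correct (t ⋆ₜ)   ρ τ = ≈-≤-trans (d-⋆ A _ _) (lipschitz-correct t ρ τ)
      lipschitz-correct (z *ₜ t) ρ τ = ≤-trans (d-*ₗ A z _ _) (≤-≈-trans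
        (*-mono (0≤∣∣₁ z) (*-nonneg (0≤fromℕ (lipschitz t)) (0≤dᴱ A ρ τ)) (∣∣₁≤scalarBound z) (lipschitz-correct t ρ τ))
        (trans (sym (*-assoc _ _ _)) (*-congʳ (sym (fromℕ-* (scalarBound z) (lipschitz t))))))

      TermClose : ℕ → ∀ {Γ} → Term C Γ → Term C Γ → Set
      TermClose n t u = ∀ ρ → d (⟦ t ⟧ˢ S ρ) (⟦ u ⟧ˢ S ρ) ≤ ι n

      termCode-close : ∀ {n Γ} {t u : Term C Γ} {c} → TermCode n t c → TermCode n u c → TermClose n t u
      termCode-close {n} (var {i = i} p) (var {i = j} q) ρ = ≈-≤-trans (≈ᴹ⇒d≈0 A
        (≈ᴹ-reflexive A (lookup-position A ρ i j (≡.trans p (≡.sym q))))) (<⇒≤ (0<ι n))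
      termCode-close {n} (con p) (con q) ρ = ≈-≤-trans (≈ᴹ⇒d≈0 A
        (≈ᴹ-reflexive A (≡.cong constant (code-injective (≡.trans p (≡.sym q)))))) (<⇒≤ (0<ι n))
      termCode-close {n} zeroₜ zeroₜ ρ = ≈-≤-trans (≈ᴹ⇒d≈0 A (≈ᴹ-refl A)) (<⇒≤ (0<ι n))
      termCode-close {n} (oneₜ {u}) (oneₜ {v}) ρ = ≈-≤-trans (≈ᴹ⇒d≈0 A
        (≈ᴹ-reflexive A (≡.cong one (T-irrelevant {unital} u v)))) (<⇒≤ (0<ι n))
      termCode-close {n} (sum p q) (sum p′ q′) ρ = ≤-trans (d-+ᴹ A _ _ _ _)
        (≤-trans (termCode-close p p′ ρ ⊕ termCode-close q q′ ρ) (proj₂ (divide₂ n)))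
      termCode-close {n} (prod {t} {u} {b = b} {b′} ≡.refl ≡.refl p q) (prod {t′} {u′} e e′ p′ q′) ρ =
        ≤-trans (d-· A _ _ _ _) (≤-trans
          (*-mono (‖‖-nonneg _) (<⇒≤ (0<ι _)) (termBound-correct t ρ) (termCode-close q q′ ρ)
           ⊕ *-mono (0≤d A _ _) (0≤fromℕ b′) (termCode-close p p′ ρ)
               (≤-≈-trans (termBound-correct u′ ρ) (reflexive (≡.cong fromℕ e′))))
          (≈-≤-trans (trans
            (solve 3 (λ a b i → a :* i :+ i :* b := (a :+ b) :* i) refl (fromℕ b) (fromℕ b′) (ι (proj₁ (divide (b ℕ.+ b′) n))))
            (*-congʳ (sym (fromℕ-+ b b′))))
            (proj₂ (divide (b ℕ.+ b′) n))))
      termCode-close {n} (star p) (star p′) ρ = ≈-≤-trans (d-⋆ A _ _) (termCode-close p p′ ρ)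
      termCode-close {n} (scal {z} {t} {b} {b′} e ≡.refl ≡.refl ≡.refl p) (scal {w} {t′} ≡.refl e′ f f′ p′) ρ =
        ≤-trans (d-triangle A _ _ _) (≤-trans (d-*ₗˡ A z w _ ⊕ d-*ₗ A w _ _) (≤-trans
          (*-mono (0≤∣∣₁ _) (0≤fromℕ b′)
             (realCode-close m (≡.sym f) ⊕ realCode-close m (≡.sym f′)) (termBound-correct t ρ)
           ⊕ *-mono (0≤∣∣₁ w) (<⇒≤ (0<ι m)) (∣∣₁≤scalarBound w) (termCode-close p p′ ρ))
          (≈-≤-trans (trans
            (solve 3 (λ b b′ i → (i :+ i) :* b′ :+ b :* i := (b :+ (b′ :+ b′)) :* i) refl (fromℕ b) (fromℕ b′) (ι m))
            (*-congʳ (trans (+-congˡ (sym (fromℕ-+ b′ b′))) (sym (fromℕ-+ b (b′ ℕ.+ b′))))))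
            (proj₂ (divide (b ℕ.+ (b′ ℕ.+ b′)) n)))))
        where
        m : ℕ
        m = proj₁ (divide (b ℕ.+ (b′ ℕ.+ b′)) n)

  -- Values of formulas

  isSupremum-resp : ∀ {p} {_≲_ : ℝ → ℝ → Set} {S : Pred ℝ p} {r s} →
    (∀ {x} → x ≲ r → x ≲ s) → (∀ {x} → r ≲ x → s ≲ x) → IsSupremum _≲_ S r → IsSupremum _≲_ S s
  isSupremum-resp f g (upper , least) = (λ Sx → f (upper Sx)) , λ ub → g (least ub)

  inf-resp : ∀ {i} {I : Set i} {f g : I → ℝ} {m n} → (∀ i → f i ≈ g i) → m ≈ n → IsInf f m → IsInf g n
  inf-resp f≈g m≈n (lower , approx) = (λ i → ≤-resp m≈n (f≈g i) (lower i)) , λ ε p →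
    let (i , q) = approx ε p in
    i , ≈-<-trans (sym (f≈g i)) (<-≈-trans q (+-congʳ m≈n))

  inf-close : ∀ {i} {I : Set i} {f g : I → ℝ} {m n ε} → IsInf f m → IsInf g n →
              (∀ i → ∣ f i - g i ∣ ≤ ε) → ∣ m - n ∣ ≤ ε
  inf-close {f = f} {g} p q h = ∣-∣≤
    (inf-mono q p λ i δ 0<δ → i , ≤-trans (∣-∣≤⇒≤+ (h i)) (x≤x+y (<⇒≤ 0<δ)))
    (inf-mono p q λ i δ 0<δ → i , ≤-trans (∣-∣≤⇒≤+ (∣∣-swap≤ (h i))) (x≤x+y (<⇒≤ 0<δ)))

  ∣neg-neg∣ : ∀ x y → ∣ - x - - y ∣ ≈ ∣ x - y ∣
  ∣neg-neg∣ x y = trans (∣∣-cong (solve 2 (λ x y → :- x :- :- y := y :- x) refl x y)) (∣∣-sym y x)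

  inf⇒isInfimum : ∀ {I : Set} {S : Pred ℝ 0ℓ} {f : I → ℝ} {m} → (∀ i → S (f i)) →
                  (∀ v → S v → ∃[ i ] v ≈ f i) → IsInf f m → IsInfimum S m
  inf⇒isInfimum {f = f} Sf S⇒ (lower , approx) = isInfimum
    (λ v Sv → let (i , v≈fi) = S⇒ v Sv in ≤-≈-trans (lower i) (sym v≈fi))
    (λ ε p → let (i , q) = approx ε p in f i , Sf i , q)

  inf⇒isSupremum : ∀ {I : Set} {S : Pred ℝ 0ℓ} {f : I → ℝ} {m} → (∀ i → S (f i)) →
                   (∀ v → S v → ∃[ i ] v ≈ f i) → IsInf (λ i → - f i) m → IsSupremum _≤_ S (- m)
  inf⇒isSupremum {f = f} {m} Sf S⇒ (lower , approx) =
    (λ {v} Sv → let (i , v≈fi) = S⇒ v Sv in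
      linear (lower i) (trans (solve 2 (λ m f → :- m :+ m := f :+ :- f) refl m (f i)) (+-congʳ (sym v≈fi)))) ,
    λ {u} ub → ≤-approx λ ε p → let (i , q) = approx ε p in
      linear (ub (Sf i) ⊕ <⇒≤ q)
        (solve 4 (λ u f m e → (u :+ e) :+ (f :+ :- f) := :- m :+ (u :+ (m :+ e))) refl u (f i) m ε)

  cons-close : ∀ A {n Γ m} (x : Ball A n) (ρ τ : Env A Γ) → dᴱ A ρ τ ≤ ι m → dᴱ A {n ∷ Γ} (x ∷ ρ) (x ∷ τ) ≤ ι m
  cons-close A {m = m} x ρ τ p = max-lub (≈-≤-trans (≈ᴹ⇒d≈0 A (≈ᴹ-refl A {proj₁ x})) (<⇒≤ (0<ι m))) p

  dist-close : ∀ A (x y x′ y′ : Carrier A) → let open CStarAlgebra A using (d) in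
               ∣ d x y - d x′ y′ ∣ ≤ d x x′ + d y y′
  dist-close A x y x′ y′ = let open CStarAlgebra A using (d) in ∣-∣≤
    (≤-trans (d-triangle A x x′ y) (≤-trans (≤-refl ⊕ d-triangle A x′ y′ y)
      (≤-≈-trans (≤-refl ⊕ (≤-refl ⊕ ≤-reflexive (d-sym A y′ y)))
        (solve 3 (λ a b c → a :+ (b :+ c) := b :+ (a :+ c)) refl (d x x′) (d x′ y′) (d y y′)))))
    (≤-trans (d-triangle A x′ x y′) (≤-≈-trans (≤-reflexive (d-sym A x′ x) ⊕ d-triangle A x y y′)
      (solve 3 (λ a b c → a :+ (b :+ c) := b :+ (a :+ c)) refl (d x x′) (d x y) (d y y′))))

  module _ {𝒮 : Signature} where
    open Signature 𝒮

    private
      C : Set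
      C = Constant

    formulaBound : ∀ {Γ} → Formula C Γ → ℕ
    formulaBound (dist t u)  = termBound {𝒮} t ℕ.+ termBound {𝒮} u
    formulaBound (conn f φs) = proj₁ (bounded-on-box (continuous f) (fromℕ (maximum λ i → formulaBound (φs i))))
    formulaBound (⨆ n φ)     = formulaBound φ
    formulaBound (⨅ n φ)     = formulaBound φ

    inBox : ∀ {k Γ} (φs : Fin k → Formula C Γ) {v : Vector ℝ k} →
            (∀ i → ∣ v i ∣ ≤ fromℕ (formulaBound (φs i))) → InBox (fromℕ (maximum λ i → formulaBound (φs i))) v
    inBox φs h i = ≤-trans (h i) (fromℕ-mono (≤-maximum (λ i → formulaBound (φs i)) i))

    module _ (S : Structure 𝒮) where
      open Structure S renaming (algebra to A)
      open CStarAlgebra A hiding (Carrier; Ball)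

      HasValueˢ : ∀ {Γ} → Formula C Γ → Env A Γ → ℝ → Set
      HasValueˢ = HasValue A constant

      hasValue-resp : ∀ {Γ} (φ : Formula C Γ) {ρ r s} → r ≈ s → HasValueˢ φ ρ r → HasValueˢ φ ρ s
      hasValue-resp (dist t u)  r≈s p = trans (sym r≈s) p
      hasValue-resp (conn f φs) r≈s (v , h , p) = v , h , trans (sym r≈s) p
      hasValue-resp (⨆ n φ) r≈s p = isSupremum-resp (λ q → ≤-resp refl r≈s q) (λ q → ≤-resp r≈s refl q) p
      hasValue-resp (⨅ n φ) r≈s p = isSupremum-resp (λ q → ≤-resp r≈s refl q) (λ q → ≤-resp refl r≈s q) p

      hasValue-unique : ∀ {Γ} (φ : Formula C Γ) {ρ r s} → HasValueˢ φ ρ r → HasValueˢ φ ρ s → r ≈ s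
      hasValue-unique (dist t u)  p q = trans p (sym q)
      hasValue-unique (conn f φs) (v , h , p) (v′ , h′ , p′) = trans p
        (trans (continuous-cong (continuous f) λ i → hasValue-unique (φs i) (h i) (h′ i)) (sym p′))
      hasValue-unique (⨆ n φ) (ub , lub) (ub′ , lub′) = ≤-antisym (lub ub′) (lub′ ub)
      hasValue-unique (⨅ n φ) (lb , glb) (lb′ , glb′) = ≤-antisym (glb′ lb) (glb lb′)

      private
        neg-bound : ∀ {x N} → ∣ x ∣ ≤ N → - N ≤ x
        neg-bound {x} {N} p = linear (≤-trans (-x≤∣x∣ x) p) (solve 2 (λ x n → x :+ :- x := :- n :+ n) refl x N)

        inf-bound : ∀ {I : Set} {f : I → ℝ} {m N} → I → (∀ i → ∣ f i ∣ ≤ N) → IsInf f m → ∣ m ∣ ≤ N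
        inf-bound {f = f} {m} {N} i₀ h (lower , approx) = ∣∣-lub
          (≤-trans (lower i₀) (≤-trans (x≤∣x∣ _) (h i₀)))
          (≤-approx λ ε p → let (i , q) = approx ε p in
            linear (≤-trans (-x≤∣x∣ (f i)) (h i) ⊕ <⇒≤ q)
              (solve 4 (λ n e f m → (n :+ e) :+ (:- f :+ f) := :- m :+ (n :+ (m :+ e))) refl N ε (f i) m))

      -- Value and bound are computed together, since the infimum for a quantifier exists only
      -- because the values under it are bounded uniformly over the ball.
      eval : ∀ {Γ} (φ : Formula C Γ) ρ → Σ[ r ∈ ℝ ] HasValueˢ φ ρ r × ∣ r ∣ ≤ fromℕ (formulaBound φ)
      infOver : ∀ {Γ n} (φ : Formula C (n ∷ Γ)) ρ → ∃ (IsInf λ (x : Ball A n) → proj₁ (eval φ (x ∷ ρ)))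
      -- Suprema are negated infima of negated values, so that the arguments for infima serve both
      -- quantifiers.
      supOver : ∀ {Γ n} (φ : Formula C (n ∷ Γ)) ρ → ∃ (IsInf λ (x : Ball A n) → - proj₁ (eval φ (x ∷ ρ)))

      eval (dist t u) ρ = d (⟦ t ⟧ˢ S ρ) (⟦ u ⟧ˢ S ρ) , refl ,
        ≈-≤-trans (∣∣-nonneg (0≤d A _ _)) (≤-trans (‖‖-triangle _ _)
          (≤-≈-trans (termBound-correct S t ρ ⊕ ≈-≤-trans (‖-‖ A _) (termBound-correct S u ρ))
            (sym (fromℕ-+ (termBound {𝒮} t) (termBound {𝒮} u)))))
      eval (conn f φs) ρ = apply f (λ i → proj₁ (eval (φs i) ρ)) ,
        ((λ i → proj₁ (eval (φs i) ρ)) , (λ i → proj₁ (proj₂ (eval (φs i) ρ))) , refl) ,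
        proj₂ (bounded-on-box (continuous f) (fromℕ (maximum λ i → formulaBound (φs i)))) _
          (inBox φs (λ i → proj₂ (proj₂ (eval (φs i) ρ))))
      eval (⨆ n φ) ρ = - proj₁ (supOver φ ρ) ,
        inf⇒isSupremum (λ x → x , proj₁ (proj₂ (eval φ (x ∷ ρ))))
          (λ v (x , p) → x , hasValue-unique φ p (proj₁ (proj₂ (eval φ (x ∷ ρ))))) (proj₂ (supOver φ ρ)) ,
        ≈-≤-trans (∣∣-neg _)
          (inf-bound (zeroBall A n) (λ x → ≈-≤-trans (∣∣-neg _) (proj₂ (proj₂ (eval φ (x ∷ ρ)))))
            (proj₂ (supOver φ ρ)))
      eval (⨅ n φ) ρ = proj₁ (infOver φ ρ) ,
        inf⇒isInfimum (λ x → x , proj₁ (proj₂ (eval φ (x ∷ ρ))))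
          (λ v (x , p) → x , hasValue-unique φ p (proj₁ (proj₂ (eval φ (x ∷ ρ))))) (proj₂ (infOver φ ρ)) ,
        inf-bound (zeroBall A n) (λ x → proj₂ (proj₂ (eval φ (x ∷ ρ)))) (proj₂ (infOver φ ρ))

      infOver {n = n} φ ρ = infimum-exists (λ x → proj₁ (eval φ (x ∷ ρ))) (zeroBall A n)
        (- fromℕ (formulaBound φ)) λ x → neg-bound (proj₂ (proj₂ (eval φ (x ∷ ρ))))
      supOver {n = n} φ ρ = infimum-exists (λ x → - proj₁ (eval φ (x ∷ ρ))) (zeroBall A n)
        (- fromℕ (formulaBound φ)) λ x → -‿anti-≤ (≤-trans (x≤∣x∣ _) (proj₂ (proj₂ (eval φ (x ∷ ρ)))))

      abstract
        val : ∀ {Γ} → Formula C Γ → Env A Γ → ℝ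
        val φ ρ = proj₁ (eval φ ρ)

        hasValue-val : ∀ {Γ} (φ : Formula C Γ) ρ → HasValueˢ φ ρ (val φ ρ)
        hasValue-val φ ρ = proj₁ (proj₂ (eval φ ρ))

        val-bound : ∀ {Γ} (φ : Formula C Γ) ρ → ∣ val φ ρ ∣ ≤ fromℕ (formulaBound φ)
        val-bound φ ρ = proj₂ (proj₂ (eval φ ρ))

        val-⨅ : ∀ {Γ n} (φ : Formula C (n ∷ Γ)) ρ → IsInf (λ (x : Ball A n) → val φ (x ∷ ρ)) (val (⨅ n φ) ρ)
        val-⨅ φ ρ = proj₂ (infOver φ ρ)

        val-⨆ : ∀ {Γ n} (φ : Formula C (n ∷ Γ)) ρ → IsInf (λ (x : Ball A n) → - val φ (x ∷ ρ)) (- val (⨆ n φ) ρ)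
        val-⨆ φ ρ = inf-resp (λ _ → refl) (solve 1 (λ x → x := :- :- x) refl _) (proj₂ (supOver φ ρ))

        val-dist : ∀ {Γ} (t u : Term C Γ) ρ → val (dist t u) ρ ≈ d (⟦ t ⟧ˢ S ρ) (⟦ u ⟧ˢ S ρ)
        val-dist t u ρ = refl

        val-conn : ∀ {Γ k} f (φs : Fin k → Formula C Γ) ρ → val (conn f φs) ρ ≈ apply f (λ i → val (φs i) ρ)
        val-conn f φs ρ = refl

      hasValue⇒val : ∀ {Γ} (φ : Formula C Γ) {ρ r} → HasValueˢ φ ρ r → r ≈ val φ ρ
      hasValue⇒val φ p = hasValue-unique φ p (hasValue-val φ _)

      val⇒hasValue : ∀ {Γ} (φ : Formula C Γ) {ρ r} → r ≈ val φ ρ → HasValueˢ φ ρ r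
      val⇒hasValue φ p = hasValue-resp φ (sym p) (hasValue-val φ _)

    abstract
      -- The modulus is found before the structure is given: Lipschitz constants for terms, uniform
      -- continuity on the box of possible arguments for connectives, and the same modulus under a
      -- quantifier, as infima of uniformly close functions are close.
      formula-uniform : ∀ {Γ} (φ : Formula C Γ) n → ∃[ m ] ∀ (S : Structure 𝒮) ρ τ →
        dᴱ (Structure.algebra S) ρ τ ≤ ι m → ∣ val S φ ρ - val S φ τ ∣ ≤ ι n
      formula-uniform (dist t u) n =
        let L = lipschitz {𝒮} t ℕ.+ lipschitz {𝒮} u
            (m , h) = divide L n
        in m , λ S ρ τ p → let A = Structure.algebra S in
          ≈-≤-trans (∣∣-cong (+-cong (val-dist S t u ρ) (-‿cong (val-dist S t u τ))))
          (≤-trans (dist-close A _ _ _ _)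
          (≤-trans (lipschitz-correct S t ρ τ ⊕ lipschitz-correct S u ρ τ)
          (≈-≤-trans (trans (sym (distribʳ (dᴱ A ρ τ) _ _))
              (*-congʳ (sym (fromℕ-+ (lipschitz {𝒮} t) (lipschitz {𝒮} u)))))
          (≤-trans (*-monoʳ (0≤fromℕ L) p) h))))
      formula-uniform (conn f φs) n =
        let (N , h) = uniform-on-box (continuous f) (fromℕ (maximum λ i → formulaBound (φs i))) (ι n) (0<ι n)
            IH = λ i → formula-uniform (φs i) N
        in maximum (λ i → proj₁ (IH i)) , λ S ρ τ p →
          ≈-≤-trans (∣∣-cong (+-cong (val-conn S f φs ρ) (-‿cong (val-conn S f φs τ))))
            (<⇒≤ (h _ (inBox φs λ i → val-bound S (φs i) ρ) _ λ i →
              proj₂ (IH i) S ρ τ (≤-trans p (ι-anti (≤-maximum (λ i → proj₁ (IH i)) i)))))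
      formula-uniform (⨆ k φ) n =
        let (m , h) = formula-uniform φ n in m , λ S ρ τ p →
          ≤-resp (∣neg-neg∣ _ _) refl (inf-close (val-⨆ S φ ρ) (val-⨆ S φ τ) λ x →
            ≈-≤-trans (∣neg-neg∣ _ _) (h S (x ∷ ρ) (x ∷ τ) (cons-close (Structure.algebra S) {k} {m = m} x ρ τ p)))
      formula-uniform (⨅ k φ) n =
        let (m , h) = formula-uniform φ n in m , λ S ρ τ p →
          inf-close (val-⨅ S φ ρ) (val-⨅ S φ τ) λ x → h S (x ∷ ρ) (x ∷ τ)
            (cons-close (Structure.algebra S) {k} {m = m} x ρ τ p)

  -- Codes of formulas

  abstract
    divide₃ : ∀ n → ∃[ m ] ι m + ι m + ι m ≤ ι n
    divide₃ n = let (m , h) = divide 3 n in m , ≤-resp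
      (solve 1 (λ x → (con (1 , 0) :+ (con (1 , 0) :+ (con (1 , 0) :+ con (0 , 0)))) :* x := x :+ x :+ x) refl (ι m)) refl h

  -- The radius is doubled for `conn-close`, where `y` reaches a grid point only by way of `x`.
  UniformAt : ∀ {k} → Connective k → (M N m : ℕ) → Set
  UniformAt f M N m = ∀ x → InBox (fromℕ M) x → ∀ y → (∀ i → ∣ x i - y i ∣ ≤ ι N + ι N) →
                      ∣ apply f x - apply f y ∣ ≤ ι m

  abstract
    uniformAt : ∀ {k} (f : Connective k) M m → ∃[ N ] UniformAt f M N m
    uniformAt f M m =
      let (N , h) = uniform-on-box (continuous f) (fromℕ M) (ι m) (0<ι m)
          (N′ , h′) = divide₂ N
      in N′ , λ x b y p → <⇒≤ (h x b y λ i → ≤-trans (p i) h′)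

  module _ {𝒮 : Signature} where
    open Signature 𝒮

    private
      C : Set
      C = Constant

    -- For a connective the code records arity, size `M` of the box and precision `N`, so that
    -- formulas with equal codes share them and their connectives are compared on the same grid.
    data FormulaCode (n : ℕ) {Γ} : Formula C Γ → Tree → Set where
      dist : ∀ {t u c c′} → TermCode {𝒮} (proj₁ (divide₂ n)) t c → TermCode {𝒮} (proj₁ (divide₂ n)) u c′ →
             FormulaCode n (dist t u) (node (leaf 0) (node c c′))
      conn : ∀ {k} {f : Connective k} {φs M N c c′ cs} → (∀ i → formulaBound {𝒮} (φs i) ≤ℕ M) →
             UniformAt f M N (proj₁ (divide₃ n)) → functionCode M N (proj₁ (divide₃ n)) k (apply f) ≡ c →
             tabulateTree cs ≡ c′ → (∀ i → FormulaCode N (φs i) (cs i)) →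
             FormulaCode n (conn f φs) (node (leaf 1) (node (node (leaf k) (leaf M)) (node (leaf N) (node c c′))))
      sup  : ∀ {m φ c} → FormulaCode n φ c → FormulaCode n (⨆ m φ) (node (leaf 2) (node (leaf m) c))
      inf  : ∀ {m φ c} → FormulaCode n φ c → FormulaCode n (⨅ m φ) (node (leaf 3) (node (leaf m) c))

    formulaCode : ∀ n {Γ} (φ : Formula C Γ) → ∃[ c ] FormulaCode n φ c
    formulaCode n (dist t u)  = _ , dist (proj₂ (termCode _ t)) (proj₂ (termCode _ u))
    formulaCode n (conn f φs) = _ , conn {cs = λ i → proj₁ (formulaCode _ (φs i))}
      (≤-maximum λ i → formulaBound {𝒮} (φs i)) (proj₂ (uniformAt f (maximum λ i → formulaBound {𝒮} (φs i)) _)) ≡.refl ≡.refl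
      (λ i → proj₂ (formulaCode _ (φs i)))
    formulaCode n (⨆ m φ)     = _ , sup (proj₂ (formulaCode n φ))
    formulaCode n (⨅ m φ)     = _ , inf (proj₂ (formulaCode n φ))

    FormulaClose : ℕ → ∀ {Γ} → Formula C Γ → Formula C Γ → Set₁
    FormulaClose n φ ψ = ∀ (S : Structure 𝒮) ρ → ∣ val S φ ρ - val S ψ ρ ∣ ≤ ι n

    private
      -- With the grid point z from `functionCode-close`, the path is f x, f z, g z, g y; each step
      -- costs a third of the precision, hence `divide₃`.
      conn-close : ∀ {k} {f g : Connective k} {M N n} → UniformAt f M N (proj₁ (divide₃ n)) →
        UniformAt g M N (proj₁ (divide₃ n)) →
        functionCode M N (proj₁ (divide₃ n)) k (apply f) ≡ functionCode M N (proj₁ (divide₃ n)) k (apply g) →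
        ∀ {x y} → InBox (fromℕ M) x → InBox (fromℕ M) y → (∀ i → ∣ x i - y i ∣ ≤ ι N) →
        ∣ apply f x - apply g y ∣ ≤ ι n
      conn-close {k} {f} {g} {M} {N} {n} uf ug p {x} {y} bx by x~y =
        let (z , x~z , fz~gz) = functionCode-close M N (proj₁ (divide₃ n)) k p x bx in
        ≤-trans (∣∣-triangle (apply f x) (apply f z) (apply g y)) (≤-trans
          (uf x bx z (λ i → ≤-trans (x~z i) (x≤x+y (<⇒≤ (0<ι N))))
           ⊕ ≤-trans (∣∣-triangle (apply f z) (apply g z) (apply g y)) (fz~gz ⊕
               ∣∣-swap≤
                 (ug y by z λ i → ≤-trans (∣∣-triangle (y i) (x i) (z i))
                   (∣∣-swap≤ (x~y i) ⊕ x~z i))))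
          (≈-≤-trans (sym (+-assoc _ _ _)) (proj₂ (divide₃ n))))

    formulaCode-close : ∀ {n Γ} {φ ψ : Formula C Γ} {c} → FormulaCode n φ c → FormulaCode n ψ c → FormulaClose n φ ψ
    formulaCode-close {n} (dist {t} {u} p q) (dist {t′} {u′} p′ q′) S ρ =
      ≈-≤-trans (∣∣-cong (+-cong (val-dist S t u ρ) (-‿cong (val-dist S t′ u′ ρ))))
        (≤-trans (dist-close (Structure.algebra S) _ _ _ _)
          (≤-trans (termCode-close S p p′ ρ ⊕ termCode-close S q q′ ρ) (proj₂ (divide₂ n))))
    formulaCode-close (conn {f = f} {φs} b u ≡.refl ≡.refl h) (conn {f = g} {ψs} b′ u′ p q h′) S ρ =
      ≈-≤-trans (∣∣-cong (+-cong (val-conn S f φs ρ) (-‿cong (val-conn S g ψs ρ))))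
        (conn-close {f = f} {g} u u′ (≡.sym p) (λ i → ≤-trans (val-bound S (φs i) ρ) (fromℕ-mono (b i)))
          (λ i → ≤-trans (val-bound S (ψs i) ρ) (fromℕ-mono (b′ i)))
          λ i → formulaCode-close (h i) (≡.subst (FormulaCode _ (ψs i)) (tabulateTree-injective q i) (h′ i)) S ρ)
    formulaCode-close (sup p) (sup p′) S ρ = ≤-resp (∣neg-neg∣ _ _) refl
      (inf-close (val-⨆ S _ ρ) (val-⨆ S _ ρ) λ x →
        ≈-≤-trans (∣neg-neg∣ _ _) (formulaCode-close p p′ S (x ∷ ρ)))
    formulaCode-close (inf p) (inf p′) S ρ =
      inf-close (val-⨅ S _ ρ) (val-⨅ S _ ρ) λ x → formulaCode-close p p′ S (x ∷ ρ)

    abstract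
      countable-term-net : Σ[ e ∈ (ℕ → Term C []) ] ∀ t n → ∃[ i ] (∀ (S : Structure 𝒮) → TermClose S n t (e i))
      countable-term-net = countable-net zeroₜ (λ n t u → ∀ (S : Structure 𝒮) → TermClose S n t u)
        (λ n t → proj₁ (termCode n t))
        (λ n {t} {u} p S → termCode-close S (≡.subst (TermCode n t) p (proj₂ (termCode n t))) (proj₂ (termCode n u)))

  -- Countably many axioms

  logicSignature : Signature
  logicSignature = record { Constant = ⊥ ; bound = λ () ; code = λ () ; code-injective = λ {c} → ⊥-elim c }

  plain : CStarAlgebra → Structure logicSignature
  plain A = record { algebra = A ; constant = λ () ; bounded = λ () }

  module _ {A : CStarAlgebra} {Γ : List Sort} (φ : LFormula Γ) {ρ : Env A Γ} {r : ℝ} where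

    lvalue⇒val : LValue A φ ρ r → r ≈ val (plain A) φ ρ
    lvalue⇒val = hasValue⇒val (plain A) φ

    val⇒lvalue : r ≈ val (plain A) φ ρ → LValue A φ ρ r
    val⇒lvalue = val⇒hasValue (plain A) φ

  -- Fills the places in an enumeration of axioms whose code belongs to no axiom, in particular all
  -- places if the theory is empty.
  trivial : LSentence
  trivial = dist zeroₜ zeroₜ

  val-trivial : ∀ A → val (plain A) trivial [] ≈ 0#
  val-trivial A = trans (val-dist (plain A) zeroₜ zeroₜ []) (≈ᴹ⇒d≈0 A (≈ᴹ-refl A))

  abstract
    -- The net is chosen inside the theory, so that its members are axioms or `trivial`. If they all
    -- have value 0, so does every axiom, being approximated by them to any precision.
    countable-subtheory : (𝒯 : Theory) → Σ[ u ∈ (ℕ → LSentence) ] (∀ i → 𝒯 (u i) ⊎ u i ≡ trivial) ×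
      (∀ A → (∀ i → val (plain A) (u i) [] ≈ 0#) → A ⊨ 𝒯)
    countable-subtheory 𝒯 =
      let (e , net) = countable-net {X = ∃[ φ ] (𝒯 φ ⊎ φ ≡ trivial)} (trivial , inj₂ ≡.refl)
            (λ n φ ψ → FormulaClose n (proj₁ φ) (proj₁ ψ))
            (λ n φ → proj₁ (formulaCode n (proj₁ φ)))
            (λ n {φ} {ψ} p → formulaCode-close
              (≡.subst (FormulaCode n (proj₁ φ)) p (proj₂ (formulaCode n (proj₁ φ)))) (proj₂ (formulaCode n (proj₁ ψ))))
      in (λ i → proj₁ (e i)) , (λ i → proj₂ (e i)) , λ A h φ 𝒯φ →
        val⇒lvalue φ (≈-approx λ ε p →
          let (n , ιn<ε) = ι-small ε p
              (i , close) = net (φ , inj₁ 𝒯φ) n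
          in ≤-trans (∣∣-swap≤
               (≈-≤-trans (∣∣-cong (+-congˡ (-‿cong (sym (h i))))) (close (plain A) []))) (<⇒≤ ιn<ε))

  -- Limits of structures

  squeeze₀ : ∀ {x y} → (∀ n → 0# ≤ x n) → Eventually (λ n → x n ≤ y n) → y ⟶ 0# → x ⟶ 0#
  squeeze₀ {x} {y} 0≤x x≤y y⟶0 ε p = eventually-map
    (λ {n} (q , r) → ≈-<-trans (abs (0≤x n)) (≤-<-trans q (≤-<-trans (x≤∣x∣ (y n)) (≈-<-trans (sym (∣∣-cong (minus0 (y n)))) r))))
    (eventually-× x≤y (y⟶0 ε p))
    where
    minus0 : ∀ z → z - 0# ≈ z
    minus0 = solve 1 (λ z → z :- con (0 , 0) := z) refl
    abs : ∀ {z} → 0# ≤ z → ∣ z - 0# ∣ ≈ z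
    abs {z} q = trans (∣∣-cong (minus0 z)) (∣∣-nonneg q)

  lim-scale₀ : ∀ {x} c → x ⟶ 0# → (λ n → c * x n) ⟶ 0#
  lim-scale₀ c p = lim-cong (λ _ → refl) (zeroʳ c) (lim-* lim-const p)

  lim-+₀ : ∀ {x y} → x ⟶ 0# → y ⟶ 0# → (λ n → x n + y n) ⟶ 0#
  lim-+₀ p q = lim-cong (λ _ → refl) (+-identityʳ 0#) (lim-+ p q)

  const₀ : ∀ {x} → (∀ n → x n ≈ 0#) → x ⟶ 0#
  const₀ h = lim-cong (λ n → sym (h n)) refl lim-const

  lim-mono : ∀ {x y l m} → (∀ n → x n ≤ y n) → x ⟶ l → y ⟶ m → l ≤ m
  lim-mono h = lim-≤ (0 , λ {n} _ → h n)

  lim-≈ : ∀ {x y l m} → (∀ n → x n ≈ y n) → x ⟶ l → y ⟶ m → l ≈ m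
  lim-≈ h p q = lim-unique p (lim-cong (λ n → sym (h n)) refl q)

  -- If the norms of closed terms converge along a sequence of structures, their
  -- limit is a C*-seminorm on closed terms; the limit structure is its completion.
  module LimitAlgebra {𝒮 : Signature} (S : ℕ → Structure 𝒮)
    (cauchy : ∀ (t : Term (Signature.Constant 𝒮) []) →
      IsCauchy λ k → CStarAlgebra.‖_‖ (Structure.algebra (S k)) (⟦ t ⟧ˢ (S k) [])) where

    open Signature 𝒮

    Tm : Set
    Tm = Term Constant []

    private
      module A k = CStarAlgebra (Structure.algebra (S k))
      alg : ℕ → CStarAlgebra
      alg k = Structure.algebra (S k)
      ⟦_⟧ₖ : Tm → ∀ k → Carrier (alg k)
      ⟦ t ⟧ₖ k = ⟦ t ⟧ˢ (S k) []
      infix 4 _≗_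
      _≗_ : Tm → Tm → Set
      t ≗ u = ∀ k → A._≈ᴹ_ k (⟦ t ⟧ₖ k) (⟦ u ⟧ₖ k)

    negₜ : Tm → Tm
    negₜ t = (ℂ.- 1ᶜ) *ₜ t

    N : Tm → ℝ
    N t = proj₁ (cauchy⇒limit (cauchy t))

    N-lim : ∀ t → (λ k → A.‖_‖ k (⟦ t ⟧ₖ k)) ⟶ N t
    N-lim t = proj₂ (cauchy⇒limit (cauchy t))

    D : Tm → Tm → ℝ
    D t u = N (t +ₜ negₜ u)

    D-lim : ∀ t u → (λ k → A.d k (⟦ t ⟧ₖ k) (⟦ u ⟧ₖ k)) ⟶ D t u
    D-lim t u = lim-cong (λ k → A.‖‖-cong k (+ᴹ-cong (alg k) (≈ᴹ-refl (alg k)) (-ᴹ≈-1*ₗ (alg k) _))) refl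
      (N-lim (t +ₜ negₜ u))

    private
      0≤N : ∀ t → 0# ≤ N t
      0≤N t = lim-mono (λ k → A.‖‖-nonneg k _) lim-const (N-lim t)

      0≤D : ∀ t u → 0# ≤ D t u
      0≤D t u = 0≤N _

      ≗⇒D≈0 : ∀ {t u} → t ≗ u → D t u ≈ 0#
      ≗⇒D≈0 {t} {u} p = lim-unique (D-lim t u) (const₀ λ k → ≈ᴹ⇒d≈0 (alg k) (p k))

      D-sym : ∀ t u → D t u ≈ D u t
      D-sym t u = lim-≈ (λ k → d-sym (alg k) _ _) (D-lim t u) (D-lim u t)

      D-triangle : ∀ t u v → D t v ≤ D t u + D u v
      D-triangle t u v = lim-mono (λ k → d-triangle (alg k) _ _ _) (D-lim t v) (lim-+ (D-lim t u) (D-lim u v))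

      D-+ : ∀ t t′ u u′ → D (t +ₜ t′) (u +ₜ u′) ≤ D t u + D t′ u′
      D-+ t t′ u u′ = lim-mono (λ k → d-+ᴹ (alg k) _ _ _ _) (D-lim _ _) (lim-+ (D-lim t u) (D-lim t′ u′))

      D-· : ∀ t t′ u u′ → D (t ·ₜ t′) (u ·ₜ u′) ≤ N t * D t′ u′ + D t u * N u′
      D-· t t′ u u′ = lim-mono (λ k → d-· (alg k) _ _ _ _) (D-lim _ _)
        (lim-+ (lim-* (N-lim t) (D-lim t′ u′)) (lim-* (D-lim t u) (N-lim u′)))

      D-⋆ : ∀ t u → D (t ⋆ₜ) (u ⋆ₜ) ≈ D t u
      D-⋆ t u = lim-≈ (λ k → d-⋆ (alg k) _ _) (D-lim _ _) (D-lim t u)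

      D-* : ∀ z t u → D (z *ₜ t) (z *ₜ u) ≤ ∣ z ∣₁ * D t u
      D-* z t u = lim-mono (λ k → d-*ₗ (alg k) z _ _) (D-lim _ _) (lim-* lim-const (D-lim t u))

      D-0 : ∀ t → D t zeroₜ ≈ N t
      D-0 t = lim-≈ (λ k → d-0ʳ (alg k) _) (D-lim t zeroₜ) (N-lim t)

      N≤N+D : ∀ t u → N t ≤ N u + D t u
      N≤N+D t u = lim-mono (λ k → ‖‖≤‖‖+d (alg k) _ _) (N-lim t) (lim-+ (N-lim u) (D-lim t u))

      ∣N-N∣≤D : ∀ t u → ∣ N t - N u ∣ ≤ D t u
      ∣N-N∣≤D t u = ∣-∣≤ (N≤N+D t u) (≤-trans (N≤N+D u t) (≤-refl ⊕ ≤-reflexive (D-sym u t)))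

    IsCauchyᴰ : (ℕ → Tm) → Set
    IsCauchyᴰ x = ∀ ε → 0# < ε → ∃[ K ] ∀ {j k} → K ≤ℕ j → K ≤ℕ k → D (x j) (x k) < ε

    record Sequence : Set where
      constructor _,_
      field
        term     : ℕ → Tm
        isCauchy : IsCauchyᴰ term
    open Sequence

    infix 4 _≈ˢ_
    -- A record rather than a bare statement about limits, so that the two sequences can be inferred
    -- from a proof of equality.
    record _≈ˢ_ (x y : Sequence) : Set where
      constructor null
      field
        vanishes : (λ j → D (term x j) (term y j)) ⟶ 0#
    open _≈ˢ_

    private
      -- An identity valid in every structure of the sequence holds in the limit; the equational
      -- laws of the limit algebra come from here.
      pointwise : ∀ {x y} → (∀ j → term x j ≗ term y j) → x ≈ˢ y
      pointwise p = null (const₀ λ j → ≗⇒D≈0 (p j))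

      N-bounded : ∀ x → ∃[ B ] Eventually λ j → N (term x j) ≤ fromℕ B
      N-bounded (x , c) =
        let (K , h) = c 1# 0<1
            (B , q) = archimedean (N (x K) + 1#)
        in B , K , λ p → ≤-trans (N≤N+D (x _) (x K)) (≤-trans (≤-refl ⊕ <⇒≤ (h p ℕ.≤-refl)) (<⇒≤ q))

      -- Every operation is Lipschitz on bounded sets, so one scheme, with a factor `B` valid from
      -- the index `K` on, handles them all; unary operations use it with both sequences equal.
      -- `null₂` is its counterpart for congruence.
      cauchy₂ : ∀ {x y z} B → IsCauchyᴰ x → IsCauchyᴰ y →
        ∃[ K ] (∀ {j k} → K ≤ℕ j → K ≤ℕ k → D (z j) (z k) ≤ fromℕ B * (D (x j) (x k) + D (y j) (y k))) →
        IsCauchyᴰ z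
      cauchy₂ B cx cy (K , h) ε p =
        let (δ , 0<δ , shrunk) = shrink B (half ε) (half-pos p)
            (M , hx) = cx (half δ) (half-pos 0<δ)
            (M′ , hy) = cy (half δ) (half-pos 0<δ)
        in K ℕ.⊔ (M ℕ.⊔ M′) , λ q r → ≤-<-trans
          (≤-trans (h (ℕ.m⊔n≤o⇒m≤o K _ q) (ℕ.m⊔n≤o⇒m≤o K _ r))
            (≤-trans (*-monoʳ (0≤fromℕ B) (≤-≈-trans
              (<⇒≤ (hx (first {K} q) (first {K} r)) ⊕ <⇒≤ (hy (second {K} q) (second {K} r)))
              (half+half δ))) shrunk))
          (half< p)
        where
        first : ∀ {K M M′ j} → K ℕ.⊔ (M ℕ.⊔ M′) ≤ℕ j → M ≤ℕ j
        first {K} {M} q = ℕ.m⊔n≤o⇒m≤o M _ (ℕ.m⊔n≤o⇒n≤o K _ q)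
        second : ∀ {K M M′ j} → K ℕ.⊔ (M ℕ.⊔ M′) ≤ℕ j → M′ ≤ℕ j
        second {K} {M} q = ℕ.m⊔n≤o⇒n≤o M _ (ℕ.m⊔n≤o⇒n≤o K _ q)

      null₂ : ∀ {x x′ y y′ z z′} B → x ≈ˢ x′ → y ≈ˢ y′ →
        Eventually (λ j → D (term z j) (term z′ j) ≤ fromℕ B * (D (term x j) (term x′ j) + D (term y j) (term y′ j))) →
        z ≈ˢ z′
      null₂ B (null p) (null q) h = null (squeeze₀ (λ _ → 0≤D _ _) h (lim-scale₀ (fromℕ B) (lim-+₀ p q)))

      ≤-one : ∀ {x y} → x ≤ y → x ≤ fromℕ 1 * y
      ≤-one {x} {y} p = ≤-≈-trans p (solve 1 (λ y → y := (con (1 , 0) :+ con (0 , 0)) :* y) refl y)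

      ·-bound : ∀ {B B′ t t′ u u′} → N t ≤ fromℕ B → N u′ ≤ fromℕ B′ →
                D (t ·ₜ t′) (u ·ₜ u′) ≤ fromℕ (B ℕ.+ B′) * (D t u + D t′ u′)
      ·-bound {B} {B′} {t} {t′} {u} {u′} p q = ≤-trans (D-· t t′ u u′) (≤-trans
        (*-mono (0≤N t) (0≤D t′ u′) p ≤-refl ⊕ *-monoʳ (0≤D t u) q)
        (linear (*-nonneg (0≤fromℕ B) (0≤D t u) ⊕ *-nonneg (0≤fromℕ B′) (0≤D t′ u′))
          (trans (+-congʳ (*-congʳ (fromℕ-+ B B′)))
            (solve 4 (λ b c x y → (b :+ c) :* (x :+ y) :+ (con (0 , 0) :+ con (0 , 0)) :=
              (b :* y :+ x :* c) :+ (b :* x :+ c :* y)) refl (fromℕ B) (fromℕ B′) (D t u) (D t′ u′)))))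

      ⋆-bound : ∀ {t u} → D (t ⋆ₜ) (u ⋆ₜ) ≤ fromℕ 1 * (D t u + D t u)
      ⋆-bound {t} {u} = ≤-one (≈-≤-trans (D-⋆ t u) (x≤x+y (0≤D t u)))

      *-bound : ∀ z {t u} → D (z *ₜ t) (z *ₜ u) ≤ fromℕ (scalarBound {𝒮} z) * (D t u + D t u)
      *-bound z {t} {u} = ≤-trans (D-* z t u) (*-mono (0≤∣∣₁ z)
        (≤-trans (0≤D t u) (x≤x+y (0≤D t u))) (∣∣₁≤scalarBound {𝒮} z) (x≤x+y (0≤D t u)))

    const : Tm → Sequence
    const t = (λ _ → t) , λ ε p → 0 , λ _ _ → ≈-<-trans (≗⇒D≈0 λ k → ≈ᴹ-refl (alg k)) p

    infixl 6 _+ˢ_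
    infixl 7 _·ˢ_

    _+ˢ_ : Sequence → Sequence → Sequence
    (x , c) +ˢ (y , c′) = (λ j → x j +ₜ y j) , cauchy₂ 1 c c′ (0 , λ _ _ → ≤-one (D-+ _ _ _ _))

    _·ˢ_ : Sequence → Sequence → Sequence
    x ·ˢ y = (λ j → term x j ·ₜ term y j) ,
      (let (B , bx) = N-bounded x
           (B′ , by) = N-bounded y
           (K , h) = eventually-× bx by
       in cauchy₂ (B ℕ.+ B′) (isCauchy x) (isCauchy y) (K , λ p q → ·-bound {B} {B′} (proj₁ (h p)) (proj₂ (h q))))

    _⋆ˢ : Sequence → Sequence
    (x , c) ⋆ˢ = (λ j → x j ⋆ₜ) , cauchy₂ 1 c c (0 , λ _ _ → ⋆-bound)

    _*ˢ_ : ℂ → Sequence → Sequence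
    z *ˢ (x , c) = (λ j → z *ₜ x j) , cauchy₂ (scalarBound {𝒮} z) c c (0 , λ _ _ → *-bound z)

    ‖_‖ˢ : Sequence → ℝ
    ‖ x , c ‖ˢ = proj₁ (cauchy⇒limit {λ j → N (x j)} λ ε p →
      let (K , h) = c ε p in K , λ q r → ≤-<-trans (∣N-N∣≤D _ _) (h q r))

    ‖‖ˢ-lim : ∀ x → (λ j → N (term x j)) ⟶ ‖ x ‖ˢ
    ‖‖ˢ-lim (x , c) = proj₂ (cauchy⇒limit λ ε p →
      let (K , h) = c ε p in K , λ q r → ≤-<-trans (∣N-N∣≤D _ _) (h q r))

    dˢ : Sequence → Sequence → ℝ
    dˢ x y = ‖ x +ˢ ((ℂ.- 1ᶜ) *ˢ y) ‖ˢ

    dˢ-lim : ∀ x y → (λ j → D (term x j) (term y j)) ⟶ dˢ x y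
    dˢ-lim x y = ‖‖ˢ-lim (x +ˢ ((ℂ.- 1ᶜ) *ˢ y))

    dˢ-triangle : ∀ x y z → dˢ x z ≤ dˢ x y + dˢ y z
    dˢ-triangle x y z = lim-mono (λ j → D-triangle _ _ _) (dˢ-lim x z) (lim-+ (dˢ-lim x y) (dˢ-lim y z))

    dˢ-sym : ∀ x y → dˢ x y ≈ dˢ y x
    dˢ-sym x y = lim-≈ (λ j → D-sym _ _) (dˢ-lim x y) (dˢ-lim y x)

    dˢ-const : ∀ t u → dˢ (const t) (const u) ≈ D t u
    dˢ-const t u = lim-unique (dˢ-lim (const t) (const u)) lim-const

    approximate : ∀ x ε → 0# < ε → ∃[ t ] dˢ x (const t) ≤ ε
    approximate x ε p =
      let (K , h) = isCauchy x ε p in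
      term x K , lim-≤ (K , λ q → <⇒≤ (h q ℕ.≤-refl)) (dˢ-lim x (const (term x K))) lim-const

    -- The limit is written down directly: replace each `X i` by a single term within `ι i` of it;
    -- the sequence of these terms is itself an element.
    complete-sequences : (X : ℕ → Sequence) →
      (∀ ε → 0# < ε → ∃[ K ] ∀ {j k} → K ≤ℕ j → K ≤ℕ k → dˢ (X j) (X k) < ε) →
      ∃[ y ] ∀ ε → 0# < ε → ∃[ K ] ∀ {j} → K ≤ℕ j → dˢ (X j) y < ε
    complete-sequences X cauchyX = y , converges
      where
      t : ℕ → Tm
      t i = proj₁ (approximate (X i) (ι i) (0<ι i))
      t-near : ∀ i → dˢ (X i) (const (t i)) ≤ ι i
      t-near i = proj₂ (approximate (X i) (ι i) (0<ι i))

      t-cauchy : ∀ ε → 0# < ε → ∃[ K ] ∀ {j k} → K ≤ℕ j → K ≤ℕ k → D (t j) (t k) < ε × ι j < ε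
      t-cauchy ε p =
        let h = half (half ε)
            ph = half-pos (half-pos p)
            (K , c) = cauchyX (half ε) (half-pos p)
            (M , ιM<) = ι-small h ph
        in K ℕ.⊔ M , λ {j} {k} q r →
          let ιj = ≤-<-trans (ι-anti (ℕ.m⊔n≤o⇒n≤o K M q)) ιM<
              ιk = ≤-<-trans (ι-anti (ℕ.m⊔n≤o⇒n≤o K M r)) ιM<
          in ≈-<-trans (sym (dˢ-const (t j) (t k)))
              (≤-<-trans (dˢ-triangle (const (t j)) (X j) (const (t k)))
              (≤-<-trans (≈-≤-trans (dˢ-sym (const (t j)) (X j)) (t-near j)
                          ⊕ ≤-trans (dˢ-triangle (X j) (X k) (const (t k))) (≤-refl ⊕ t-near k))
              (<-≈-trans (<⊕< ιj (<⊕< (c (ℕ.m⊔n≤o⇒m≤o K M q) (ℕ.m⊔n≤o⇒m≤o K M r)) ιk))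
                (trans (solve 2 (λ h e → h :+ (e :+ h) := (h :+ h) :+ e) refl h (half ε))
                  (trans (+-congʳ (half+half (half ε))) (half+half ε)))))) ,
             <-trans ιj (<-trans (half< (half-pos p)) (half< p))

      y : Sequence
      y = t , λ ε p → let (K , h) = t-cauchy ε p in K , λ q r → proj₁ (h q r)

      converges : ∀ ε → 0# < ε → ∃[ K ] ∀ {j} → K ≤ℕ j → dˢ (X j) y < ε
      converges ε p =
        let (K , h) = t-cauchy (half (half ε)) (half-pos (half-pos p)) in
        K , λ {j} q → ≤-<-trans (dˢ-triangle (X j) (const (t j)) y)
          (halves< (≤-<-trans (t-near j) (<-trans (proj₂ (h q ℕ.≤-refl)) (half< (half-pos p))))
            (≤-<-trans (lim-≤ (K , λ r → <⇒≤ (proj₁ (h q r))) (dˢ-lim (const (t j)) y) lim-const) (half< (half-pos p))))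

    private
      ≈ˢ-isEquivalence : IsEquivalence _≈ˢ_
      ≈ˢ-isEquivalence = record
        { refl  = pointwise λ j k → ≈ᴹ-refl (alg k)
        ; sym   = λ (null p) → null (lim-cong (λ j → D-sym _ _) refl p)
        ; trans = λ (null p) (null q) → null (squeeze₀ (λ _ → 0≤D _ _) (0 , λ _ → D-triangle _ _ _) (lim-+₀ p q))
        }

      +ˢ-cong : ∀ {x x′ y y′} → x ≈ˢ x′ → y ≈ˢ y′ → x +ˢ y ≈ˢ x′ +ˢ y′
      +ˢ-cong p q = null₂ 1 p q (0 , λ _ → ≤-one (D-+ _ _ _ _))

      ·ˢ-cong : ∀ {x x′ y y′} → x ≈ˢ x′ → y ≈ˢ y′ → x ·ˢ y ≈ˢ x′ ·ˢ y′
      ·ˢ-cong {x} {x′} {y} {y′} p q =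
        let (B , bx) = N-bounded x
            (B′ , by) = N-bounded y′
        in null₂ (B ℕ.+ B′) p q (eventually-map (λ (a , b) → ·-bound {B} {B′} a b) (eventually-× bx by))

      *ˢ-cong : ∀ {z w x y} → z ℂ.≈ w → x ≈ˢ y → z *ˢ x ≈ˢ w *ˢ y
      *ˢ-cong {z} {w} {x} p q = IsEquivalence.trans ≈ˢ-isEquivalence {j = w *ˢ x}
        (pointwise λ j k → *ₗ-cong (alg k) p (≈ᴹ-refl (alg k)))
        (null₂ (scalarBound {𝒮} w) q q (0 , λ _ → *-bound w))

      +ˢ-isAbelianGroup : IsAbelianGroup _≈ˢ_ _+ˢ_ (const zeroₜ) ((ℂ.- 1ᶜ) *ˢ_)
      +ˢ-isAbelianGroup = record
        { isGroup = record
          { isMonoid = record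
            { isSemigroup = record
              { isMagma = record { isEquivalence = ≈ˢ-isEquivalence ; ∙-cong = +ˢ-cong }
              ; assoc   = λ x y z → pointwise λ j k → +ᴹ-assoc (alg k) _ _ _ }
            ; identity = (λ x → pointwise λ j k → +ᴹ-identityˡ (alg k) _) ,
                         (λ x → pointwise λ j k → +ᴹ-identityʳ (alg k) _) }
          ; inverse = (λ x → pointwise λ j k → ≈ᴹ-trans (alg k)
                        (+ᴹ-cong (alg k) (-ᴹ≈-1*ₗ (alg k) _) (≈ᴹ-refl (alg k))) (-ᴹ‿inverseˡ (alg k) _)) ,
                      (λ x → pointwise λ j k → ≈ᴹ-trans (alg k)
                        (+ᴹ-cong (alg k) (≈ᴹ-refl (alg k)) (-ᴹ≈-1*ₗ (alg k) _)) (-ᴹ‿inverseʳ (alg k) _))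
          ; ⁻¹-cong = *ˢ-cong ℂ.refl }
        ; comm = λ x y → pointwise λ j k → +ᴹ-comm (alg k) _ _ }

      ‖‖ˢ-mono : ∀ {x y} → x ≈ˢ y → ‖ x ‖ˢ ≤ ‖ y ‖ˢ
      ‖‖ˢ-mono {x} {y} (null p) = ≤-resp refl (+-identityʳ _)
        (lim-mono (λ j → N≤N+D _ _) (‖‖ˢ-lim x) (lim-+ (‖‖ˢ-lim y) p))

    algebra : CStarAlgebra
    algebra = record
      { leftModule = record
        { Carrierᴹ = Sequence ; _≈ᴹ_ = _≈ˢ_ ; _+ᴹ_ = _+ˢ_ ; _*ₗ_ = _*ˢ_ ; 0ᴹ = const zeroₜ ; -ᴹ_ = (ℂ.- 1ᶜ) *ˢ_
        ; isLeftModule = record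
          { isLeftSemimodule = record
            { +ᴹ-isCommutativeMonoid = IsAbelianGroup.isCommutativeMonoid +ˢ-isAbelianGroup
            ; isPreleftSemimodule = record
              { *ₗ-cong      = *ˢ-cong
              ; *ₗ-zeroˡ     = λ x → pointwise λ j k → *ₗ-zeroˡ (alg k) _
              ; *ₗ-distribʳ  = λ x z w → pointwise λ j k → *ₗ-distribʳ (alg k) _ z w
              ; *ₗ-identityˡ = λ x → pointwise λ j k → *ₗ-identityˡ (alg k) _
              ; *ₗ-assoc     = λ z w x → pointwise λ j k → *ₗ-assoc (alg k) z w _
              ; *ₗ-zeroʳ     = λ z → pointwise λ j k → *ₗ-zeroʳ (alg k) z
              ; *ₗ-distribˡ  = λ z x y → pointwise λ j k → *ₗ-distribˡ (alg k) z _ _ } }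
          ; -ᴹ‿cong    = *ˢ-cong ℂ.refl
          ; -ᴹ‿inverse = IsAbelianGroup.inverse +ˢ-isAbelianGroup } }
      ; _·_ = _·ˢ_
      ; isRingWithoutOne = record
        { +-isAbelianGroup = +ˢ-isAbelianGroup
        ; *-cong  = ·ˢ-cong
        ; *-assoc = λ x y z → pointwise λ j k → ·-assoc (alg k) _ _ _
        ; distrib = (λ x y z → pointwise λ j k → ·-distribˡ (alg k) _ _ _) ,
                    (λ x y z → pointwise λ j k → ·-distribʳ (alg k) _ _ _) }
      ; *ₗ-·-assocˡ    = λ z x y → pointwise λ j k → A.*ₗ-·-assocˡ k z _ _
      ; *ₗ-·-assocʳ    = λ z x y → pointwise λ j k → A.*ₗ-·-assocʳ k z _ _
      ; one            = λ u → const (oneₜ u)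
      ; one-identityˡ  = λ u x → pointwise λ j k → A.one-identityˡ k u _
      ; one-identityʳ  = λ u x → pointwise λ j k → A.one-identityʳ k u _
      ; _⋆             = _⋆ˢ
      ; ⋆-cong         = λ p → null₂ 1 p p (0 , λ _ → ⋆-bound)
      ; ⋆-involutive   = λ x → pointwise λ j k → A.⋆-involutive k _
      ; ⋆-homo-+ᴹ      = λ x y → pointwise λ j k → A.⋆-homo-+ᴹ k _ _
      ; ⋆-conjugate    = λ z x → pointwise λ j k → A.⋆-conjugate k z _
      ; ⋆-antihomo-·   = λ x y → pointwise λ j k → A.⋆-antihomo-· k _ _
      ; ‖_‖            = ‖_‖ˢ
      ; ‖‖-cong        = λ p → ≤-antisym (‖‖ˢ-mono p) (‖‖ˢ-mono (IsEquivalence.sym ≈ˢ-isEquivalence p))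
      ; ‖‖-nonneg      = λ x → lim-mono (λ j → 0≤N _) lim-const (‖‖ˢ-lim x)
      ; ‖‖-definite    = λ x p → null (lim-cong (λ j → sym (D-0 _)) p (‖‖ˢ-lim x))
      -- Two limits are nested from here on: `k` runs over the structures, `j` along the sequences
      -- of terms.
      ; ‖‖-homogeneous = λ z x m → lim-≈ (λ j → lim-≈ (λ k → A.‖‖-homogeneous k z _ m) (N-lim _) (lim-* lim-const (N-lim _)))
          (‖‖ˢ-lim (z *ˢ x)) (lim-* lim-const (‖‖ˢ-lim x))
      ; ‖‖-triangle    = λ x y → lim-mono (λ j → lim-mono (λ k → A.‖‖-triangle k _ _) (N-lim _) (lim-+ (N-lim _) (N-lim _)))
          (‖‖ˢ-lim (x +ˢ y)) (lim-+ (‖‖ˢ-lim x) (‖‖ˢ-lim y))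
      ; ‖‖-submult     = λ x y → lim-mono (λ j → lim-mono (λ k → A.‖‖-submult k _ _) (N-lim _) (lim-* (N-lim _) (N-lim _)))
          (‖‖ˢ-lim (x ·ˢ y)) (lim-* (‖‖ˢ-lim x) (‖‖ˢ-lim y))
      ; C*-identity    = λ x → lim-≈ (λ j → lim-≈ (λ k → A.C*-identity k _) (N-lim _) (lim-* (N-lim _) (N-lim _)))
          (‖‖ˢ-lim ((x ⋆ˢ) ·ˢ x)) (lim-* (‖‖ˢ-lim x) (‖‖ˢ-lim x))
      ; isComplete     = complete-sequences
      }

  -- Points and the Baire category theorem

  newConstants : Signature
  newConstants = record
    { Constant = NewConstant ; bound = proj₁ ; code = λ (n , j) → node (leaf n) (leaf j)
    ; code-injective = λ { ≡.refl → ≡.refl } }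

  ClosedTerm : Set
  ClosedTerm = Term NewConstant []

  Point : Set₁
  Point = Σ CStarAlgebra Interpretation

  structure : Point → Structure newConstants
  structure (A , a) = record
    { algebra = A ; constant = λ (n , j) → proj₁ (a n j) ; bounded = λ (n , j) → proj₂ (a n j) }

  Valuation : Set
  Valuation = QFSentence⁺ → ℝ

  value : Point → Valuation
  value p (φ , _) = val (structure p) φ []

  module _ {A : CStarAlgebra} {a : Interpretation A} (σ : QFSentence⁺) {r : ℝ} where

    value⁺⇒value : Value⁺ A a σ r → r ≈ value (A , a) σ
    value⁺⇒value = hasValue⇒val (structure (A , a)) (proj₁ σ)

    value⇒value⁺ : r ≈ value (A , a) σ → Value⁺ A a σ r
    value⇒value⁺ = val⇒hasValue (structure (A , a)) (proj₁ σ)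

  distance : ClosedTerm → ClosedTerm → QFSentence⁺
  distance t u = dist t u , dist t u

  evaluate : ClosedTerm → (p : Point) → Carrier (proj₁ p)
  evaluate t p = ⟦ t ⟧ˢ (structure p) []

  value-distance : ∀ p t u → value p (distance t u) ≈ CStarAlgebra.d (proj₁ p) (evaluate t p) (evaluate u p)
  value-distance p t u = val-dist (structure p) t u []

  -- What limit points satisfy by construction. `SortwiseDense` is stronger and has to be forced.
  TermDense : Point → Set
  TermDense p = ∀ x ε → 0# < ε → ∃[ t ] CStarAlgebra.d (proj₁ p) x (evaluate t p) ≤ ε

  module LimitPoint (p : ℕ → Point)
    (cauchy : ∀ t → IsCauchy λ k → CStarAlgebra.‖_‖ (proj₁ (p k)) (evaluate t (p k))) where

    open LimitAlgebra {newConstants} (λ k → structure (p k)) cauchy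
    open _≈ˢ_

    limitPoint : Point
    limitPoint = algebra , λ n j → const (con (n , j)) ,
      ≈-≤-trans (lim-unique (‖‖ˢ-lim (const (con (n , j)))) lim-const)
        (lim-mono (λ k → proj₂ (proj₂ (p k) n j)) (N-lim (con (n , j))) lim-const)

    private
      module L = CStarAlgebra algebra

      evaluate-const : ∀ t → evaluate t limitPoint L.≈ᴹ const t
      evaluate-const (con c)  = ≈ᴹ-refl algebra
      evaluate-const zeroₜ    = ≈ᴹ-refl algebra
      evaluate-const (oneₜ u) = ≈ᴹ-refl algebra
      evaluate-const (t +ₜ u) = null (vanishes (+ᴹ-cong algebra (evaluate-const t) (evaluate-const u)))
      evaluate-const (t ·ₜ u) = null (vanishes (·-cong algebra (evaluate-const t) (evaluate-const u)))
      evaluate-const (t ⋆ₜ)   = null (vanishes (L.⋆-cong (evaluate-const t)))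
      evaluate-const (z *ₜ t) = null (vanishes (*ₗ-cong algebra ℂ.refl (evaluate-const t)))

      distance-const : ∀ t u → L.d (evaluate t limitPoint) (evaluate u limitPoint) ≈ D t u
      distance-const t u = trans
        (d-cong algebra {evaluate t limitPoint} {const t} {evaluate u limitPoint} {const u} (evaluate-const t) (evaluate-const u))
        (lim-unique (dˢ-lim (const t) (const u)) lim-const)

    limitPoint-termDense : TermDense limitPoint
    limitPoint-termDense x ε q =
      let (t , h) = approximate x ε q in
      t , ≈-≤-trans (d-cong algebra {x} {x} {evaluate t limitPoint} {const t} (≈ᴹ-refl algebra) (evaluate-const t)) h

    value-lim : ∀ σ → (λ k → value (p k) σ) ⟶ value limitPoint σ
    value-lim (φ , q) = go φ q
      where
      go : ∀ φ → QuantifierFree φ → (λ k → val (structure (p k)) φ []) ⟶ val (structure limitPoint) φ []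
      go _ (dist t u) = lim-cong (λ k → sym (value-distance (p k) t u))
        (sym (trans (value-distance limitPoint t u) (distance-const t u))) (D-lim t u)
      go _ (conn f {φs} qs) = lim-cong (λ k → sym (val-conn (structure (p k)) f φs []))
        (sym (val-conn (structure limitPoint) f φs []))
        (continuous-lim (continuous f) λ i → go (φs i) (qs i))

  Nearᵛ : List QFSentence⁺ → ℝ → Valuation → Valuation → Set
  Nearᵛ σs ε v w = All (λ σ → ∣ w σ - v σ ∣ < ε) σs

  near-mono : ∀ {σs ε δ v w} → ε ≤ δ → Nearᵛ σs ε v w → Nearᵛ σs δ v w
  near-mono p = All.map λ q → <-≤-trans q p

  near-trans : ∀ {σs ε δ u v w} → Nearᵛ σs ε u v → Nearᵛ σs δ v w → Nearᵛ σs (δ + ε) u w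
  near-trans {u = u} {v} {w} p q = All.zipWith
    (λ {σ} (a , b) → ≤-<-trans (∣∣-triangle (w σ) (v σ) (u σ)) (<⊕< b a)) (p , q)

  near-refl : ∀ {ε v w} σs → 0# < ε → (∀ σ → v σ ≈ w σ) → Nearᵛ σs ε v w
  near-refl σs p v≈w = All.universal (λ σ → ≈-<-trans (∣x-x∣≈0 (sym (v≈w σ))) p) σs

  IsOpenᵛ : Pred Valuation (lsuc 0ℓ) → Set₁
  IsOpenᵛ O = ∀ v → O v → ∃[ σs ] ∃[ ε ] 0# < ε × (∀ w → Nearᵛ σs ε v w → O w)

  module _ (𝒯 : Theory) where

    ModelPoint : Set₁
    ModelPoint = Σ[ p ∈ Point ] proj₁ p ⊨ 𝒯

    record DenseOpen : Set₂ where
      field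
        member : Pred Valuation (lsuc 0ℓ)
        isOpen : IsOpenᵛ member
        dense  : (p : ModelPoint) → ∀ σs ε → 0# < ε →
                 Σ[ q ∈ ModelPoint ] member (value (proj₁ q)) × Nearᵛ σs ε (value (proj₁ p)) (value (proj₁ q))

    open DenseOpen

    -- Besides lying in the prescribed dense open sets, the approximations control
    -- the norms of more and more terms of a countable net, so that the limit
    -- structure exists.
    module Baire (O : ℕ → DenseOpen) (p₀ : ModelPoint) (σs₀ : List QFSentence⁺) (ε₀ : ℝ) (0<ε₀ : 0# < ε₀) where

      record Stage : Set₁ where
        field
          point     : ModelPoint
          sentences : List QFSentence⁺
          radius    : ℝ
          positive  : 0# < radius

        valuation : Valuation
        valuation = value (proj₁ point)

        Inside : Pred Valuation 0ℓ
        Inside = Nearᵛ sentences radius valuation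

      open Stage

      net : ℕ → ClosedTerm
      net = proj₁ (countable-term-net {newConstants})

      normOf : ClosedTerm → QFSentence⁺
      normOf t = distance t zeroₜ

      -- The new point lies within half of the old radius and the new radius is at most the other
      -- half, so the neighbourhoods are nested. By `controls` and `small`, the norm of `net k`
      -- moves by less than `ι k` at all later stages.
      record Successor (k : ℕ) (s : Stage) : Set₁ where
        field
          next      : Stage
          near      : Nearᵛ (sentences s) (half (radius s)) (valuation s) (valuation next)
          keeps     : ∀ {Q : Pred QFSentence⁺ 0ℓ} → All Q (sentences next) → All Q (sentences s)
          controls  : ∀ {Q : Pred QFSentence⁺ 0ℓ} → All Q (sentences next) → Q (normOf (net k))
          halves    : radius next ≤ half (radius s)
          small     : radius next ≤ ι k
          inside    : ∀ w → Inside next w → member (O k) w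

      open Successor

      abstract
        successor : ∀ k s → Successor k s
        successor k s =
          let (p , Op , near) = dense (O k) (point s) (sentences s) (half (radius s)) (half-pos (positive s))
              (σs , ε , 0<ε , nbhd) = isOpen (O k) (value (proj₁ p)) Op
              (δ , 0<δ , δ≤½ , δ≤ε) = positive-minimum (half-pos (positive s)) 0<ε
              (η , 0<η , η≤δ , η≤ι) = positive-minimum 0<δ (0<ι k)
          in record
            { next     = record { point = p ; sentences = normOf (net k) ∷ (σs ++ sentences s) ; radius = η ; positive = 0<η }
            ; near     = near
            ; keeps    = λ { (_ ∷ h) → ++⁻ʳ σs h }
            ; controls = λ { (h ∷ _) → h }
            ; halves   = ≤-trans η≤δ δ≤½
            ; small    = η≤ι
            ; inside   = λ { w (_ ∷ h) → nbhd w (near-mono (≤-trans η≤δ δ≤ε) (++⁻ˡ σs h)) }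
            }

      stage : ℕ → Stage
      stage zero    = record { point = p₀ ; sentences = σs₀ ; radius = ε₀ ; positive = 0<ε₀ }
      stage (suc k) = next (successor k (stage k))

      v : ℕ → Valuation
      v k = valuation (stage k)

      keeps* : ∀ {k j} → k ≤ℕ j → ∀ {Q : Pred QFSentence⁺ 0ℓ} → All Q (sentences (stage j)) → All Q (sentences (stage k))
      keeps* {k} p = go (ℕ.≤⇒≤′ p)
        where
        go : ∀ {j} → k ℕ.≤′ j → ∀ {Q : Pred QFSentence⁺ 0ℓ} → All Q (sentences (stage j)) → All Q (sentences (stage k))
        go ℕ.≤′-refl h = h
        go {suc j} (ℕ.≤′-step r) h = go r (keeps (successor j (stage j)) h)

      inside-pred : ∀ k {w} → Inside (stage (suc k)) w → Inside (stage k) w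
      inside-pred k h = near-mono (≤-≈-trans (halves (successor k (stage k)) ⊕ ≤-refl) (half+half _))
        (near-trans (near (successor k (stage k))) (keeps (successor k (stage k)) h))

      inside* : ∀ {k j} → k ≤ℕ j → Inside (stage k) (v j)
      inside* {k} {j} p = go (ℕ.≤⇒≤′ p) (near-refl (sentences (stage j)) (positive (stage j)) λ σ → refl)
        where
        go : ∀ {j} → k ℕ.≤′ j → ∀ {w} → Inside (stage j) w → Inside (stage k) w
        go ℕ.≤′-refl h = h
        go {suc j} (ℕ.≤′-step r) h = go r (inside-pred j h)

      point′ : ℕ → Point
      point′ k = proj₁ (point (stage k))

      norm : ClosedTerm → ℕ → ℝ
      norm t k = CStarAlgebra.‖_‖ (proj₁ (point′ k)) (evaluate t (point′ k))

      norm-value : ∀ t k → v k (normOf t) ≈ norm t k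
      norm-value t k = trans (value-distance (point′ k) t zeroₜ) (d-0ʳ (proj₁ (point′ k)) _)

      controlled : ∀ i K {j} → suc i ≤ℕ suc K → suc K ≤ℕ j → ∣ norm (net i) j - norm (net i) (suc K) ∣ < ι K
      controlled i K {j} p q = ≈-<-trans (∣∣-cong (+-cong (sym (norm-value (net i) j)) (-‿cong (sym (norm-value (net i) (suc K))))))
        (<-≤-trans (controls (successor i (stage i)) (keeps* p (inside* q)))
          (small (successor K (stage K))))

      norm-cauchy : ∀ t → IsCauchy (norm t)
      norm-cauchy t ε q =
        let h = half (half ε)
            (n , ιn<) = ι-small h (half-pos (half-pos q))
            (i , close) = proj₂ (countable-term-net {newConstants}) t n
        -- Four quarters of ε: from `t` to `net i` at stage `j`, on to the stage `suc (i ⊔ n)`, then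
        -- to stage `k`, and back to `t`. The stage must be past `i`, for `net i` to be controlled,
        -- and past `n`, for the control to be as fine as `ι n`.
        in suc (i ℕ.⊔ n) , λ {j} {k} r s → fourway q
             (term-close j close ιn<)
             (<-trans (controlled i (i ℕ.⊔ n) (ℕ.s≤s (ℕ.m≤m⊔n i n)) r) (≤-<-trans (ι-anti (ℕ.m≤n⊔m i n)) ιn<))
             (<-trans (controlled i (i ℕ.⊔ n) (ℕ.s≤s (ℕ.m≤m⊔n i n)) s) (≤-<-trans (ι-anti (ℕ.m≤n⊔m i n)) ιn<))
             (term-close k close ιn<)
        where
        term-close : ∀ j {n i h} → (∀ (S : Structure newConstants) → TermClose S n t (net i)) → ι n < h → ∣ norm t j - norm (net i) j ∣ < h
        term-close j close ιn< = ≤-<-trans (∣‖‖-‖‖∣≤d (proj₁ (point′ j)) _ _)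
          (≤-<-trans (close (structure (point′ j)) []) ιn<)
        fourway : ∀ {a b c d e ε} → 0# < ε → ∣ a - b ∣ < half (half ε) → ∣ b - c ∣ < half (half ε) → ∣ d - c ∣ < half (half ε) →
                  ∣ e - d ∣ < half (half ε) → ∣ a - e ∣ < ε
        fourway {a} {b} {c} {d} {e} {ε} _ p q r s = ≤-<-trans (∣∣-triangle a c e)
          (halves< (≤-<-trans (∣∣-triangle a b c) (halves< p q))
            (≤-<-trans (∣∣-triangle c d e) (halves< (∣∣-swap< r) (∣∣-swap< s))))

      open LimitPoint point′ norm-cauchy public using (limitPoint; limitPoint-termDense; value-lim)

      -- Limits preserve only weak inequalities. Strictness comes from the strict bound `near`
      -- between the stages `k` and `suc k`.
      limit-inside : ∀ k → Inside (stage k) (value limitPoint)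
      limit-inside k = All.map
        (λ {σ} (h , g) → ≤-<-trans (∣∣-triangle (value limitPoint σ) (v (suc k) σ) (v k σ))
          (<-≈-trans (≤-trans (limit-close σ g) (halves (successor k (stage k))) ⊕< h) (half+half _)))
        (All.zip (near (successor k (stage k)) , keeps (successor k (stage k)) all-close))
        where
        Close : Pred QFSentence⁺ 0ℓ
        Close σ = ∀ {j} → suc k ≤ℕ j → ∣ v j σ - v (suc k) σ ∣ < radius (stage (suc k))
        all-close : All Close (sentences (stage (suc k)))
        all-close = All.tabulate λ σ∈ {j} q → All.lookup (inside* q) σ∈
        limit-close : ∀ σ → Close σ → ∣ value limitPoint σ - v (suc k) σ ∣ ≤ radius (stage (suc k))
        limit-close σ g = ∣-∣≤
          (lim-≤ (suc k , λ q → ∣-∣≤⇒≤+ (<⇒≤ (g q))) (value-lim σ) lim-const)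
          (lim-≤ (suc k , λ {j} q → ∣-∣≤⇒≤+ (∣∣-swap≤ (<⇒≤ (g q)))) lim-const (lim-+ (value-lim σ) lim-const))

      limit-member : ∀ k → member (O k) (value limitPoint)
      limit-member k = inside (successor k (stage k)) _ (limit-inside (suc k))

    abstract
      baire : (O : ℕ → DenseOpen) (p : ModelPoint) → ∀ σs ε → 0# < ε →
        Σ[ q ∈ Point ] TermDense q × Nearᵛ σs ε (value (proj₁ p)) (value q) × (∀ k → member (O k) (value q))
      baire O p σs ε 0<ε = limitPoint , limitPoint-termDense , limit-inside 0 , limit-member
        where open Baire O p σs ε 0<ε

  -- Constants as names of elements

  Indices : List Sort → Set
  Indices = All (λ _ → ℕ)

  module _ (A : CStarAlgebra) where

    constants : ∀ {Γ} → Interpretation A → Indices Γ → Env A Γ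
    constants a []            = []
    constants a (_∷_ {n} j y) = a n j ∷ constants a y

    constants-lookup : ∀ {Γ n} a (y : Indices Γ) (i : n ∈ Γ) → lookup (constants a y) i ≡ a n (lookup y i)
    constants-lookup a (_ ∷ _) (here ≡.refl) = ≡.refl
    constants-lookup a (_ ∷ y) (there i)     = constants-lookup a y i

    constants-++ : ∀ {Δ Γ} a (y : Indices Δ) (z : Indices Γ) →
                   constants a (++⁺ y z) ≡ ++⁺ (constants a y) (constants a z)
    constants-++ a []      z = ≡.refl
    constants-++ a (_ ∷ y) z = ≡.cong (_ ∷_) (constants-++ a y z)

  instantiateₜ : ∀ {Γ} → Indices Γ → Term ⊥ Γ → ClosedTerm
  instantiateₜ y (var {n} i) = con (n , lookup y i)
  instantiateₜ y zeroₜ       = zeroₜ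
  instantiateₜ y (oneₜ u)    = oneₜ u
  instantiateₜ y (t +ₜ u)    = instantiateₜ y t +ₜ instantiateₜ y u
  instantiateₜ y (t ·ₜ u)    = instantiateₜ y t ·ₜ instantiateₜ y u
  instantiateₜ y (t ⋆ₜ)      = instantiateₜ y t ⋆ₜ
  instantiateₜ y (z *ₜ t)    = z *ₜ instantiateₜ y t

  instantiateᶠ : ∀ {Γ} → Indices Γ → {ψ : LFormula Γ} → QuantifierFree ψ → Formula NewConstant []
  instantiateᶠ y (dist t u)  = dist (instantiateₜ y t) (instantiateₜ y u)
  instantiateᶠ y (conn f qs) = conn f λ i → instantiateᶠ y (qs i)

  instantiate-qf : ∀ {Γ} (y : Indices Γ) {ψ : LFormula Γ} (q : QuantifierFree ψ) → QuantifierFree (instantiateᶠ y q)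
  instantiate-qf y (dist t u)  = dist _ _
  instantiate-qf y (conn f qs) = conn f λ i → instantiate-qf y (qs i)

  instantiate : ∀ {Γ} {ψ : LFormula Γ} → QuantifierFree ψ → Indices Γ → QFSentence⁺
  instantiate q y = instantiateᶠ y q , instantiate-qf y q

  module _ (A : CStarAlgebra) (a : Interpretation A) where

    evaluate-instantiate : ∀ {Γ} (y : Indices Γ) t →
      evaluate (instantiateₜ y t) (A , a) ≡ ⟦ t ⟧ˢ (plain A) (constants A a y)
    evaluate-instantiate y (var i)  = ≡.cong proj₁ (≡.sym (constants-lookup A a y i))
    evaluate-instantiate y zeroₜ    = ≡.refl
    evaluate-instantiate y (oneₜ u) = ≡.refl
    evaluate-instantiate y (t +ₜ u) = ≡.cong₂ (CStarAlgebra._+ᴹ_ A) (evaluate-instantiate y t) (evaluate-instantiate y u)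
    evaluate-instantiate y (t ·ₜ u) = ≡.cong₂ (CStarAlgebra._·_ A) (evaluate-instantiate y t) (evaluate-instantiate y u)
    evaluate-instantiate y (t ⋆ₜ)   = ≡.cong (CStarAlgebra._⋆ A) (evaluate-instantiate y t)
    evaluate-instantiate y (z *ₜ t) = ≡.cong (CStarAlgebra._*ₗ_ A z) (evaluate-instantiate y t)

    value-instantiate : ∀ {Γ} {ψ : LFormula Γ} (q : QuantifierFree ψ) (y : Indices Γ) →
      value (A , a) (instantiate q y) ≈ val (plain A) ψ (constants A a y)
    value-instantiate (dist t u) y = trans (value-distance (A , a) (instantiateₜ y t) (instantiateₜ y u))
      (trans (reflexive (≡.cong₂ (CStarAlgebra.d A) (evaluate-instantiate y t) (evaluate-instantiate y u)))
        (sym (val-dist (plain A) t u (constants A a y))))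
    value-instantiate (conn f {φs} qs) y = trans (val-conn (structure (A , a)) f (λ i → instantiateᶠ y (qs i)) [])
      (trans (continuous-cong (continuous f) λ i → value-instantiate (qs i) y)
        (sym (val-conn (plain A) f φs (constants A a y))))

  termUses : ClosedTerm → List NewConstant
  termUses (con c)  = c ∷ []
  termUses zeroₜ    = []
  termUses (oneₜ u) = []
  termUses (t +ₜ u) = termUses t ++ termUses u
  termUses (t ·ₜ u) = termUses t ++ termUses u
  termUses (t ⋆ₜ)   = termUses t
  termUses (z *ₜ t) = termUses t

  concatFin : ∀ {k} {X : Set} → (Fin k → List X) → List X
  concatFin {zero}  f = []
  concatFin {suc k} f = f fzero ++ concatFin (f ∘ fsuc)

  concatFin⁻ : ∀ {k} {X : Set} {P : Pred X 0ℓ} (f : Fin k → List X) → All P (concatFin f) → ∀ i → All P (f i)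
  concatFin⁻ f h fzero    = ++⁻ˡ (f fzero) h
  concatFin⁻ f h (fsuc i) = concatFin⁻ (f ∘ fsuc) (++⁻ʳ (f fzero) h) i

  qfUses : ∀ {φ : Formula NewConstant []} → QuantifierFree φ → List NewConstant
  qfUses (dist t u)  = termUses t ++ termUses u
  qfUses (conn f qs) = concatFin λ i → qfUses (qs i)

  uses : List QFSentence⁺ → List NewConstant
  uses []             = []
  uses ((_ , q) ∷ σs) = qfUses q ++ uses σs

  -- Freshness is judged by the index alone, across all sorts: no constant with at least this index
  -- occurs in the list.
  indexBound : List NewConstant → ℕ
  indexBound []             = 0
  indexBound ((_ , j) ∷ cs) = suc j ℕ.⊔ indexBound cs

  indicesBound : ∀ {Γ} → Indices Γ → ℕ
  indicesBound []      = 0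
  indicesBound (j ∷ y) = suc j ℕ.⊔ indicesBound y

  module _ (A : CStarAlgebra) where

    AgreeOn : List NewConstant → Interpretation A → Interpretation A → Set
    AgreeOn cs a b = All (λ (n , j) → a n j ≡ b n j) cs

    Agree : ℕ → Interpretation A → Interpretation A → Set
    Agree L a b = ∀ n j → j <ℕ L → a n j ≡ b n j

    agree-≤ : ∀ {K L a b} → K ≤ℕ L → Agree L a b → Agree K a b
    agree-≤ p h n j q = h n j (ℕ.≤-trans q p)

    agree⇒agreeOn : ∀ cs {a b} → Agree (indexBound cs) a b → AgreeOn cs a b
    agree⇒agreeOn []             h = []
    agree⇒agreeOn ((n , j) ∷ cs) h =
      h n j (ℕ.m≤m⊔n (suc j) (indexBound cs)) ∷ agree⇒agreeOn cs (agree-≤ (ℕ.m≤n⊔m (suc j) (indexBound cs)) h)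

    module _ {a b : Interpretation A} where

      evaluate-agree : ∀ t → AgreeOn (termUses t) a b → evaluate t (A , a) ≡ evaluate t (A , b)
      evaluate-agree (con (n , j)) (h ∷ []) = ≡.cong proj₁ h
      evaluate-agree zeroₜ    h = ≡.refl
      evaluate-agree (oneₜ u) h = ≡.refl
      evaluate-agree (t +ₜ u) h = ≡.cong₂ (CStarAlgebra._+ᴹ_ A) (evaluate-agree t (++⁻ˡ _ h)) (evaluate-agree u (++⁻ʳ (termUses t) h))
      evaluate-agree (t ·ₜ u) h = ≡.cong₂ (CStarAlgebra._·_ A) (evaluate-agree t (++⁻ˡ _ h)) (evaluate-agree u (++⁻ʳ (termUses t) h))
      evaluate-agree (t ⋆ₜ)   h = ≡.cong (CStarAlgebra._⋆ A) (evaluate-agree t h)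
      evaluate-agree (z *ₜ t) h = ≡.cong (CStarAlgebra._*ₗ_ A z) (evaluate-agree t h)

      value-agree : ∀ {φ} (q : QuantifierFree φ) → AgreeOn (qfUses q) a b → value (A , a) (φ , q) ≈ value (A , b) (φ , q)
      value-agree (dist t u) h = trans (value-distance (A , a) t u)
        (trans (reflexive (≡.cong₂ (CStarAlgebra.d A) (evaluate-agree t (++⁻ˡ _ h)) (evaluate-agree u (++⁻ʳ (termUses t) h))))
          (sym (value-distance (A , b) t u)))
      value-agree (conn f {φs} qs) h = trans (val-conn (structure (A , a)) f φs [])
        (trans (continuous-cong (continuous f) λ i → value-agree (qs i) (concatFin⁻ (λ i → qfUses (qs i)) h i))
          (sym (val-conn (structure (A , b)) f φs [])))

      values-agree : ∀ σs → AgreeOn (uses σs) a b → All (λ σ → value (A , a) σ ≈ value (A , b) σ) σs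
      values-agree []             h = []
      values-agree ((φ , q) ∷ σs) h = value-agree q (++⁻ˡ _ h) ∷ values-agree σs (++⁻ʳ (qfUses q) h)

      near-agree : ∀ σs {ε} → 0# < ε → AgreeOn (uses σs) a b → Nearᵛ σs ε (value (A , a)) (value (A , b))
      near-agree σs p h = All.map (λ e → ≈-<-trans (∣x-x∣≈0 (sym e)) p) (values-agree σs h)

      constants-agree : ∀ {Γ} (y : Indices Γ) → Agree (indicesBound y) a b → constants A a y ≡ constants A b y
      constants-agree []            h = ≡.refl
      constants-agree (_∷_ {n} j y) h = ≡.cong₂ _∷_ (h n j (ℕ.m≤m⊔n (suc j) (indicesBound y)))
        (constants-agree y (agree-≤ (ℕ.m≤n⊔m (suc j) (indicesBound y)) h))

    assign : Interpretation A → ∀ n → ℕ → Ball A n → Interpretation A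
    assign a n j x n′ j′ with n ℕ.≟ n′ | j ℕ.≟ j′
    ... | yes ≡.refl | yes _ = x
    ... | _          | _     = a n′ j′

    assign-same : ∀ a n j x → assign a n j x n j ≡ x
    assign-same a n j x with n ℕ.≟ n | j ℕ.≟ j
    ... | yes ≡.refl | yes _ = ≡.refl
    ... | no n≢n     | _     = ⊥-elim (n≢n ≡.refl)
    ... | yes ≡.refl | no j≢j = ⊥-elim (j≢j ≡.refl)

    assign-agree : ∀ a n L x → Agree L a (assign a n L x)
    assign-agree a n L x n′ j′ p with n ℕ.≟ n′ | L ℕ.≟ j′
    ... | yes ≡.refl | yes ≡.refl = ⊥-elim (ℕ.<-irrefl ≡.refl p)
    ... | yes ≡.refl | no _       = ≡.refl
    ... | no _       | _          = ≡.refl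

    -- Successive elements get the indices L, L + 1, ... whatever their sorts, so a later assignment
    -- never overwrites an earlier one.
    extend : ∀ {Δ} (τ : Env A Δ) L a → Σ[ b ∈ Interpretation A ] Agree L a b × Σ[ y ∈ Indices Δ ] constants A b y ≡ τ
    extend []                  L a = a , (λ _ _ _ → ≡.refl) , [] , ≡.refl
    extend {n ∷ Δ} (x ∷ τ) L a =
      let (b , agree , y , p) = extend τ (suc L) (assign a n L x)
      in b , (λ n′ j q → ≡.trans (assign-agree a n L x n′ j q) (agree n′ j (ℕ.m<n⇒m<1+n q))) ,
         L ∷ y , ≡.cong₂ _∷_ (≡.trans (≡.sym (agree n L (ℕ.n<1+n L))) (assign-same a n L x)) p

  module _ (A : CStarAlgebra) where
    open CStarAlgebra A using (d)

    dᴱ-++ : ∀ {Δ Γ} (τ : Env A Δ) (ρ ρ′ : Env A Γ) {n} → dᴱ A ρ ρ′ ≤ ι n → dᴱ A (++⁺ τ ρ) (++⁺ τ ρ′) ≤ ι n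
    dᴱ-++ []                  ρ ρ′ p = p
    dᴱ-++ {n ∷ Δ} (x ∷ τ) ρ ρ′ p = cons-close A {n} x (++⁺ τ ρ) (++⁺ τ ρ′) (dᴱ-++ τ ρ ρ′ p)

    dᴱ-++ˡ : ∀ {Δ Γ} (τ τ′ : Env A Δ) (ρ : Env A Γ) {n} → dᴱ A τ τ′ ≤ ι n → dᴱ A (++⁺ τ ρ) (++⁺ τ′ ρ) ≤ ι n
    dᴱ-++ˡ [] [] [] {n} p = p
    dᴱ-++ˡ {Γ = n ∷ Γ} [] [] (x ∷ ρ) {k} p = cons-close A {n} x ρ ρ (dᴱ-++ˡ [] [] ρ p)
    dᴱ-++ˡ ((_ , _) ∷ τ) ((_ , _) ∷ τ′) ρ p = max-lub (≤-trans ≤-max₁ p) (dᴱ-++ˡ τ τ′ ρ (≤-trans ≤-max₂ p))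

    approximate-constants : ∀ a → SortwiseDense A a → ∀ {Γ} (ρ : Env A Γ) ε → 0# < ε →
                            Σ[ y ∈ Indices Γ ] dᴱ A ρ (constants A a y) < ε
    approximate-constants a dense []            ε p = [] , p
    approximate-constants a dense {n ∷ Γ} ((x , b) ∷ ρ) ε p =
      let (j , q) = dense n (x , b) ε p
          (y , r) = approximate-constants a dense ρ ε p
      in j ∷ y , max-lub< q r

    inf-≥ : ∀ {i} {I : Set i} {f : I → ℝ} {m b} → IsInf f m → (∀ i → b ≤ f i) → b ≤ m
    inf-≥ (_ , approx) h = ≤-approx λ ε p → let (i , q) = approx ε p in ≤-trans (h i) (<⇒≤ q)

    val-⨅* : ∀ Δ {Γ} (ψ : LFormula (Δ ++ Γ)) ρ →
      IsInf (λ (τ : Env A Δ) → val (plain A) ψ (++⁺ τ ρ)) (val (plain A) (⨅* Δ ψ) ρ)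
    val-⨅* []      ψ ρ = (λ { [] → ≤-refl }) , λ ε p → [] , x<x+y p
    val-⨅* (n ∷ Δ) ψ ρ =
      let (lower , approx) = val-⨅* Δ (⨅ n ψ) ρ in
      (λ { (x ∷ τ) → ≤-trans (lower τ) (proj₁ (val-⨅ (plain A) ψ (++⁺ τ ρ)) x) }) ,
      λ ε p → let (τ , q) = approx (half ε) (half-pos p)
                  (x , r) = proj₂ (val-⨅ (plain A) ψ (++⁺ τ ρ)) (half ε) (half-pos p)
              in x ∷ τ , <-trans r (<-≈-trans
                   (linear< q (solve 3 (λ m v h → (m :+ h :+ h) :+ v := (v :+ h) :+ (m :+ h)) refl _ _ (half ε)))
                   (trans (+-assoc _ _ _) (+-congˡ (half+half ε))))

    0≤val-⨅* : ∀ Δ {Γ} {ψ : LFormula (Δ ++ Γ)} → Nonnegative ψ → ∀ ρ → 0# ≤ val (plain A) (⨅* Δ ψ) ρ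
    0≤val-⨅* Δ {ψ = ψ} nonneg ρ = inf-≥ (val-⨅* Δ ψ ρ) λ τ → nonneg A (++⁺ τ ρ) _ (val⇒lvalue ψ refl)

    closure≈0⇐ : ∀ {Γ} (φ : LFormula Γ) → (∀ ρ → val (plain A) φ ρ ≈ 0#) → val (plain A) (⨆-closure φ) [] ≈ 0#
    closure≈0⇐ {[]}    φ h = h []
    closure≈0⇐ {n ∷ Γ} φ h = closure≈0⇐ (⨆ n φ) λ ρ →
      let (lower , approx) = val-⨆ (plain A) φ ρ
          -m≈0 = inf-unique (lower , approx) ((λ x → ≤-reflexive (sym (neg0 (h (x ∷ ρ))))) ,
                   λ ε p → zeroBall A n , ≈-<-trans (neg0 (h (zeroBall A n ∷ ρ))) (x<x+y p))
      in trans (solve 1 (λ x → x := :- :- x) refl _) (neg0 -m≈0)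
      where
      neg0 : ∀ {x} → x ≈ 0# → - x ≈ 0#
      neg0 p = trans (-‿cong p) (solve 0 (:- con (0 , 0) := con (0 , 0)) refl)

    closure≈0⇒ : ∀ {Γ} (φ : LFormula Γ) → (∀ ρ → 0# ≤ val (plain A) φ ρ) →
                 val (plain A) (⨆-closure φ) [] ≈ 0# → ∀ ρ → val (plain A) φ ρ ≈ 0#
    closure≈0⇒ {[]}    φ 0≤φ h []      = h
    closure≈0⇒ {n ∷ Γ} φ 0≤φ h (x ∷ ρ) = ≤-antisym
      (≤-≈-trans (φ≤⨆ x) (closure≈0⇒ (⨆ n φ) (λ ρ → ≤-trans (0≤φ (zeroBall A n ∷ ρ)) (φ≤⨆ (zeroBall A n))) h ρ))
      (0≤φ (x ∷ ρ))
      where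
      φ≤⨆ : ∀ {ρ} x → val (plain A) φ (x ∷ ρ) ≤ val (plain A) (⨆ n φ) ρ
      φ≤⨆ {ρ} x = linear (proj₁ (val-⨆ (plain A) φ ρ) x)
        (solve 2 (λ s f → s :+ :- s := f :+ :- f) refl _ _)

  -- Uniqueness of the determined model

  sortwiseDense⇒termDense : ∀ A a → SortwiseDense A a → TermDense (A , a)
  sortwiseDense⇒termDense A a dense x ε p =
    let (n , x<n) = archimedean (CStarAlgebra.‖_‖ A x)
        (j , q) = dense n (x , <⇒≤ x<n) ε p
    in con (n , j) , <⇒≤ q

  SameValues : Point → Point → Set
  SameValues p q = ∀ σ → value p σ ≈ value q σ

  -- The graph of the isomorphism: x ~ y when the same closed terms approximate x
  -- and y.
  module Correspondence (p q : Point) (same : SameValues p q) where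

    private
      A B : CStarAlgebra
      A = proj₁ p
      B = proj₁ q
      module A = CStarAlgebra A
      module B = CStarAlgebra B

    infix 4 _~_
    _~_ : A.Carrier → B.Carrier → Set
    x ~ y = ∀ ε → 0# < ε → ∃[ t ] A.d x (evaluate t p) ≤ ε × B.d y (evaluate t q) ≤ ε

    same-distance : ∀ t u → A.d (evaluate t p) (evaluate u p) ≈ B.d (evaluate t q) (evaluate u q)
    same-distance t u = trans (sym (value-distance p t u)) (trans (same (distance t u)) (value-distance q t u))

    ~-term : ∀ t → evaluate t p ~ evaluate t q
    ~-term t ε r = t , ≈-≤-trans (≈ᴹ⇒d≈0 A (≈ᴹ-refl A)) (<⇒≤ r) ,
                       ≈-≤-trans (≈ᴹ⇒d≈0 B (≈ᴹ-refl B)) (<⇒≤ r)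

    -- This inequality makes the relation functional; together with its mirror image, with the two
    -- points exchanged, it makes the correspondence isometric.
    ~-d : ∀ {x x′ y y′} → x ~ y → x′ ~ y′ → B.d y y′ ≤ A.d x x′
    ~-d {x} {x′} {y} {y′} x~y x′~y′ = ≤-approx λ ε r →
      let h = half (half ε)
          0<h = half-pos (half-pos r)
          (t , xt , yt) = x~y h 0<h
          (u , xu , yu) = x′~y′ h 0<h
      in ≤-trans (d-triangle B y (evaluate t q) y′) (≤-trans
        (yt ⊕ ≤-trans (d-triangle B (evaluate t q) (evaluate u q) y′)
          (≤-reflexive (sym (same-distance t u)) ⊕ ≈-≤-trans (d-sym B _ _) yu))
        (≤-≈-trans (≤-refl ⊕ (≤-trans (d-triangle A (evaluate t p) x (evaluate u p))
            (≈-≤-trans (d-sym A _ _) xt ⊕ ≤-trans (d-triangle A x x′ (evaluate u p)) (≤-refl ⊕ xu)) ⊕ ≤-refl))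
          (trans (solve 2 (λ h d → h :+ ((h :+ (d :+ h)) :+ h) := d :+ ((h :+ h) :+ (h :+ h))) refl h (A.d x x′))
            (+-congˡ (trans (+-cong (half+half (half ε)) (half+half (half ε))) (half+half ε))))))

    ~-functional : ∀ {x x′ y y′} → x ~ y → x′ ~ y′ → x A.≈ᴹ x′ → y B.≈ᴹ y′
    ~-functional r s x≈x′ = d≤0⇒≈ᴹ B (≤-≈-trans (~-d r s) (≈ᴹ⇒d≈0 A x≈x′))

    ~-+ : ∀ {x x′ y y′} → x ~ y → x′ ~ y′ → x A.+ᴹ x′ ~ y B.+ᴹ y′
    ~-+ x~y x′~y′ ε r =
      let (t , xt , yt) = x~y (half ε) (half-pos r)
          (u , xu , yu) = x′~y′ (half ε) (half-pos r)
      in t +ₜ u , ≤-trans (d-+ᴹ A _ _ _ _) (≤-≈-trans (xt ⊕ xu) (half+half ε)) ,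
                  ≤-trans (d-+ᴹ B _ _ _ _) (≤-≈-trans (yt ⊕ yu) (half+half ε))

    private
      -- As δ ≤ 1, the norm of `t′` is at most ‖x′‖ + 1, so the factor depends on `x` and `x′` only
      -- and can be fixed before the terms are chosen.
      product-close : ∀ C {x x′ t t′ K L δ} → let open CStarAlgebra C in
        ‖ x ‖ ≤ fromℕ K → ‖ x′ ‖ + 1# ≤ fromℕ L → 0# ≤ δ → δ ≤ 1# → d x t ≤ δ → d x′ t′ ≤ δ →
        d (x · x′) (t · t′) ≤ fromℕ (K ℕ.+ L) * δ
      product-close C {x} {x′} {t} {t′} {K} {L} {δ} bx bx′ 0≤δ δ≤1 xt xt′ = ≤-trans (d-· C x x′ t t′) (≤-≈-trans
        (*-mono (‖‖-nonneg x) 0≤δ bx xt′ ⊕ *-mono (0≤d C x t) (0≤fromℕ L) xt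
          (≤-trans (‖‖≤‖‖+d C t′ x′) (≤-trans (≤-refl ⊕ ≈-≤-trans (d-sym C t′ x′) (≤-trans xt′ δ≤1)) bx′)))
        (trans (solve 3 (λ k l d → k :* d :+ d :* l := (k :+ l) :* d) refl (fromℕ K) (fromℕ L) δ)
          (*-congʳ (sym (fromℕ-+ K L)))))
        where open CStarAlgebra C

    ~-· : ∀ {x x′ y y′} → x ~ y → x′ ~ y′ → x A.· x′ ~ y B.· y′
    ~-· {x} {x′} {y} {y′} x~y x′~y′ ε r =
      let (K , bx) = archimedean A.‖ x ‖
          (L , bx′) = archimedean (A.‖ x′ ‖ + 1#)
          (K′ , by) = archimedean B.‖ y ‖
          (L′ , by′) = archimedean (B.‖ y′ ‖ + 1#)
          (δ₁ , 0<δ₁ , h) = shrink ((K ℕ.+ L) ℕ.+ (K′ ℕ.+ L′)) ε r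
          (δ , 0<δ , δ≤1 , δ≤δ₁) = positive-minimum 0<1 0<δ₁
          (t , xt , yt) = x~y δ 0<δ
          (u , xu , yu) = x′~y′ δ 0<δ
          finish = λ {M} (q : M ≤ℕ (K ℕ.+ L) ℕ.+ (K′ ℕ.+ L′)) →
            ≤-trans (*-mono (0≤fromℕ M) (<⇒≤ 0<δ₁) (fromℕ-mono q) δ≤δ₁) h
      in t ·ₜ u ,
         ≤-trans (product-close A {K = K} {L} (<⇒≤ bx) (<⇒≤ bx′) (<⇒≤ 0<δ) δ≤1 xt xu) (finish (ℕ.m≤m+n (K ℕ.+ L) (K′ ℕ.+ L′))) ,
         ≤-trans (product-close B {K = K′} {L′} (<⇒≤ by) (<⇒≤ by′) (<⇒≤ 0<δ) δ≤1 yt yu) (finish (ℕ.m≤n+m (K′ ℕ.+ L′) (K ℕ.+ L)))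

    ~-⋆ : ∀ {x y} → x ~ y → x A.⋆ ~ y B.⋆
    ~-⋆ x~y ε r = let (t , xt , yt) = x~y ε r in
      t ⋆ₜ , ≈-≤-trans (d-⋆ A _ _) xt , ≈-≤-trans (d-⋆ B _ _) yt

    ~-*ₗ : ∀ z {x y} → x ~ y → z A.*ₗ x ~ z B.*ₗ y
    ~-*ₗ z x~y ε r =
      let (δ , 0<δ , h) = shrink (scalarBound {newConstants} z) ε r
          (t , xt , yt) = x~y δ 0<δ
          finish = λ {e} (0≤e : 0# ≤ e) (q : e ≤ δ) →
            ≤-trans (*-mono (0≤∣∣₁ z) (<⇒≤ 0<δ) (∣∣₁≤scalarBound {newConstants} z) q) h
      in z *ₜ t , ≤-trans (d-*ₗ A z _ _) (finish (0≤d A _ _) xt) , ≤-trans (d-*ₗ B z _ _) (finish (0≤d B _ _) yt)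

    module _ (dense : TermDense p) where

      abstract
        -- Terms approximating `x` have the same mutual distances in both algebras, so their values
        -- in the second one form a Cauchy sequence there.
        partner : ∀ x → ∃[ y ] x ~ y
        partner x = proj₁ limit , λ ε r →
          let (M , h) = proj₂ limit ε r
              (k , ιk<ε) = ι-small ε r
          in t (k ℕ.⊔ M) ,
             ≤-trans (t-near (k ℕ.⊔ M)) (≤-trans (ι-anti (ℕ.m≤m⊔n k M)) (<⇒≤ ιk<ε)) ,
             ≈-≤-trans (d-sym B _ _) (<⇒≤ (h (ℕ.m≤n⊔m k M)))
          where
          t : ℕ → ClosedTerm
          t k = proj₁ (dense x (ι k) (0<ι k))
          t-near : ∀ k → A.d x (evaluate (t k) p) ≤ ι k
          t-near k = proj₂ (dense x (ι k) (0<ι k))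
          limit : ∃[ y ] ∀ ε → 0# < ε → ∃[ K ] ∀ {j} → K ≤ℕ j → B.d (evaluate (t j) q) y < ε
          limit = B.isComplete (λ k → evaluate (t k) q) λ ε r →
            let (K , ιK<) = ι-small (half ε) (half-pos r) in
            K , λ {j} {k} u v → ≈-<-trans (sym (same-distance (t j) (t k)))
              (≤-<-trans (d-triangle A (evaluate (t j) p) x (evaluate (t k) p))
              (halves< (≈-<-trans (d-sym A _ x) (≤-<-trans (t-near j) (≤-<-trans (ι-anti u) ιK<)))
                (≤-<-trans (t-near k) (≤-<-trans (ι-anti v) ιK<))))

  module _ (p q : Point) (same : SameValues p q) (dense-p : TermDense p) (dense-q : TermDense q) where
    private
      module F = Correspondence p q same
      module G = Correspondence q p (λ σ → sym (same σ))
      module A = CStarAlgebra (proj₁ p)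
      module B = CStarAlgebra (proj₁ q)
      open F using (_~_)
      f : A.Carrier → B.Carrier
      f x = proj₁ (F.partner dense-p x)
      f-~ : ∀ x → x ~ f x
      f-~ x = proj₂ (F.partner dense-p x)
      g : B.Carrier → A.Carrier
      g y = proj₁ (G.partner dense-q y)
      flip~ : ∀ {x y} → G._~_ y x → x ~ y
      flip~ h ε r = let (t , u , v) = h ε r in t , v , u
      unflip~ : ∀ {x y} → x ~ y → G._~_ y x
      unflip~ h ε r = let (t , u , v) = h ε r in t , v , u
      g-~ : ∀ y → g y ~ y
      g-~ y = flip~ (proj₂ (G.partner dense-q y))

    same-values⇒≅ : Σ[ h ∈ proj₁ p ≅ proj₁ q ] ∀ n j → _≅_.to h (proj₁ (proj₂ p n j)) B.≈ᴹ proj₁ (proj₂ q n j)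
    same-values⇒≅ = record
      { to        = f
      ; from      = g
      ; to-cong   = λ {x} {x′} r → F.~-functional (f-~ x) (f-~ x′) r
      ; from-cong = λ {y} {y′} r → G.~-functional (unflip~ (g-~ y)) (unflip~ (g-~ y′)) r
      ; to-from   = λ y → F.~-functional (f-~ (g y)) (g-~ y) (≈ᴹ-refl (proj₁ p))
      ; from-to   = λ x → G.~-functional (unflip~ (g-~ (f x))) (unflip~ (f-~ x)) (≈ᴹ-refl (proj₁ q))
      ; +ᴹ-homo   = λ x y → F.~-functional (f-~ _) (F.~-+ (f-~ x) (f-~ y)) (≈ᴹ-refl (proj₁ p))
      ; ·-homo    = λ x y → F.~-functional (f-~ _) (F.~-· (f-~ x) (f-~ y)) (≈ᴹ-refl (proj₁ p))
      ; *ₗ-homo   = λ z x → F.~-functional (f-~ _) (F.~-*ₗ z (f-~ x)) (≈ᴹ-refl (proj₁ p))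
      ; ⋆-homo    = λ x → F.~-functional (f-~ _) (F.~-⋆ (f-~ x)) (≈ᴹ-refl (proj₁ p))
      ; one-homo  = λ u → F.~-functional (f-~ _) (F.~-term (oneₜ u)) (≈ᴹ-refl (proj₁ p))
      ; isometric = λ x → trans (sym (d-0ʳ (proj₁ q) (f x))) (trans (≤-antisym
          (F.~-d (f-~ x) (F.~-term zeroₜ)) (G.~-d (unflip~ (f-~ x)) (unflip~ (F.~-term zeroₜ)))) (d-0ʳ (proj₁ p) x))
      } , λ n j → F.~-functional (f-~ _) (F.~-term (con (n , j))) (≈ᴹ-refl (proj₁ p))

  -- Dense open conditions

  BasicOpen : Pred Valuation 0ℓ → Set
  BasicOpen O = ∀ v → O v → ∃[ σs ] ∃[ ε ] 0# < ε × (∀ w → Nearᵛ σs ε v w → O w)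

  open-< : ∀ σ c → BasicOpen (λ v → v σ < c)
  open-< σ c v p = σ ∷ [] , c - v σ , <⇒0<- p , λ { w (q ∷ []) →
    <-≈-trans (∣-∣<⇒<+ q) (x+[y-x]≈y (v σ) c) }

  open-> : ∀ σ c → BasicOpen (λ v → c < v σ)
  open-> σ c v p = σ ∷ [] , v σ - c , <⇒0<- p , λ { w (q ∷ []) →
    linear< (∣-∣<⇒<+ (∣∣-swap< q))
      (solve 3 (λ v c w → w :+ v := c :+ (w :+ (v :- c))) refl (v σ) c (w σ)) }

  open-∃ : ∀ {I : Set} {O : I → Pred Valuation 0ℓ} → (∀ i → BasicOpen (O i)) → BasicOpen (λ v → ∃[ i ] O i v)
  open-∃ h v (i , p) = let (σs , ε , 0<ε , f) = h i v p in σs , ε , 0<ε , λ w q → i , f w q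

  open-⊎ : ∀ {O O′ : Pred Valuation 0ℓ} → BasicOpen O → BasicOpen O′ → BasicOpen (λ v → O v ⊎ O′ v)
  open-⊎ h h′ v (inj₁ p) = let (σs , ε , 0<ε , f) = h v p in σs , ε , 0<ε , λ w q → inj₁ (f w q)
  open-⊎ h h′ v (inj₂ p) = let (σs , ε , 0<ε , f) = h′ v p in σs , ε , 0<ε , λ w q → inj₂ (f w q)

  module _ {𝒯 : Theory} where

    basic : (O : Pred Valuation 0ℓ) → BasicOpen O →
            ((p : ModelPoint 𝒯) → ∀ σs ε → 0# < ε →
             Σ[ q ∈ ModelPoint 𝒯 ] O (value (proj₁ q)) × Nearᵛ σs ε (value (proj₁ p)) (value (proj₁ q))) →
            DenseOpen 𝒯
    basic O isOpen dense = record
      { member = λ v → Lift (lsuc 0ℓ) (O v)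
      ; isOpen = λ { v (lift p) → let (σs , ε , 0<ε , f) = isOpen v p in σs , ε , 0<ε , λ w q → lift (f w q) }
      ; dense  = λ p σs ε 0<ε → let (q , Oq , near) = dense p σs ε 0<ε in q , lift Oq , near
      }

  -- The constants naming τ have fresh indices, hence do not occur in σs or ρ.
  name-elements : ∀ A a {Γ Δ} {ψ : LFormula (Δ ++ Γ)} (q : QuantifierFree ψ) (ρ : Indices Γ) (τ : Env A Δ) σs {ε} → 0# < ε →
    Σ[ b ∈ Interpretation A ] Nearᵛ σs ε (value (A , a)) (value (A , b)) ×
      Σ[ y ∈ Indices Δ ] value (A , b) (instantiate q (++⁺ y ρ)) ≈ val (plain A) ψ (++⁺ τ (constants A a ρ))
  name-elements A a {ψ = ψ} q ρ τ σs 0<ε =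
    let L = indexBound (uses σs)
        K = indicesBound ρ
        (b , agree , y , y≡τ) = extend A τ (L ℕ.⊔ K) a
    in b , near-agree A σs 0<ε (agree⇒agreeOn A (uses σs) (agree-≤ A (ℕ.m≤m⊔n L K) agree)) ,
       y , trans (value-instantiate A b q (++⁺ y ρ)) (reflexive (≡.cong (val (plain A) ψ)
         (≡.trans (constants-++ A b y ρ) (≡.cong₂ ++⁺ y≡τ
           (≡.sym (constants-agree A ρ (agree-≤ A (ℕ.m≤n⊔m L K) agree)))))))

  module _ (A : CStarAlgebra) where
    open CStarAlgebra A hiding (Carrier; Ball)

    -- Scale by n / (n + δ).
    shrink-into-ball : ∀ n {δ} → 0# < δ → ∀ x → ‖ x ‖ ≤ fromℕ n + δ → Σ[ y ∈ Ball A n ] d x (proj₁ y) ≤ δ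
    shrink-into-ball n {δ} 0<δ x x≤ =
      let (r , 0<r , sr≈1) = reciprocal (fromℕ n + δ) (<-≤-trans 0<δ (≤-≈-trans (x≤x+y (0≤fromℕ n)) (+-comm _ _)))
          λ′ = fromℕ n * r
          0≤λ = *-nonneg (0≤fromℕ n) (<⇒≤ 0<r)
          1-λ = ∣∣-nonneg {δ * r} (*-nonneg (<⇒≤ 0<δ) (<⇒≤ 0<r))
      in ((λ′ , 0#) *ₗ x , ≈-≤-trans (‖‖-homogeneous (λ′ , 0#) x (isModulus-re λ′))
           (≤-≈-trans (*-mono (0≤∣∣ λ′) (≤-trans (‖‖-nonneg x) x≤) (≤-reflexive (∣∣-nonneg 0≤λ)) x≤)
             (trans (solve 3 (λ n r s → n :* r :* s := n :* (s :* r)) refl (fromℕ n) r (fromℕ n + δ))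
               (trans (*-congˡ sr≈1) (*-identityʳ _))))) ,
         ≈-≤-trans (d-cong A (≈ᴹ-sym A (*ₗ-identityˡ A x)) (≈ᴹ-refl A))
           (≤-trans (d-*ₗˡ A 1ᶜ (λ′ , 0#) x)
           (≤-≈-trans (*-monoʳ (0≤∣∣₁ (1ᶜ ℂ.- (λ′ , 0#))) x≤)
             (trans (*-congʳ (trans (+-cong
               (trans (∣∣-cong (trans (+-congʳ (sym sr≈1)) (solve 3 (λ n d r → (n :+ d) :* r :- n :* r := d :* r) refl (fromℕ n) δ r))) 1-λ)
               (∣∣-0 (-‿inverseʳ 0#))) (+-identityʳ _)))
               (trans (solve 3 (λ d r s → d :* r :* s := d :* (s :* r)) refl δ r (fromℕ n + δ))
                 (trans (*-congˡ sr≈1) (*-identityʳ δ))))))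

  closedNet : ℕ → ClosedTerm
  closedNet = proj₁ (countable-term-net {newConstants})

  module _ (𝒯 : Theory) where

    -- A term approximating an element of the n-ball may itself lie slightly outside. So either `e`
    -- is too large to be within `ι m` of the ball, or a constant of sort `n` is near it. Both
    -- alternatives are open; between them, `shrink-into-ball` moves `e` into the ball at cost
    -- `ι m`, and the doubled bound makes this strict.
    densityRequirement : ℕ × ℕ × ℕ → DenseOpen 𝒯
    densityRequirement (i , n , m) = basic
      (λ v → fromℕ n + ι m < v (distance e zeroₜ) ⊎ (∃[ j ] v (distance e (con (n , j))) < ι m + ι m))
      (open-⊎ (open-> (distance e zeroₜ) _) (open-∃ λ j → open-< (distance e (con (n , j))) _))
      dense
      where
      e : ClosedTerm
      e = closedNet i
      dense : (p : ModelPoint 𝒯) → ∀ σs ε → 0# < ε → Σ[ q ∈ ModelPoint 𝒯 ]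
        (fromℕ n + ι m < value (proj₁ q) (distance e zeroₜ) ⊎ (∃[ j ] value (proj₁ q) (distance e (con (n , j))) < ι m + ι m)) ×
        Nearᵛ σs ε (value (proj₁ p)) (value (proj₁ q))
      dense p@((A , a) , A⊨) σs ε 0<ε = cases (≤⊎> (value (A , a) (distance e zeroₜ)) (fromℕ n + ι m))
        (λ small →
          let (x , near) = shrink-into-ball A n (0<ι m) (evaluate e (A , a))
                (≈-≤-trans (sym (trans (value-distance (A , a) e zeroₜ) (d-0ʳ A _))) small)
              -- `distance e zeroₜ` is listed so that `L` is fresh for `e` too, whose value must
              -- survive the assignment.
              L = indexBound (uses (distance e zeroₜ ∷ σs))
              b = assign A a n L x
              agree = agree⇒agreeOn A (uses (distance e zeroₜ ∷ σs)) (assign-agree A a n L x)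
          in ((A , b) , A⊨) ,
             inj₂ (L , ≈-<-trans (trans (value-distance (A , b) e (con (n , L)))
                 (reflexive (≡.cong₂ (CStarAlgebra.d A) (≡.sym (evaluate-agree A e (++⁻ˡ (termUses e) (++⁻ˡ (termUses e ++ []) agree))))
                   (≡.cong proj₁ (assign-same A a n L x)))))
               (≤-<-trans near (x<x+y (0<ι m)))) ,
             near-agree A σs 0<ε (++⁻ʳ (termUses e ++ []) agree))
        (λ large → p , inj₁ large , near-refl σs 0<ε λ σ → refl)

    densityRequirement-correct : ∀ A a → TermDense (A , a) →
      (∀ k → DenseOpen.member (densityRequirement k) (value (A , a))) → SortwiseDense A a
    densityRequirement-correct A a dense h n (x , x≤n) ε 0<ε =
      let (m , ιm<) = ι-small (half (half ε)) (half-pos (half-pos 0<ε))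
          (t , xt) = dense x (half (ι m)) (half-pos (0<ι m))
          (m′ , ιm′<) = ι-small (half (ι m)) (half-pos (0<ι m))
          (i , close) = proj₂ (countable-term-net {newConstants}) t m′
          xe = ≤-trans (d-triangle A x (evaluate t (A , a)) (evaluate (closedNet i) (A , a)))
                 (≤-≈-trans (xt ⊕ ≤-trans (close (structure (A , a)) []) (<⇒≤ ιm′<)) (half+half (ι m)))
      in pick xe ιm< (lower (h (i , n , m)))
      where
      pick : ∀ {m i} → CStarAlgebra.d A x (evaluate (closedNet i) (A , a)) ≤ ι m → ι m < half (half ε) →
             fromℕ n + ι m < value (A , a) (distance (closedNet i) zeroₜ) ⊎
             (∃[ j ] value (A , a) (distance (closedNet i) (con (n , j))) < ι m + ι m) →
             ∃[ j ] CStarAlgebra.d A x (proj₁ (a n j)) < ε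
      pick {m} {i} xe ιm< (inj₁ large) = ⊥-elim (<⇒≱ large (≈-≤-trans (trans (value-distance (A , a) (closedNet i) zeroₜ) (d-0ʳ A _))
        (≤-trans (‖‖≤‖‖+d A _ x) (x≤n ⊕ ≈-≤-trans (d-sym A _ x) xe))))
      pick {m} {i} xe ιm< (inj₂ (j , near)) = j , ≤-<-trans (d-triangle A x (evaluate (closedNet i) (A , a)) (proj₁ (a n j)))
        (<-trans (xe ⊕< ≈-<-trans (sym (value-distance (A , a) (closedNet i) (con (n , j)))) near)
          (halves< (<-trans ιm< (half< (half-pos 0<ε))) (halves< ιm< ιm<)))

    module _ {φ : LSentence} (Γ Δ : List Sort) {ψ : LFormula (Δ ++ Γ)} (q : QuantifierFree ψ)
             (nonneg : Nonnegative ψ) (φ≡ : φ ≡ ⨆-closure (⨅* {Γ = Γ} Δ ψ)) where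

      -- The universal variables are instantiated by constants and the existential ones have to be
      -- witnessed by constants up to `ι m`. If the constants are dense, uniform continuity of ψ
      -- extends this to all tuples.
      axiomRequirement : (∀ A → A ⊨ 𝒯 → val (plain A) φ [] ≈ 0#) → Indices Γ × ℕ → DenseOpen 𝒯
      axiomRequirement holds (ρ , m) = basic
        (λ v → ∃[ y ] v (instantiate q (++⁺ {xs = Δ} y ρ)) < ι m)
        (open-∃ λ y → open-< (instantiate q (++⁺ y ρ)) (ι m))
        λ ((A , a) , A⊨) σs ε 0<ε →
          let val≈0 = closure≈0⇒ A (⨅* Δ ψ) (0≤val-⨅* A Δ nonneg)
                (≡.subst (λ φ → val (plain A) φ [] ≈ 0#) φ≡ (holds A A⊨)) (constants A a ρ)
              (τ , small) = proj₂ (val-⨅* A Δ ψ (constants A a ρ)) (ι m) (0<ι m)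
              (b , near , y , e) = name-elements A a q ρ τ σs 0<ε
          in ((A , b) , A⊨) ,
             (y , ≈-<-trans e (<-≈-trans small (trans (+-congʳ val≈0) (+-identityˡ _)))) ,
             near

      axiomRequirement-correct : ∀ holds A a → SortwiseDense A a →
        (∀ k → DenseOpen.member (axiomRequirement holds k) (value (A , a))) → val (plain A) φ [] ≈ 0#
      axiomRequirement-correct holds A a dense h =
        ≡.subst (λ φ → val (plain A) φ [] ≈ 0#) (≡.sym φ≡) (closure≈0⇐ A (⨅* Δ ψ) λ ρ →
          ≤-antisym (≤-approx λ ε 0<ε →
            let (n , ιn<) = ι-small (half ε) (half-pos 0<ε)
                (m , uniform) = formula-uniform {logicSignature} ψ n
                (ρ′ , near) = approximate-constants A a dense ρ (ι m) (0<ι m)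
                (y , small) = lower (h (ρ′ , n))
            in ≤-trans (proj₁ (val-⨅* A Δ ψ ρ) (constants A a y)) (≤-trans
                 (∣-∣≤⇒≤+ (uniform (plain A) (++⁺ (constants A a y) ρ) (++⁺ (constants A a y) (constants A a ρ′))
                   (dᴱ-++ A (constants A a y) ρ (constants A a ρ′) (<⇒≤ near))))
                 (≤-trans (≈-≤-trans (sym (trans (value-instantiate A a q (++⁺ y ρ′))
                     (reflexive (≡.cong (val (plain A) ψ) (constants-++ A a y ρ′))))) (<⇒≤ small)
                   ⊕ <⇒≤ ιn<)
                 (≤-≈-trans (<⇒≤ ιn< ⊕ ≤-refl) (trans (half+half ε) (sym (+-identityˡ ε)))))))
            (0≤val-⨅* A Δ nonneg ρ))

  -- Continuity of the values of sentences at generic points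

  module GenericContinuity (𝒯 : Theory) where
    open DenseOpen

    Good : Pred Point 0ℓ
    Good (A , a) = A ⊨ 𝒯 × SortwiseDense A a

    InAll : (ℕ → DenseOpen 𝒯) → Pred Point (lsuc 0ℓ)
    InAll Q p = ∀ k → member (Q k) (value p)

    ContinuousOn : (ℕ → DenseOpen 𝒯) → (Point → ℝ) → Set₁
    ContinuousOn Q F = ∀ p → Good p → InAll Q p → ∀ ε → 0# < ε →
      ∃[ σs ] ∃[ δ ] 0# < δ × (∀ p′ → Good p′ → InAll Q p′ → Nearᵛ σs δ (value p) (value p′) → ∣ F p′ - F p ∣ < ε)

    GenericallyContinuous : (Point → ℝ) → Set₂
    GenericallyContinuous F = Σ[ Q ∈ (ℕ → DenseOpen 𝒯) ] ContinuousOn Q F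

    everything : DenseOpen 𝒯
    everything = basic (λ _ → ⊤) (λ v _ → [] , 1# , 0<1 , λ _ _ → tt) λ p σs ε 0<ε → p , tt , near-refl σs 0<ε λ σ → refl

    flatten : ∀ {x} {X : Set x} → (ℕ → ℕ → X) → ℕ → X
    flatten Q n = Q (proj₁ (unpair n)) (proj₂ (unpair n))

    inAll-flatten : ∀ Q {p} → InAll (flatten Q) p → ∀ i → InAll (Q i) p
    inAll-flatten Q {p} h i j = let (n , e) = unpair-surjective i j in
      ≡.subst (λ ij → member (Q (proj₁ ij) (proj₂ ij)) (value p)) e (h n)

    nth : ∀ {x k} {X : Set x} → X → (Fin k → X) → ℕ → X
    nth {k = zero}  x f i       = x
    nth {k = suc k} x f zero    = f fzero
    nth {k = suc k} x f (suc i) = nth x (f ∘ fsuc) i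

    nth-toℕ : ∀ {x k} {X : Set x} (x₀ : X) (f : Fin k → X) i → nth x₀ f (toℕ i) ≡ f i
    nth-toℕ x₀ f fzero    = ≡.refl
    nth-toℕ x₀ f (fsuc i) = nth-toℕ x₀ (f ∘ fsuc) i

    generic-cong : ∀ {F G} → (∀ p → F p ≈ G p) → GenericallyContinuous F → GenericallyContinuous G
    generic-cong F≈G (Q , c) = Q , λ p good h ε 0<ε →
      let (σs , δ , 0<δ , f) = c p good h ε 0<ε in σs , δ , 0<δ , λ p′ good′ h′ near →
        ≈-<-trans (∣∣-cong (+-cong (sym (F≈G p′)) (-‿cong (sym (F≈G p))))) (f p′ good′ h′ near)

    generic-neg : ∀ {F} → GenericallyContinuous F → GenericallyContinuous (λ p → - F p)
    generic-neg {F} (Q , c) = Q , λ p good h ε 0<ε →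
      let (σs , δ , 0<δ , f) = c p good h ε 0<ε in σs , δ , 0<δ , λ p′ good′ h′ near →
        ≈-<-trans (∣neg-neg∣ (F p′) (F p)) (f p′ good′ h′ near)

    common-neighbourhood : ∀ k {p} {X : Fin k → Pred Point (lsuc 0ℓ)} →
      (∀ i → ∃[ σs ] ∃[ δ ] 0# < δ × (∀ p′ → Nearᵛ σs δ (value p) (value p′) → X i p′)) →
      ∃[ σs ] ∃[ δ ] 0# < δ × (∀ p′ → Nearᵛ σs δ (value p) (value p′) → ∀ i → X i p′)
    common-neighbourhood zero    h = [] , 1# , 0<1 , λ _ _ ()
    common-neighbourhood (suc k) {X = X} h =
      let (σs , δ , 0<δ , f) = h fzero
          (σs′ , δ′ , 0<δ′ , g) = common-neighbourhood k (h ∘ fsuc)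
          (η , 0<η , η≤δ , η≤δ′) = positive-minimum 0<δ 0<δ′
      in σs ++ σs′ , η , 0<η , λ { p′ near fzero    → f p′ (near-mono η≤δ (++⁻ˡ σs near))
                                 ; p′ near (fsuc i) → g p′ (near-mono η≤δ′ (++⁻ʳ σs near)) i }

    generic-conn : ∀ {k} (f : Connective k) {F : Fin k → Point → ℝ} → (∀ i → GenericallyContinuous (F i)) →
                   GenericallyContinuous (λ p → apply f (λ i → F i p))
    generic-conn {k} f {F} c = flatten Q , λ p good h ε 0<ε →
      let (δ , 0<δ , fδ) = continuous f (λ i → F i p) ε 0<ε
          (σs , η , 0<η , g) = common-neighbourhood k
            {X = λ i p′ → Good p′ → InAll (proj₁ (c i)) p′ → ∣ F i p′ - F i p ∣ < δ} λ i →
            let (σs , η , 0<η , g) = proj₂ (c i) p good (component h i) δ 0<δ in σs , η , 0<η , λ p′ near good′ h′ → g p′ good′ h′ near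
      in σs , η , 0<η , λ p′ good′ h′ near →
        ∣∣-swap<
          (fδ (λ i → F i p′) λ i → ∣∣-swap<
            (g p′ near i good′ (component h′ i)))
      where
      Q : ℕ → ℕ → DenseOpen 𝒯
      Q i = nth (λ _ → everything) (λ i → proj₁ (c i)) i
      component : ∀ {p} → InAll (flatten Q) p → ∀ i → InAll (proj₁ (c i)) p
      component {p} h i = ≡.subst (λ q → InAll q p) (nth-toℕ _ (λ i → proj₁ (c i)) i) (inAll-flatten Q {p} h (toℕ i))

    -- The interior of a set of points, transported to valuations: only points are tested, but the
    -- centre may be any valuation.
    Locally : Pred Point (lsuc 0ℓ) → Pred Valuation (lsuc 0ℓ)
    Locally X v = ∃[ σs ] ∃[ ε ] 0# < ε × (∀ p → Nearᵛ σs ε v (value p) → X p)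

    locally-open : ∀ X → IsOpenᵛ (Locally X)
    locally-open X v (σs , ε , 0<ε , f) = σs , half ε , half-pos 0<ε , λ w v~w →
      σs , half ε , half-pos 0<ε , λ p w~p → f p (near-mono (≤-reflexive (half+half ε)) (near-trans v~w w~p))

    locally-here : ∀ {X p} → Locally X (value p) → X p
    locally-here {p = p} (σs , ε , 0<ε , f) = f p (near-refl σs 0<ε λ σ → refl)

    -- An infimum F of continuous functions is upper semicontinuous, hence continuous
    -- wherever, for every r in a countable dense set, one is in the open set where
    -- F < r or in the interior of its complement.
    module Infimum {F : ℕ → Point → ℝ} {inf : Point → ℝ} (c : ∀ j → GenericallyContinuous (F j))
                   (isInf : ∀ p → Good p → IsInf (λ j → F j p) (inf p)) where

      C : ℕ → ℕ → DenseOpen 𝒯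
      C j = proj₁ (c j)

      -- `Apart r` excludes `Below r` only at points of models, which matches density: if no point
      -- of a model near `p` is in `Below r`, then `p` itself is in `Apart r`.
      Below Apart : ℝ → Pred Valuation (lsuc 0ℓ)
      Below r = Locally λ p → Good p → InAll (flatten C) p → inf p < r
      Apart r = Locally λ p → proj₁ p ⊨ 𝒯 → ¬ Below r (value p)

      boundary : ℝ → DenseOpen 𝒯
      boundary r = record
        { member = λ v → Below r v ⊎ Apart r v
        ; isOpen = λ
            { v (inj₁ b) → let (σs , ε , 0<ε , f) = locally-open _ v b in σs , ε , 0<ε , λ w n → inj₁ (f w n)
            ; v (inj₂ a) → let (σs , ε , 0<ε , f) = locally-open _ v a in σs , ε , 0<ε , λ w n → inj₂ (f w n) }
        ; dense  = λ p σs ε 0<ε → cases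
            (decide (Σ[ q ∈ ModelPoint 𝒯 ] Below r (value (proj₁ q)) × Nearᵛ σs ε (value (proj₁ p)) (value (proj₁ q))))
            (λ (q , b , near) → q , inj₁ b , near)
            (λ none → p , inj₂ (σs , ε , 0<ε , λ q near q⊨ b → none ((q , q⊨) , b , near)) , near-refl σs 0<ε λ σ → refl)
        }

      Q : ℕ → ℕ → DenseOpen 𝒯
      Q zero    = λ i → boundary (proj₁ countable-dense-reals i)
      Q (suc i) = λ _ → flatten C i

      inAll-C : ∀ {p} → InAll (flatten Q) p → InAll (flatten C) p
      inAll-C {p} h i = inAll-flatten Q {p} h (suc i) 0

      -- Upper semicontinuity: some `F j` is already below `r` at `p`, stays below `r` nearby by its
      -- continuity, and dominates the infimum.
      below : ∀ {r p} → Good p → InAll (flatten C) p → inf p < r → Below r (value p)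
      below {r} {p} good h inf<r =
        let (j , Fj<) = proj₂ (isInf p good) (r - inf p) (<⇒0<- inf<r)
            Fj<r = <-≈-trans Fj< (x+[y-x]≈y (inf p) r)
            (σs , δ , 0<δ , f) = proj₂ (c j) p good (inAll-flatten C {p} h j) (r - F j p) (<⇒0<- Fj<r)
        in σs , δ , 0<δ , λ p′ near good′ h′ → ≤-<-trans (proj₁ (isInf p′ good′) j)
             (<-≈-trans (∣-∣<⇒<+ (f p′ good′ (inAll-flatten C {p′} h′ j) near))
               (x+[y-x]≈y (F j p) r))

      value-between : ∀ m ε → 0# < ε → ∃[ i ] m - ε < proj₁ countable-dense-reals i × proj₁ countable-dense-reals i < m
      value-between m ε 0<ε =
        let (n , ιn<) = ι-small (half ε) (half-pos 0<ε)
            (i , near) = proj₂ countable-dense-reals (m - half ε) n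
            q = proj₁ countable-dense-reals i
            near′ = ≤-<-trans near ιn<
        in i ,
          linear< (∣-∣<⇒<+ near′) (trans (solve 4 (λ m e h q → q :+ (m :- h) := (m :- (h :+ h)) :+ (q :+ h)) refl m ε (half ε) q)
            (+-congʳ (+-congˡ (-‿cong (half+half ε))))) ,
          <-≈-trans (∣-∣<⇒<+ (∣∣-swap< near′))
            (solve 2 (λ m h → (m :- h) :+ h := m) refl m (half ε))

      generic-inf : GenericallyContinuous inf
      generic-inf = flatten Q , λ p good h ε 0<ε →
        -- For r between inf p - ε and inf p, the point is not in `Below r`, so `boundary` puts it
        -- in `Apart r`; this is the missing lower bound for the infimum nearby.
        let (i , lo , hi) = value-between (inf p) ε 0<ε
            (σs , δ , 0<δ , f) = below {inf p + ε} {p} good (inAll-C {p} h) (x<x+y 0<ε)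
            (σs′ , δ′ , 0<δ′ , g) = apart {p = p} good (inAll-C {p} h) hi (inAll-flatten Q {p} h 0 i)
            (η , 0<η , η≤δ , η≤δ′) = positive-minimum 0<δ 0<δ′
        in σs ++ σs′ , η , 0<η , λ p′ good′ h′ near → ∣-∣<
             (f p′ (near-mono η≤δ (++⁻ˡ σs near)) good′ (inAll-C {p′} h′))
             (linear< (<-≤-trans lo (≮⇒≥ λ inf<r → g p′ (near-mono η≤δ′ (++⁻ʳ σs near)) (proj₁ good′)
                 (below {p = p′} good′ (inAll-C {p′} h′) inf<r)))
               (solve 3 (λ m e m′ → (m′ :+ e) :+ (m :- e) := m :+ m′) refl (inf p) ε (inf p′)))
        where
        apart : ∀ {p r} → Good p → InAll (flatten C) p → r < inf p → Below r (value p) ⊎ Apart r (value p) → Apart r (value p)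
        apart {p} good h r<inf (inj₁ b) = ⊥-elim (<⇒≱ (locally-here {p = p} b good h) (<⇒≤ r<inf))
        apart good h r<inf (inj₂ a) = a

    generic-distance : ∀ {Γ} t u (ρ : Indices Γ) → GenericallyContinuous (λ (A , a) → val (plain A) (dist t u) (constants A a ρ))
    generic-distance t u ρ = (λ _ → everything) , λ (A , a) good h ε 0<ε →
      instantiate (dist t u) ρ ∷ [] , ε , 0<ε , λ { (B , b) good′ h′ (near ∷ []) →
        ≈-<-trans (∣∣-cong (+-cong (sym (value-instantiate B b (dist t u) ρ)) (-‿cong (sym (value-instantiate A a (dist t u) ρ))))) near }

    -- Density of the constants turns the infimum over a ball into one over a sequence, as `Infimum`
    -- expects. `g` is the identity for infima and negation for suprema.
    inf-over-constants : ∀ {Γ n} (φ : LFormula (n ∷ Γ)) (g : ℝ → ℝ) → (∀ x y → ∣ g x - g y ∣ ≈ ∣ x - y ∣) →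
      ∀ A a ρ {m} → SortwiseDense A a →
      IsInf (λ (x : Ball A n) → g (val (plain A) φ (x ∷ ρ))) m → IsInf (λ j → g (val (plain A) φ (a n j ∷ ρ))) m
    inf-over-constants {n = n} φ g g-isometric A a ρ {m} dense (lower , approx) = (λ j → lower (a n j)) , λ ε 0<ε →
      let (x , small) = approx (half ε) (half-pos 0<ε)
          (k , ιk<) = ι-small (half ε) (half-pos 0<ε)
          (M , uniform) = formula-uniform {logicSignature} φ k
          (j , near) = dense n x (ι M) (0<ι M)
          close = uniform (plain A) (a n j ∷ ρ) (x ∷ ρ) (max-lub (≈-≤-trans (d-sym A (proj₁ (a n j)) (proj₁ x)) (<⇒≤ near)) (dᴱ-refl ρ M))
      in j , ≤-<-trans (∣-∣≤⇒≤+ (≈-≤-trans (g-isometric _ _) close))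
           (<-≈-trans (<⊕< small ιk<) (trans (+-assoc _ _ _) (+-congˡ (half+half ε))))
      where
      dᴱ-refl : ∀ {Γ} (ρ : Env A Γ) M → dᴱ A ρ ρ ≤ ι M
      dᴱ-refl []              M = <⇒≤ (0<ι M)
      dᴱ-refl {n ∷ Γ} (x ∷ ρ) M = cons-close A {n} x ρ ρ (dᴱ-refl ρ M)

    abstract
      -- The free variables are filled by constants, so that a quantifier step replaces the bound
      -- variable by one more constant index and the induction stays within functions of points.
      generic-formula : ∀ {Γ} (φ : LFormula Γ) (ρ : Indices Γ) → GenericallyContinuous (λ (A , a) → val (plain A) φ (constants A a ρ))
      generic-formula (dist t u)  ρ = generic-distance t u ρ
      generic-formula (conn f φs) ρ = generic-cong (λ (A , a) → sym (val-conn (plain A) f φs (constants A a ρ)))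
        (generic-conn f λ i → generic-formula (φs i) ρ)
      generic-formula (⨅ n φ) ρ = Infimum.generic-inf (λ j → generic-formula φ (j ∷ ρ))
        λ (A , a) (_ , dense) → inf-over-constants φ (λ x → x) (λ _ _ → refl) A a (constants A a ρ) dense (val-⨅ (plain A) φ (constants A a ρ))
      generic-formula (⨆ n φ) ρ = generic-cong (λ p → solve 1 (λ x → :- :- x := x) refl _)
        (generic-neg (Infimum.generic-inf (λ j → generic-neg (generic-formula φ (j ∷ ρ)))
          λ (A , a) (_ , dense) → inf-over-constants φ (λ x → - x) ∣neg-neg∣ A a (constants A a ρ) dense (val-⨆ (plain A) φ (constants A a ρ))))

  -- Complete theories

  sorts : List NewConstant → List Sort
  sorts = map proj₁

  -- The decision is passed as an argument so that proofs can split on it, `decide` being opaque.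
  -- The trailing `++ []` is the context of a formula under `⨅* (sorts cs)`.
  findFirst : ∀ {c c′ : NewConstant} {cs} → c ≡ c′ ⊎ ¬ c ≡ c′ → Maybe (proj₁ c ∈ sorts cs ++ []) →
              Maybe (proj₁ c ∈ sorts (c′ ∷ cs) ++ [])
  findFirst (inj₁ ≡.refl) _ = just (here ≡.refl)
  findFirst (inj₂ _)      i = Maybe.map there i

  find : ∀ c cs → Maybe (proj₁ c ∈ sorts cs ++ [])
  find c []        = nothing
  find c (c′ ∷ cs) = findFirst {cs = cs} (decide (c ≡ c′)) (find c cs)

  module _ (cs : List NewConstant) where

    -- Constants outside cs become 0.
    generalizeₜ : ClosedTerm → Term ⊥ (sorts cs ++ [])
    generalizeₜ (con c)  = maybe′ var zeroₜ (find c cs)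
    generalizeₜ zeroₜ    = zeroₜ
    generalizeₜ (oneₜ u) = oneₜ u
    generalizeₜ (t +ₜ u) = generalizeₜ t +ₜ generalizeₜ u
    generalizeₜ (t ·ₜ u) = generalizeₜ t ·ₜ generalizeₜ u
    generalizeₜ (t ⋆ₜ)   = generalizeₜ t ⋆ₜ
    generalizeₜ (z *ₜ t) = z *ₜ generalizeₜ t

    generalizeᶠ : ∀ {φ : Formula NewConstant []} → QuantifierFree φ → LFormula (sorts cs ++ [])
    generalizeᶠ (dist t u)  = dist (generalizeₜ t) (generalizeₜ u)
    generalizeᶠ (conn f qs) = conn f λ i → generalizeᶠ (qs i)

    generalize-qf : ∀ {φ : Formula NewConstant []} (q : QuantifierFree φ) → QuantifierFree (generalizeᶠ q)
    generalize-qf (dist t u)  = dist _ _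
    generalize-qf (conn f qs) = conn f λ i → generalize-qf (qs i)

    module _ (A : CStarAlgebra) where

      interpret : Env A (sorts cs ++ []) → Interpretation A
      interpret τ n j = maybe′ (lookup τ) (zeroBall A n) (find (n , j) cs)

      module _ (τ : Env A (sorts cs ++ [])) where

        evaluate-variable : ∀ {n} (i : Maybe (n ∈ sorts cs ++ [])) →
          proj₁ (maybe′ (lookup τ) (zeroBall A n) i) ≡ ⟦ maybe′ var zeroₜ i ⟧ˢ (plain A) τ
        evaluate-variable (just i) = ≡.refl
        evaluate-variable nothing  = ≡.refl

        evaluate-generalize : ∀ t → evaluate t (A , interpret τ) ≡ ⟦ generalizeₜ t ⟧ˢ (plain A) τ
        evaluate-generalize (con (n , j)) = evaluate-variable (find (n , j) cs)
        evaluate-generalize zeroₜ    = ≡.refl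
        evaluate-generalize (oneₜ u) = ≡.refl
        evaluate-generalize (t +ₜ u) = ≡.cong₂ (CStarAlgebra._+ᴹ_ A) (evaluate-generalize t) (evaluate-generalize u)
        evaluate-generalize (t ·ₜ u) = ≡.cong₂ (CStarAlgebra._·_ A) (evaluate-generalize t) (evaluate-generalize u)
        evaluate-generalize (t ⋆ₜ)   = ≡.cong (CStarAlgebra._⋆ A) (evaluate-generalize t)
        evaluate-generalize (z *ₜ t) = ≡.cong (CStarAlgebra._*ₗ_ A z) (evaluate-generalize t)

        value-generalize : ∀ {φ} (q : QuantifierFree φ) → val (plain A) (generalizeᶠ q) τ ≈ value (A , interpret τ) (φ , q)
        value-generalize (dist t u) = trans (val-dist (plain A) (generalizeₜ t) (generalizeₜ u) τ)
          (trans (reflexive (≡.cong₂ (CStarAlgebra.d A) (≡.sym (evaluate-generalize t)) (≡.sym (evaluate-generalize u))))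
            (sym (value-distance (A , interpret τ) t u)))
        value-generalize (conn f {φs} qs) = trans (val-conn (plain A) f (λ i → generalizeᶠ (qs i)) τ)
          (trans (continuous-cong (continuous f) λ i → value-generalize (qs i))
            (sym (val-conn (structure (A , interpret τ)) f φs [])))

  restrict : ∀ A → Interpretation A → ∀ cs → Env A (sorts cs)
  restrict A a []             = []
  restrict A a ((n , j) ∷ cs) = a n j ∷ restrict A a cs

  module _ (A : CStarAlgebra) (a : Interpretation A) where

    private
      Found : ∀ cs n (j : ℕ) → Maybe (n ∈ sorts cs ++ []) → Set
      Found cs n j i = maybe′ (lookup (++⁺ (restrict A a cs) [])) (zeroBall A n) i ≡ a n j

      found-there : ∀ n′ j′ cs {n j} (i : Maybe (n ∈ sorts cs ++ [])) → Found cs n j i → Found ((n′ , j′) ∷ cs) n j (Maybe.map there i)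
      found-there n′ j′ cs (just i) p = p
      found-there n′ j′ cs nothing  p = p

      found-first : ∀ n′ j′ cs {n j} (e : (n , j) ≡ (n′ , j′) ⊎ ¬ (n , j) ≡ (n′ , j′)) → (n , j) ∈ (n′ , j′) ∷ cs →
        (∀ (c∈ : (n , j) ∈ cs) → Found cs n j (find (n , j) cs)) →
        Found ((n′ , j′) ∷ cs) n j (findFirst {cs = cs} e (find (n , j) cs))
      found-first n′ j′ cs (inj₁ ≡.refl) c∈          h = ≡.refl
      found-first n′ j′ cs (inj₂ c≢c′)   (here c≡c′) h = ⊥-elim (c≢c′ c≡c′)
      found-first n′ j′ cs {n} {j} (inj₂ c≢c′)   (there c∈)  h = found-there n′ j′ cs (find (n , j) cs) (h c∈)

      found : ∀ cs {n j} → (n , j) ∈ cs → Found cs n j (find (n , j) cs)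
      found ((n′ , j′) ∷ cs) {n} {j} c∈ = found-first n′ j′ cs (decide ((n , j) ≡ (n′ , j′))) c∈ (found cs)

    interpret-restrict : ∀ cs → AgreeOn A cs a (interpret cs A (++⁺ (restrict A a cs) []))
    interpret-restrict cs = All.tabulate λ c∈cs → ≡.sym (found cs c∈cs)

  -- Gathers finitely many nearness conditions in one number, so that a single formula can express
  -- them, with the reals `v σ` built into its connectives.
  deviation : Valuation → Valuation → List QFSentence⁺ → ℝ
  deviation v w []       = 0#
  deviation v w (σ ∷ σs) = ∣ w σ - v σ ∣ + deviation v w σs

  0≤deviation : ∀ v w σs → 0# ≤ deviation v w σs
  0≤deviation v w []       = ≤-refl
  0≤deviation v w (σ ∷ σs) = ≤-trans (0≤∣∣ _) (x≤x+y (0≤deviation v w σs))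

  deviation⇒near : ∀ v w σs {ε} → deviation v w σs < ε → Nearᵛ σs ε v w
  deviation⇒near v w []       p = []
  deviation⇒near v w (σ ∷ σs) p = ≤-<-trans (x≤x+y (0≤deviation v w σs)) p ∷
    deviation⇒near v w σs (≤-<-trans (≤-≈-trans (x≤x+y (0≤∣∣ _)) (+-comm _ _)) p)

  deviation≈0 : ∀ v w σs → All (λ σ → v σ ≈ w σ) σs → deviation v w σs ≈ 0#
  deviation≈0 v w []       []       = refl
  deviation≈0 v w (σ ∷ σs) (p ∷ ps) = trans (+-cong (∣x-x∣≈0 (sym p)) (deviation≈0 v w σs ps)) (+-identityʳ 0#)

  deviationConnective : ℝ → Connective 2
  deviationConnective r = record
    { apply      = λ v → ∣ v fzero - r ∣ + v (fsuc fzero)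
    ; continuous = λ v ε 0<ε → half ε , half-pos 0<ε , λ w h → ≤-<-trans
        (≈-≤-trans (∣∣-cong (solve 4 (λ a b c d → (a :+ b) :- (c :+ d) := (a :- c) :+ (b :- d)) refl _ _ _ _))
          (∣∣-+ _ _))
        (halves< (≤-<-trans (shift (v fzero) (w fzero)) (h fzero)) (h (fsuc fzero)))
    }
    where
    shift : ∀ x y → ∣ ∣ x - r ∣ - ∣ y - r ∣ ∣ ≤ ∣ x - y ∣
    shift x y = ∣-∣≤
      (≤-≈-trans (∣∣-triangle x y r) (+-comm _ _))
      (≤-≈-trans (∣∣-triangle y x r) (trans (+-comm _ _) (+-congˡ (∣∣-sym y x))))

  module _ (cs : List NewConstant) (v : Valuation) where

    deviationFormula : List QFSentence⁺ → LFormula (sorts cs ++ [])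
    deviationArguments : ∀ {φ} → QuantifierFree φ → List QFSentence⁺ → Fin 2 → LFormula (sorts cs ++ [])

    deviationFormula []             = dist zeroₜ zeroₜ
    deviationFormula ((φ , q) ∷ σs) = conn (deviationConnective (v (φ , q))) (deviationArguments q σs)

    deviationArguments q σs fzero    = generalizeᶠ cs q
    deviationArguments q σs (fsuc _) = deviationFormula σs

    val-deviation : ∀ A τ σs → val (plain A) (deviationFormula σs) τ ≈ deviation v (value (A , interpret cs A τ)) σs
    val-deviation A τ [] = trans (val-dist (plain A) zeroₜ zeroₜ τ) (≈ᴹ⇒d≈0 A (≈ᴹ-refl A))
    val-deviation A τ ((φ , q) ∷ σs) = trans (val-conn (plain A) (deviationConnective (v (φ , q))) (deviationArguments q σs) τ)
      (+-cong (∣∣-cong (+-congʳ (value-generalize cs A τ q))) (val-deviation A τ σs))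

  module _ {𝒯 : Theory} (complete : Complete 𝒯) where

    same-values : ∀ A B → A ⊨ 𝒯 → B ⊨ 𝒯 → ∀ φ → val (plain A) φ [] ≈ val (plain B) φ []
    same-values A B A⊨ B⊨ φ = complete A B A⊨ B⊨ φ _ _ (val⇒lvalue φ refl) (val⇒lvalue φ refl)

    -- The constants that occur in σs, as interpreted in `A`, give Ψ the value 0, so its infimum is
    -- at most 0 in `A` and by completeness also in `B`. A nearly optimal tuple in `B` then
    -- interprets these constants.
    transfer : ∀ A a B → A ⊨ 𝒯 → B ⊨ 𝒯 → ∀ σs ε → 0# < ε →
               Σ[ b ∈ Interpretation B ] Nearᵛ σs ε (value (A , a)) (value (B , b))
    transfer A a B A⊨ B⊨ σs ε 0<ε = realize (proj₂ (val-⨅* B (sorts cs) Ψ []) ε 0<ε)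
      where
      cs : List NewConstant
      cs = uses σs
      v : Valuation
      v = value (A , a)
      Ψ : LFormula (sorts cs ++ [])
      Ψ = deviationFormula cs v σs
      τ : Env A (sorts cs ++ [])
      τ = ++⁺ (restrict A a cs) []
      Ψ≈0 : val (plain A) Ψ τ ≈ 0#
      Ψ≈0 = trans (val-deviation cs v A τ σs) (deviation≈0 v (value (A , interpret cs A τ)) σs
        (values-agree A {a} {interpret cs A τ} σs (interpret-restrict A a cs)))
      inf≤0 : val (plain B) (⨅* (sorts cs) Ψ) [] ≤ 0#
      inf≤0 = ≈-≤-trans (same-values B A B⊨ A⊨ (⨅* (sorts cs) Ψ))
        (≤-≈-trans (proj₁ (val-⨅* A (sorts cs) Ψ []) (restrict A a cs)) Ψ≈0)
      realize : Σ[ τ ∈ Env B (sorts cs) ] val (plain B) Ψ (++⁺ τ []) < val (plain B) (⨅* (sorts cs) Ψ) [] + ε →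
                Σ[ b ∈ Interpretation B ] Nearᵛ σs ε v (value (B , b))
      realize (τ′ , small) = interpret cs B (++⁺ τ′ []) ,
        deviation⇒near v (value (B , interpret cs B (++⁺ τ′ []))) σs
          (≈-<-trans (sym (val-deviation cs v B (++⁺ τ′ []) σs))
            (<-≤-trans small (≤-≈-trans (inf≤0 ⊕ ≤-refl) (+-identityˡ ε))))

  -- Conditions from the existential families

  module FamilyConditions {p : Level} {P : Pred CStarAlgebra p} (definable : DefinableByUniformFamilies P) where
    open DefinableByUniformFamilies definable
    open UniformFamily
    open Modulus using (modulus; limit)

    Condition : Set
    Condition = Σ[ n ∈ ℕ ] Indices (context n) × ℕ

    Realized : ∀ {Γ} {φ : LFormula Γ} → Existential φ → Indices Γ → ℕ → Pred Valuation 0ℓ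
    Realized (Δ , ψ , q , _) ρ m v = ∃[ y ] v (instantiate q (++⁺ {xs = Δ} y ρ)) < ι m

    -- The infimum over the family and the quantifiers inside its members become one search for a
    -- formula and constants with value below `ι m`; as a union of open sets it is open.
    Holds : Condition → Pred Valuation 0ℓ
    Holds (n , ρ , m) v = Σ[ (φ , φ∈) ∈ Σ (LFormula (context n)) (family n) ] Realized (existential n φ φ∈) ρ m v

    holds-open : ∀ c → BasicOpen (Holds c)
    holds-open (n , ρ , m) = open-∃ λ (φ , φ∈) → realized-open (existential n φ φ∈)
      where
      realized-open : ∀ {φ} (e : Existential φ) → BasicOpen (Realized e ρ m)
      realized-open (Δ , ψ , q , _) = open-∃ λ y → open-< (instantiate q (++⁺ y ρ)) (ι m)

    FamiliesVanish : CStarAlgebra → Set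
    FamiliesVanish A = ∀ n ρ → IsInfimum (λ v → ∃[ φ ] family n φ × LValue A φ ρ v) 0#

    realized⇒small : ∀ A a {Γ} {φ : LFormula Γ} (e : Existential φ) (ρ : Indices Γ) m →
                     Realized e ρ m (value (A , a)) → val (plain A) φ (constants A a ρ) < ι m
    realized⇒small A a (Δ , ψ , q , _ , ≡.refl) ρ m (y , small) = ≤-<-trans
      (proj₁ (val-⨅* A Δ ψ (constants A a ρ)) (constants A a y))
      (≈-<-trans (sym (trans (value-instantiate A a q (++⁺ y ρ))
        (reflexive (≡.cong (val (plain A) ψ) (constants-++ A a y ρ))))) small)

    Witnessed : ∀ A {Γ} {φ : LFormula Γ} → Existential φ → Env A Γ → ℝ → Set
    Witnessed A (Δ , ψ , _) ρ r = Σ[ τ ∈ Env A Δ ] val (plain A) ψ (++⁺ τ ρ) < r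

    small⇒witnessed : ∀ A {Γ} {φ : LFormula Γ} (e : Existential φ) ρ {r} → val (plain A) φ ρ < r → Witnessed A e ρ r
    small⇒witnessed A (Δ , ψ , q , _ , ≡.refl) ρ {r} small =
      let (τ , h) = proj₂ (val-⨅* A Δ ψ ρ) (r - val (plain A) (⨅* Δ ψ) ρ) (<⇒0<- small)
      in τ , <-≈-trans h (x+[y-x]≈y _ r)

    vanish⇒witnessed : ∀ A → FamiliesVanish A → ∀ n (ρ : Env A (context n)) r → 0# < r →
      Σ[ (φ , φ∈) ∈ Σ (LFormula (context n)) (family n) ] Witnessed A (existential n φ φ∈) ρ r
    vanish⇒witnessed A vanish n ρ r 0<r =
      let (v , (φ , φ∈ , φ≈v) , v<r) = isInfimum⇒≤ (vanish n ρ) r 0<r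
      in (φ , φ∈) , small⇒witnessed A (existential n φ φ∈) ρ
           (≈-<-trans (sym (lvalue⇒val φ φ≈v)) (<-≈-trans v<r (+-identityˡ r)))

    name-witness : ∀ A a {Γ} {φ : LFormula Γ} (e : Existential φ) (ρ : Indices Γ) m → Witnessed A e (constants A a ρ) (ι m) →
      ∀ σs {ε} → 0# < ε → Σ[ b ∈ Interpretation A ] Nearᵛ σs ε (value (A , a)) (value (A , b)) × Realized e ρ m (value (A , b))
    name-witness A a (Δ , ψ , q , _) ρ m (τ , small) σs 0<ε =
      let (b , near , y , e) = name-elements A a q ρ τ σs 0<ε in
      b , near , y , ≈-<-trans e small

    -- In contrast to `name-witness` the interpretation is kept, so that the condition is verified
    -- at the given point: dense constants approximate the witness.
    approximate-witness : ∀ A a → SortwiseDense A a → ∀ {Γ} {φ : LFormula Γ} (e : Existential φ) (ρ : Indices Γ) m →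
      Witnessed A e (constants A a ρ) (ι m) → Realized e ρ m (value (A , a))
    approximate-witness A a dense (Δ , ψ , q , _) ρ m (τ , small) =
      -- The gap left by the strict inequality is the error allowed when the witness is replaced by
      -- constants.
      let (k , ιk<) = ι-small (ι m - val (plain A) ψ (++⁺ τ (constants A a ρ))) (<⇒0<- small)
          (M , uniform) = formula-uniform {logicSignature} ψ k
          (y , near) = approximate-constants A a dense τ (ι M) (0<ι M)
      in y , ≤-<-trans
           (≈-≤-trans (trans (value-instantiate A a q (++⁺ y ρ)) (reflexive (≡.cong (val (plain A) ψ) (constants-++ A a y ρ))))
             (∣-∣≤⇒≤+ (∣∣-swap≤ (uniform (plain A) (++⁺ τ (constants A a ρ)) (++⁺ (constants A a y) (constants A a ρ))
               (dᴱ-++ˡ A τ (constants A a y) (constants A a ρ) (<⇒≤ near))))))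
           (<-≈-trans (≤-refl ⊕< ιk<) (x+[y-x]≈y _ (ι m)))

    module _ (A : CStarAlgebra) (a : Interpretation A) (dense : SortwiseDense A a) where

      vanish⇒holds : FamiliesVanish A → ∀ c → Holds c (value (A , a))
      vanish⇒holds vanish (n , ρ , m) =
        let ((φ , φ∈) , w) = vanish⇒witnessed A vanish n (constants A a ρ) (ι m) (0<ι m)
        in (φ , φ∈) , approximate-witness A a dense (existential n φ φ∈) ρ m w

      -- The formula φ is found only after the approximating constants `ρ′`, so the radius δ must be
      -- chosen for the whole family; this is what the common modulus provides.
      holds⇒vanish : A ⊨ theory → (∀ c → Holds c (value (A , a))) → FamiliesVanish A
      holds⇒vanish A⊨ holds n ρ = isInfimum
        (λ v (φ , φ∈ , φ≈v) → nonnegative (uniform n) φ φ∈ A ρ v φ≈v)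
        λ ε 0<ε →
          let (u , equi) = equicontinuous (uniform n)
              (δ , 0<δ , u-small) = limit u (half ε) (half-pos 0<ε)
              (ρ′ , near) = approximate-constants A a dense ρ δ 0<δ
              (m , ιm<) = ι-small (half ε) (half-pos 0<ε)
              ((φ , φ∈) , r) = holds (n , ρ′ , m)
              close = equi A A⊨ φ φ∈ ρ (constants A a ρ′) _ _ (val⇒lvalue φ refl) (val⇒lvalue φ refl)
          in val (plain A) φ ρ , (φ , φ∈ , val⇒lvalue φ refl) ,
             ≤-<-trans (∣-∣≤⇒≤+ close) (<-≈-trans
               (<⊕< (<-trans (realized⇒small A a (existential n φ φ∈) ρ′ m r) ιm<)
                 (u-small (dᴱ A ρ (constants A a ρ′)) (0≤dᴱ A ρ (constants A a ρ′)) near))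
               (trans (half+half ε) (sym (+-identityˡ ε))))

    -- By completeness the finitely many values to be preserved are attained in `B` up to ε/2. There
    -- the families vanish, and naming a witness costs another ε/2.
    holds-dense : ∀ {𝒯} → Complete 𝒯 → ∀ B → B ⊨ 𝒯 → FamiliesVanish B → Condition → DenseOpen 𝒯
    holds-dense complete B B⊨ vanish c@(n , ρ , m) = basic (Holds c) (holds-open c) λ ((A , a) , A⊨) σs ε 0<ε →
      let (b , near) = transfer complete A a B A⊨ B⊨ σs (half ε) (half-pos 0<ε)
          ((φ , φ∈) , w) = vanish⇒witnessed B vanish n (constants B b ρ) (ι m) (0<ι m)
          (b′ , near′ , r) = name-witness B b (existential n φ φ∈) ρ m w σs (half-pos 0<ε)
      in ((B , b′) , B⊨) , ((φ , φ∈) , r) , near-mono (≤-reflexive (half+half ε)) (near-trans near near′)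

  -- The generic set and its subset given by the property

  module Main {p : Level} (𝒯 : Theory) (P : Pred CStarAlgebra p)
              (axiomatizable : ForallExistsAxiomatizable 𝒯) (definable : DefinableByUniformFamilies P) where
    open DenseOpen
    open GenericContinuity 𝒯
    open FamilyConditions definable
    open DefinableByUniformFamilies definable
    open Dual using (⟪_⟫)
    open Equivalence using (to; from)

    dual : ModelPoint 𝒯 → Dual 𝒯
    dual (p@(A , a) , A⊨) = record
      { ⟪_⟫     = value p
      ; linear  = λ { b c f h (φ , _) (ψ , _) → trans (val-conn (structure p) f _ []) (h _) }
      ; bounded = 1# , λ σ r (upper , _) → ≤-≈-trans
          (upper (A , A⊨ , a , value p σ , value⇒value⁺ {A} {a} σ refl , refl)) (sym (*-identityˡ r))
      }

    evaluation : ∀ A a (s : Dual 𝒯) → (∀ σ → ⟪ s ⟫ σ ≈ value (A , a) σ) → IsEvaluationAt A a s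
    evaluation A a s h σ = value⇒value⁺ {A} {a} σ (h σ)

    dual∈𝔗 : ∀ q → 𝔗 𝒯 (dual q)
    dual∈𝔗 ((A , a) , A⊨) = A , A⊨ , a , λ σ → value⇒value⁺ {A} {a} σ refl

    modelPoint : ∀ s → 𝔗 𝒯 s → ModelPoint 𝒯
    modelPoint s (A , A⊨ , a , _) = (A , a) , A⊨

    modelPoint-value : ∀ s (t : 𝔗 𝒯 s) σ → ⟪ s ⟫ σ ≈ value (proj₁ (modelPoint s t)) σ
    modelPoint-value s (A , A⊨ , a , ev) σ = value⁺⇒value {A} {a} σ (ev σ)

    -- Predicates on valuations need not respect pointwise equality of reals by definition; open
    -- ones do, because equal valuations are in every neighbourhood of each other.
    member-resp : ∀ (O : DenseOpen 𝒯) {v w} → (∀ σ → v σ ≈ w σ) → member O v → member O w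
    member-resp O {v} {w} v≈w p = let (σs , ε , 0<ε , f) = isOpen O v p in f w (near-refl {v = v} {w} σs 0<ε v≈w)

    near-resp : ∀ {σs ε v v′ w w′} → (∀ σ → v σ ≈ v′ σ) → (∀ σ → w σ ≈ w′ σ) → Nearᵛ σs ε v w → Nearᵛ σs ε v′ w′
    near-resp v≈v′ w≈w′ = All.map λ {σ} q → ≈-<-trans (∣∣-cong (+-cong (sym (w≈w′ σ)) (-‿cong (sym (v≈v′ σ))))) q

    private
      𝒰 : Theory
      𝒰 = proj₁ axiomatizable

      axiom : ℕ → LSentence
      axiom = proj₁ (countable-subtheory 𝒰)

      trivial-∀∃ : ForallExists trivial
      trivial-∀∃ = [] , [] , trivial , dist zeroₜ zeroₜ ,
        (λ { A [] r h → ≤-reflexive (sym (trans (lvalue⇒val trivial h) (val-trivial A))) }) , ≡.refl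

      axiom-∀∃ : ∀ i → ForallExists (axiom i)
      axiom-∀∃ i = cases (proj₁ (proj₂ (countable-subtheory 𝒰)) i) (proj₁ (proj₂ axiomatizable) (axiom i))
        λ e → ≡.subst ForallExists (≡.sym e) trivial-∀∃

      axiom-holds : ∀ i A → A ⊨ 𝒯 → val (plain A) (axiom i) [] ≈ 0#
      axiom-holds i A A⊨ = cases (proj₁ (proj₂ (countable-subtheory 𝒰)) i)
        (λ u → sym (lvalue⇒val (axiom i) (to (proj₂ (proj₂ axiomatizable) A) A⊨ (axiom i) u)))
        (λ e → ≡.subst (λ φ → val (plain A) φ [] ≈ 0#) (≡.sym e) (val-trivial A))

      Γ : ℕ → List Sort
      Γ i = proj₁ (axiom-∀∃ i)

      property : ℕ → LSentence
      property = proj₁ (countable-subtheory theory)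

      propertyValue : ℕ → Point → ℝ
      propertyValue i (A , a) = val (plain A) (property i) []

      generic-property : ∀ i → GenericallyContinuous (propertyValue i)
      generic-property i = generic-formula (property i) []

      Requirement : Set
      Requirement = (ℕ × ℕ × ℕ) ⊎ (Σ[ i ∈ ℕ ] Indices (Γ i) × ℕ) ⊎ (ℕ × ℕ)

      requirement : Requirement → DenseOpen 𝒯
      requirement (inj₁ k) = densityRequirement 𝒯 k
      requirement (inj₂ (inj₁ (i , k))) =
        let (Γ , Δ , ψ , q , nonneg , φ≡) = axiom-∀∃ i in axiomRequirement 𝒯 Γ Δ q nonneg φ≡ (axiom-holds i) k
      requirement (inj₂ (inj₂ (i , k))) = proj₁ (generic-property i) k

      requirements : Enumerable Requirement
      requirements = enumerable-⊎ (enumerable-× enumerable-ℕ (enumerable-× enumerable-ℕ enumerable-ℕ))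
        (enumerable-⊎ (enumerable-Σ enumerable-ℕ λ i → enumerable-× (enumerable-All (Γ i)) enumerable-ℕ)
          (enumerable-× enumerable-ℕ enumerable-ℕ))

      conditions : Enumerable Condition
      conditions = enumerable-Σ enumerable-ℕ λ n → enumerable-× (enumerable-All (context n)) enumerable-ℕ

      O : ℕ → DenseOpen 𝒯
      O k = requirement (proj₁ requirements k)

      everywhere : ∀ {v} → (∀ k → member (O k) v) → ∀ r → member (requirement r) v
      everywhere {v} h r = let (k , e) = proj₂ requirements r in ≡.subst (λ r → member (requirement r) v) e (h k)

      -- The order matters: term density lets the density requirements yield sortwise density, and
      -- only then do the axiom requirements, which speak about constants, yield the axioms.
      generic-good : ∀ A a → TermDense (A , a) → (∀ k → member (O k) (value (A , a))) → Good (A , a)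
      generic-good A a dense h = from (proj₂ (proj₂ axiomatizable) A)
          (proj₂ (proj₂ (countable-subtheory 𝒰)) A λ i →
            let (Γ , Δ , ψ , q , nonneg , φ≡) = axiom-∀∃ i in
            axiomRequirement-correct 𝒯 Γ Δ q nonneg φ≡ (axiom-holds i) A a sortwise λ k → everywhere {value (A , a)} h (inj₂ (inj₁ (i , k)))) ,
        sortwise
        where
        sortwise : SortwiseDense A a
        sortwise = densityRequirement-correct 𝒯 A a dense λ k → everywhere {value (A , a)} h (inj₁ k)

    𝔊 : Pred (Dual 𝒯) (lsuc 0ℓ)
    𝔊 s = 𝔗 𝒯 s × (∀ k → member (O k) ⟪ s ⟫)

    -- The model determined by s is the limit of a constant sequence.
    abstract
      genericPoint : ∀ s → 𝔗 𝒯 s → Σ[ q ∈ Point ] TermDense q × (∀ σ → ⟪ s ⟫ σ ≈ value q σ)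
      genericPoint s t = limitPoint , limitPoint-termDense , λ σ →
        trans (modelPoint-value s t σ) (lim-unique lim-const (value-lim σ))
        where open LimitPoint (λ _ → proj₁ (modelPoint s t)) (λ t ε 0<ε → 0 , λ _ _ → ≈-<-trans (∣x-x∣≈0 refl) 0<ε)

    module _ (s : Dual 𝒯) (g : 𝔊 s) where

      point : Point
      point = proj₁ (genericPoint s (proj₁ g))

      point-value : ∀ σ → ⟪ s ⟫ σ ≈ value point σ
      point-value = proj₂ (proj₂ (genericPoint s (proj₁ g)))

      point-termDense : TermDense point
      point-termDense = proj₁ (proj₂ (genericPoint s (proj₁ g)))

      point-member : ∀ k → member (O k) (value point)
      point-member k = member-resp (O k) {⟪ s ⟫} {value point} point-value (proj₂ g k)

      point-good : Good point
      point-good = generic-good (proj₁ point) (proj₂ point) point-termDense point-member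

      determined : UniquelyDetermines s
      determined = record
        { algebra        = proj₁ point
        ; interpretation = proj₂ point
        ; determines     = record
            { isModel = proj₁ point-good ; dense = proj₂ point-good
            ; evaluation = evaluation (proj₁ point) (proj₂ point) s point-value }
        ; unique         = unique
        }
        where
        unique : ∀ B b → Determines s B b → Σ[ h ∈ proj₁ point ≅ B ]
          ∀ n j → CStarAlgebra._≈ᴹ_ B (_≅_.to h (proj₁ (proj₂ point n j))) (proj₁ (b n j))
        unique B b D = same-values⇒≅ point (B , b)
          (λ σ → trans (sym (point-value σ)) (value⁺⇒value {B} {b} σ (Determines.evaluation D σ)))
          point-termDense
          (sortwiseDense⇒termDense B b (Determines.dense D))

    -- A general `Q` that implies the conditions of 𝔊 lets one argument serve both density claims;
    -- for 𝔊ₚ the family conditions are added.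
    generic-dense : (Q : ℕ → DenseOpen 𝒯) → (∀ {v} → (∀ k → member (Q k) v) → ∀ k → member (O k) v) →
      ∀ s → 𝔗 𝒯 s → ∀ σs ε → 0# < ε → Σ[ s′ ∈ Dual 𝒯 ] 𝔊 s′ × (∀ k → member (Q k) ⟪ s′ ⟫) × Near σs ε s s′
    generic-dense Q Q⊆O s t σs ε 0<ε =
      let (q@(A , a) , dense , near , members) = baire 𝒯 Q (modelPoint s t) σs ε 0<ε
          q⊨ = proj₁ (generic-good A a dense (Q⊆O members))
      in dual (q , q⊨) , (dual∈𝔗 (q , q⊨) , Q⊆O members) , members ,
         near-resp {v = value (proj₁ (modelPoint s t))} {⟪ s ⟫} {value q} {value q} (λ σ → sym (modelPoint-value s t σ)) (λ σ → refl) near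

    𝔊-dense : IsDenseIn (𝔗 𝒯) 𝔊
    𝔊-dense = proj₁ , λ s t σs ε 0<ε →
      let (s′ , g , _ , near) = generic-dense O (λ h → h) s t σs ε 0<ε in s′ , g , near

    𝔊-Gδ : IsGδIn (𝔗 𝒯) 𝔊
    𝔊-Gδ = proj₁ , (λ k s → member (O k) ⟪ s ⟫) ,
      (λ k s _ h → let (σs , ε , 0<ε , f) = isOpen (O k) ⟪ s ⟫ h in σs , ε , 0<ε , λ s′ _ near → f ⟪ s′ ⟫ near) ,
      λ s t → mk⇔ proj₂ (λ h → t , h)

    𝔊ₚ : Pred (Dual 𝒯) (lsuc 0ℓ ⊔ p)
    𝔊ₚ = determined with-property P

    property-continuous : ∀ i s (g : 𝔊 s) ε → 0# < ε → ∃[ σs ] ∃[ δ ] 0# < δ ×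
      (∀ s′ (g′ : 𝔊 s′) → Near σs δ s s′ → ∣ propertyValue i (point s′ g′) - propertyValue i (point s g) ∣ < ε)
    property-continuous i s g ε 0<ε =
      let (σs , δ , 0<δ , f) = proj₂ (generic-property i) (point s g) (point-good s g) (inAll s g) ε 0<ε
      in σs , δ , 0<δ , λ s′ g′ near → f (point s′ g′) (point-good s′ g′) (inAll s′ g′)
           (near-resp {v = ⟪ s ⟫} {value (point s g)} {⟪ s′ ⟫} {value (point s′ g′)} (point-value s g) (point-value s′ g′) near)
      where
      inAll : ∀ s g → InAll (proj₁ (generic-property i)) (point s g)
      inAll s g k = everywhere {value (point s g)} (point-member s g) (inj₂ (inj₂ (i , k)))

    -- `point` depends on the proof of genericity. The points for two proofs have the same
    -- valuation, so they are arbitrarily near and continuity makes the values agree.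
    property-independent : ∀ i s g g′ → propertyValue i (point s g′) ≈ propertyValue i (point s g)
    property-independent i s g g′ = ≈-approx λ ε 0<ε →
      let (σs , δ , 0<δ , f) = property-continuous i s g ε 0<ε in <⇒≤ (f s g′ (near-refl {v = ⟪ s ⟫} {⟪ s ⟫} σs 0<δ λ σ → refl))

    private
      -- That a sentence has value 0 is a closed condition on 𝔊; it enters as the intersection over
      -- `l` of open conditions.
      PropertyOpen : (ℕ × ℕ) ⊎ Condition → Pred (Dual 𝒯) (lsuc 0ℓ)
      PropertyOpen (inj₁ (i , l)) s = Σ[ g ∈ 𝔊 s ] ∣ propertyValue i (point s g) ∣ < ι l
      PropertyOpen (inj₂ c)       s = Lift (lsuc 0ℓ) (Holds c ⟪ s ⟫)

      propertyOpen-open : ∀ k → IsOpenIn 𝔊 (PropertyOpen k)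
      propertyOpen-open (inj₁ (i , l)) s _ (g , small) =
        let x = propertyValue i (point s g)
            (σs , δ , 0<δ , f) = property-continuous i s g (ι l - ∣ x ∣) (<⇒0<- small)
        in σs , δ , 0<δ , λ s′ g′ near → g′ , smaller x (propertyValue i (point s′ g′)) (f s′ g′ near)
        where
        smaller : ∀ x y → ∣ y - x ∣ < ι l - ∣ x ∣ → ∣ y ∣ < ι l
        smaller x y h = ≤-<-trans
          (≤-resp (∣∣-cong (x+[y-x]≈y x y)) refl (∣∣-+ x (y - x)))
          (<-≈-trans (≤-refl ⊕< h) (x+[y-x]≈y ∣ x ∣ (ι l)))
      propertyOpen-open (inj₂ c) s _ (lift h) =
        let (σs , ε , 0<ε , f) = holds-open c ⟪ s ⟫ h in σs , ε , 0<ε , λ s′ _ near → lift (f ⟪ s′ ⟫ near)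

      holds-resp : ∀ c {v w} → (∀ σ → v σ ≈ w σ) → Holds c v → Holds c w
      holds-resp c {v} {w} v≈w h = let (σs , ε , 0<ε , f) = holds-open c v h in f w (near-refl {v = v} {w} σs 0<ε v≈w)

      indices : Enumerable ((ℕ × ℕ) ⊎ Condition)
      indices = enumerable-⊎ (enumerable-× enumerable-ℕ enumerable-ℕ) conditions

      theory-vanishes : ∀ i A → A ⊨ theory → val (plain A) (property i) [] ≈ 0#
      theory-vanishes i A A⊨ = cases (proj₁ (proj₂ (countable-subtheory theory)) i)
        (λ u → sym (lvalue⇒val (property i) (A⊨ (property i) u)))
        (λ e → ≡.subst (λ φ → val (plain A) φ [] ≈ 0#) (≡.sym e) (val-trivial A))

    𝔊ₚ-Gδ : IsGδIn 𝔊 𝔊ₚ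
    𝔊ₚ-Gδ = proj₁ , (λ k → PropertyOpen (proj₁ indices k)) , (λ k → propertyOpen-open (proj₁ indices k)) ,
      λ s g → mk⇔ (λ (g , Pg) k → hasProperty⇒open s g Pg (proj₁ indices k))
                  (λ h → g , open⇒hasProperty s g λ c → let (k , e) = proj₂ indices c in ≡.subst (λ c → PropertyOpen c s) e (h k))
      where
      hasProperty⇒open : ∀ s g → P (proj₁ (point s g)) → ∀ c → PropertyOpen c s
      hasProperty⇒open s g Pg (inj₁ (i , l)) = g , ≈-<-trans
        (∣∣-0 (theory-vanishes i (proj₁ (point s g)) (proj₁ (to (defines (proj₁ (point s g))) Pg)))) (0<ι l)
      hasProperty⇒open s g Pg (inj₂ c) = lift (holds-resp c {value (point s g)} {⟪ s ⟫} (λ σ → sym (point-value s g σ))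
        (vanish⇒holds (proj₁ (point s g)) (proj₂ (point s g)) (proj₂ (point-good s g)) (proj₂ (to (defines (proj₁ (point s g))) Pg)) c))

      open⇒hasProperty : ∀ s g → (∀ c → PropertyOpen c s) → P (proj₁ (point s g))
      open⇒hasProperty s g h = from (defines (proj₁ (point s g))) (modelOfTheory ,
        holds⇒vanish (proj₁ (point s g)) (proj₂ (point s g)) (proj₂ (point-good s g)) modelOfTheory
          λ c → holds-resp c {⟪ s ⟫} {value (point s g)} (point-value s g) (lower (h (inj₂ c))))
        where
        modelOfTheory : proj₁ (point s g) ⊨ theory
        modelOfTheory = proj₂ (proj₂ (countable-subtheory theory)) (proj₁ (point s g)) λ i →
          ≈-approx λ ε 0<ε →
            let (l , ιl<ε) = ι-small ε 0<ε
                (g′ , small) = h (inj₁ (i , l))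
            in ≈-≤-trans (∣∣-cong (trans (+-congʳ (property-independent i s g′ g)) (minus0 _))) (<⇒≤ (<-trans small ιl<ε))
          where
          minus0 : ∀ x → x - 0# ≈ x
          minus0 = solve 1 (λ x → x :- con (0 , 0) := x) refl

    module _ (complete : Complete 𝒯) (B : CStarAlgebra) (B⊨ : B ⊨ 𝒯) (PB : P B) where

      private
        B⊨theory = proj₁ (to (defines B) PB)

        theory-transfers : ∀ A → A ⊨ 𝒯 → A ⊨ theory
        theory-transfers A A⊨ φ φ∈ = val⇒lvalue φ
          (trans (lvalue⇒val φ (B⊨theory φ φ∈)) (same-values complete B A B⊨ A⊨ φ))

        -- Row 0 keeps the limit in 𝔊. All later rows repeat the family conditions, to fit the shape
        -- that `flatten` expects; row 1 is the one read back.
        Q : ℕ → ℕ → DenseOpen 𝒯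
        Q zero    = O
        Q (suc _) = λ k → holds-dense complete B B⊨ (proj₂ (to (defines B) PB)) (proj₁ conditions k)

      𝔊ₚ-dense : IsDenseIn 𝔊 𝔊ₚ
      𝔊ₚ-dense = proj₁ , λ s g σs ε 0<ε →
        let (s′ , g′ , members , near) = generic-dense (flatten Q) (λ {v} h k → inFlatten {v} h 0 k) s (proj₁ g) σs ε 0<ε
            A = proj₁ (point s′ g′)
            A⊨ = theory-transfers A (proj₁ (point-good s′ g′))
        in s′ , (g′ , from (defines A) (A⊨ , holds⇒vanish A (proj₂ (point s′ g′)) (proj₂ (point-good s′ g′)) A⊨ λ c →
             let (k , e) = proj₂ conditions c in
             holds-resp c {⟪ s′ ⟫} {value (point s′ g′)} (point-value s′ g′)
               (≡.subst (λ c → Holds c ⟪ s′ ⟫) e (lower (inFlatten {⟪ s′ ⟫} members 1 k))))) , near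
        where
        inFlatten : ∀ {v} → (∀ k → member (flatten Q k) v) → ∀ i j → member (Q i j) v
        inFlatten {v} h i j = let (n , e) = unpair-surjective i j in
          ≡.subst (λ ij → member (Q (proj₁ ij) (proj₂ ij)) v) e (h n)

theorem6p3p1 : (∀ {ℓ} → ExcludedMiddle ℓ) →
    (R : RealNumbers) (unital : Bool) →
    let open ContinuousLogic R unital in
    ∀ {p : Level} (𝒯 : Theory) (P : Pred CStarAlgebra p) →
    ForallExistsAxiomatizable 𝒯 →
    DefinableByUniformFamilies P →
    ∃[ A ] (A ⊨ 𝒯 × P A) →
    Σ[ 𝔊 ∈ Pred (Dual 𝒯) (lsuc 0ℓ) ]
    IsDenseIn (𝔗 𝒯) 𝔊 × IsGδIn (𝔗 𝒯) 𝔊 ×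
    (Σ[ determined ∈ (∀ s → 𝔊 s → UniquelyDetermines s) ]
    IsGδIn 𝔊 (determined with-property P) ×
    (Complete 𝒯 → IsDenseIn 𝔊 (determined with-property P)))
theorem6p3p1 em R unital 𝒯 P axiomatizable definable (B , B⊨ , PB) =
  𝔊 , 𝔊-dense , 𝔊-Gδ , determined , 𝔊ₚ-Gδ , λ complete → 𝔊ₚ-dense complete B B⊨ PB
  where open Development.Main em R unital 𝒯 P axiomatizable definable
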